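{- Let $q\equiv1\pmod 4$ and let $A$ be a multiplicative character of $\mathbb{F}_q$ with $A^2\notin\{\varepsilon,\varphi,\chi_4,\overline{\chi_4}\}$. Put $N=g(A^2\chi_4)\,g(\overline{A^2}\chi_4)$ and let $F(t)={}_4F_3(A^2,A^2\varphi,A^2\chi_4,A^2\overline{\chi_4};\,A^4\varphi,A^4,\varphi\mid t)$. Then for every $x\in\mathbb{F}_q$ with $x\neq0,1$: (i) \begin{align*} F(4x(1-x))&=\frac{(\overline{A^4}\varphi)(2)}{g(\varphi)\,N}\left(\frac{1+\varphi(1-x)}{2}\right)\left(\frac{1+\varphi(x)}{2}\right)\Big(\overline{A^4}(1+\sqrt{1-x})+\overline{A^4}(1-\sqrt{1-x})\Big)\\ &\qquad\times\Big(\overline{A^4}(1+\sqrt{x})+\overline{A^4}(1-\sqrt{x})\Big)-\frac{(A^2\varphi)(x)\,(\overline{A^4}\varphi)(2)\,\overline{A^6}(x-1)\,g(\varphi)}{q\,N}\,\delta\!\left(\frac{1-2x}{(1-x)^2}\right); \end{align*} (ii) \begin{align*} F\!\left(\frac{ -4x}{(1-x)^2}\right)&=\frac{(\overline{A^4}\varphi)(2)}{g(\varphi)\,N}\cdot\frac{(1+\varphi(1-x))(1+\varphi(x^2-x))}{4}\Big(\overline{A^4}\big(1+\tfrac{1}{\sqrt{1-x}}\big)+\overline{A^4}\big(1-\tfrac{1}{\sqrt{1-x}}\big)\Big)\\ &\qquad\times\Big(\overline{A^4}\big(1+\sqrt{\tfrac{x}{x-1}}\big)+\overline{A^4}\big(1-\sqrt{\tfrac{x}{x-1}}\big)\Big)-\frac{(A^2\varphi)(x)\,(\overline{A^4}\varphi)(2)\,(A^4\varphi)(x-1)\,g(\varphi)}{q\,N}\,\delta(1-x^2).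 \end{align*}
   Context: Let $p$ be an odd prime, $q=p^r$, and $\mathbb{F}_q$ the field with $q$ elements. Multiplicative characters of $\mathbb{F}_q^\times$ are extended to $\mathbb{F}_q$ by $\chi(0)=0$ (including the trivial character $\varepsilon$). $\varphi$ is the quadratic character and, when $q\equiv1\pmod4$, $\chi_4$ is a fixed character of order $4$. Characters are multiplied pointwise, $\overline{A}$ is the inverse of $A$, and $(\overline{A^4}\varphi)(2)$ etc. means the product character evaluated at that element. For $x\in\mathbb{F}_q$, $\delta(x)=1$ if $x=0$ and $0$ otherwise. Square roots $\sqrt{\cdot}$ denote any square root in $\mathbb{F}_q$ (the expressions are independent of the choice); whenever one of the relevant elements is not a square, the accompanying factor $1+\varphi(\cdot)$ vanishes and the whole product term is interpreted as $0$. The Gauss sum is $g(\chi)=\sum_{x\in\mathbb{F}_q}\chi(x)\theta(x)$ with $\theta(\alpha)=\zeta_p^{\mathrm{tr}(\alpha)}$, $\zeta_p$ a fixed primitive $p$-th root of unity, $\mathrm{tr}$ the trace to $\mathbb{F}_p$. The binomial coefficient is $\binom{A}{B}=\frac{B(-1)}{q}\sum_{x\in\mathbb{F}_q}A(x)\overline{B}(1-x)$. Greene's series: ${}_{n+1}F_n(A_0,\dots,A_n;\,B_1,\dots,B_n\mid x)=\frac{q}{q-1}\sum_{\chi}\binom{A_0\chi}{\chi}\prod_{i=1}^n\binom{A_i\chi}{B_i\chi}\chi(x)$, summed over all multiplicative characters $\chi$. -}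

module Defs where

open import Data.Nat as ℕ using (ℕ; zero; suc; _∸_)
open import Data.Nat.Primality using (Prime)
open import Data.List using (List; []; _∷_; map; foldr; upTo; length)
open import Data.List.Membership.Propositional using (_∈_)
open import Data.List.Relation.Unary.Unique.Propositional using (Unique)
open import Data.Maybe using (Maybe; just; nothing; fromMaybe)
open import Data.Product using (Σ; ∃; _×_; _,_)
open import Relation.Binary.PropositionalEquality using (_≡_)
open import Relation.Binary.Definitions using (DecidableEquality)
open import Relation.Nullary using (¬_; Dec; yes; no)
open import Algebra.Structures using (IsCommutativeRing)

-- A field, with propositional equality as its equality.  The inverse is a
-- total function; its value at 0 is unconstrained (only used at nonzero
-- arguments in the theorem).

record Fld : Set₁ where
  infixl 6 _+_ _-_
  infixl 7 _*_
  infix  8 -_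
  infixr 9 _^_
  field
    Carrier    : Set
    _+_ _*_    : Carrier → Carrier → Carrier
    -_         : Carrier → Carrier
    0# 1#      : Carrier
    isCommRing : IsCommutativeRing _≡_ _+_ _*_ -_ 0# 1#
    _⁻¹        : Carrier → Carrier
    inverse    : ∀ x → ¬ x ≡ 0# → x * (x ⁻¹) ≡ 1#
    0≢1        : ¬ 0# ≡ 1#
    _≟_        : DecidableEquality Carrier

  _-_ : Carrier → Carrier → Carrier
  x - y = x + (- y)

  _^_ : Carrier → ℕ → Carrier
  x ^ zero  = 1#
  x ^ suc n = x * (x ^ n)

  _×1 : ℕ → Carrier
  zero ×1  = 0#
  suc n ×1 = 1# + (n ×1)

  sumL : {X : Set} → (X → Carrier) → List X → Carrier
  sumL f = foldr (λ a s → f a + s) 0#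

  prodL : {X : Set} → (X → Carrier) → List X → Carrier
  prodL f = foldr (λ a s → f a * s) 1#

  CharZero : Set
  CharZero = ∀ n → n ×1 ≡ 0# → n ≡ zero

record FiniteField (p r : ℕ) : Set₁ where
  field
    fld      : Fld
  open Fld fld public
  field
    elems    : List Carrier
    complete : ∀ x → x ∈ elems
    unique   : Unique elems
    card     : length elems ≡ p ℕ.^ r
    charp    : p ×1 ≡ 0#

findL : {X : Set} {P : X → Set} → ((x : X) → Dec (P x)) → List X → Maybe X
findL P? []       = nothing
findL P? (x ∷ xs) with P? x
... | yes _ = just x
... | no  _ = findL P? xs

-- Everything depends on the finite field F_q, the target field K
-- (a field of characteristic 0, playing the role of ℂ), a primitive
-- p-th root of unity ζ in K, a primitive (q-1)-th root of unity ω in K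
-- and a generator g of F_q^×; ω and g are used only to enumerate the
-- multiplicative characters (the enumeration does not depend on them).

module Setup {p r : ℕ} (Fq : FiniteField p r) (K : Fld) (ζ ω : Fld.Carrier K)
             (g : FiniteField.Carrier Fq) where

  module F = FiniteField Fq
  module K = Fld K

  q : ℕ
  q = p ℕ.^ r

  Fe : Set
  Fe = F.Carrier

  Char : Set
  Char = Fe → K.Carrier

  IsChar : Char → Set
  IsChar χ = (χ F.0# ≡ K.0#) × (χ F.1# ≡ K.1#)
             × (∀ x y → χ (x F.* y) ≡ χ x K.* χ y)

  _≐_ : Char → Char → Set
  χ ≐ ψ = ∀ x → χ x ≡ ψ x

  ε : Char
  ε x with x F.≟ F.0#
  ... | yes _ = K.0#
  ... | no  _ = K.1#

  _⊗_ : Char → Char → Char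
  (χ ⊗ ψ) x = χ x K.* ψ x

  bar : Char → Char
  bar χ x with x F.≟ F.0#
  ... | yes _ = K.0#
  ... | no  _ = χ (x F.⁻¹)

  pow : Char → ℕ → Char
  pow χ zero    = ε
  pow χ (suc n) = χ ⊗ pow χ n

  sqrtM : Fe → Maybe Fe
  sqrtM x = findL (λ y → (y F.* y) F.≟ x) F.elems

  -- a chosen square root (an arbitrary value, 0, if x is not a square)
  sqrt : Fe → Fe
  sqrt x = fromMaybe F.0# (sqrtM x)

  φ : Char
  φ x with x F.≟ F.0#
  ... | yes _ = K.0#
  ... | no  _ with sqrtM x
  ...   | just _  = K.1#
  ...   | nothing = K.- K.1#

  δ : Fe → K.Carrier
  δ x with x F.≟ F.0#
  ... | yes _ = K.1#
  ... | no  _ = K.0#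

  tr : Fe → Fe
  tr α = F.sumL (λ i → α F.^ (p ℕ.^ i)) (upTo r)

  trNat : Fe → ℕ
  trNat α = fromMaybe 0 (findL (λ k → (k F.×1) F.≟ tr α) (upTo p))

  θ : Fe → K.Carrier
  θ α = ζ K.^ trNat α

  gauss : Char → K.Carrier
  gauss χ = K.sumL (λ x → χ x K.* θ x) F.elems

  qK : K.Carrier
  qK = q K.×1

  binom : Char → Char → K.Carrier
  binom A B = B (F.- F.1#) K.* ((qK K.⁻¹)
              K.* K.sumL (λ x → A x K.* bar B (F.1# F.- x)) F.elems)

  dlog : Fe → ℕ
  dlog x = fromMaybe 0 (findL (λ j → (g F.^ j) F.≟ x) (upTo (q ∸ 1)))

  charK : ℕ → Char
  charK k x with x F.≟ F.0#
  ... | yes _ = K.0#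
  ... | no  _ = ω K.^ (k ℕ.* dlog x)

  allChars : List Char
  allChars = map charK (upTo (q ∸ 1))

  -- Greene's 4F3
  F43 : (A0 A1 A2 A3 B1 B2 B3 : Char) → Fe → K.Carrier
  F43 A0 A1 A2 A3 B1 B2 B3 t =
    (qK K.* (((q ∸ 1) K.×1) K.⁻¹))
    K.* K.sumL (λ χ → binom (A0 ⊗ χ) χ
                      K.* binom (A1 ⊗ χ) (B1 ⊗ χ)
                      K.* binom (A2 ⊗ χ) (B2 ⊗ χ)
                      K.* binom (A3 ⊗ χ) (B3 ⊗ χ)
                      K.* χ t) allChars

  PrimitivePthRoot : Set
  PrimitivePthRoot = (ζ K.^ p ≡ K.1#) × ¬ (ζ ≡ K.1#)

  PrimitiveRoot-q-1 : Set
  PrimitiveRoot-q-1 = (ω K.^ (q ∸ 1) ≡ K.1#)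
    × (∀ k → 0 ℕ.< k → k ℕ.< q ∸ 1 → ¬ (ω K.^ k ≡ K.1#))

  Generator : Set
  Generator = ∀ x → ¬ x ≡ F.0# → ∃ λ j → g F.^ j ≡ x

  module Thm (A χ4 : Char) where

    A2 A4 A4b A6b : Char
    A2  = pow A 2
    A4  = pow A 4
    A4b = bar (pow A 4)
    A6b = bar (pow A 6)

    two four : Fe
    two  = 2 F.×1
    four = 4 F.×1

    N : K.Carrier
    N = gauss (A2 ⊗ χ4) K.* gauss (bar A2 ⊗ χ4)

    Fn : Fe → K.Carrier
    Fn = F43 A2 (A2 ⊗ φ) (A2 ⊗ χ4) (A2 ⊗ bar χ4) (A4 ⊗ φ) A4 φ

    c : K.Carrier
    c = (A4b ⊗ φ) two

    half : Fe → K.Carrier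
    half y = (K.1# K.+ φ y) K.* ((2 K.×1) K.⁻¹)

    T : Fe → K.Carrier
    T s = A4b (F.1# F.+ s) K.+ A4b (F.1# F.- s)

    claim-i : Fe → Set
    claim-i x =
      Fn (four F.* x F.* (F.1# F.- x))
      ≡ (c K.* ((gauss φ K.* N) K.⁻¹) K.* half (F.1# F.- x) K.* half x
           K.* T (sqrt (F.1# F.- x)) K.* T (sqrt x))
        K.- ((((A2 ⊗ φ) x K.* c K.* A6b (x F.- F.1#) K.* gauss φ)
              K.* ((qK K.* N) K.⁻¹))
             K.* δ ((F.1# F.- two F.* x) F.* (((F.1# F.- x) F.^ 2) F.⁻¹)))

    claim-ii : Fe → Set
    claim-ii x =
      Fn ((F.- (four F.* x)) F.* (((F.1# F.- x) F.^ 2) F.⁻¹))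
      ≡ (c K.* ((gauss φ K.* N) K.⁻¹)
           K.* ((K.1# K.+ φ (F.1# F.- x)) K.* (K.1# K.+ φ (x F.^ 2 F.- x))
                K.* ((4 K.×1) K.⁻¹))
           K.* T ((sqrt (F.1# F.- x)) F.⁻¹)
           K.* T (sqrt (x F.* ((x F.- F.1#) F.⁻¹))))
        K.- ((((A2 ⊗ φ) x K.* c K.* (A4 ⊗ φ) (x F.- F.1#) K.* gauss φ)
              K.* ((qK K.* N) K.⁻¹))
             K.* δ (F.1# F.- x F.^ 2))

{-# OPTIONS --safe #-}
module Submission where

-- Each binomial in the series is a Jacobi sum, hence a quotient of Gauss sums;
-- the Hasse-Davenport relation for duplication turns the eight Gauss sums
-- containing χ into G(A⁸χ⁴) G(χ⁻²) G(A⁻⁸χ⁻²), which is again a single Jacobi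
-- sum.  Expanding it in χ² and using orthogonality, F(t) is a multiple of the
-- sum of A⁻⁴((1 + v)²) over the v with (v² - 1)² = t.
--
-- For t = 4x(1 - x) these v are the sums a + b with a² = x and b² = 1 - x, and
-- then (1 + v)² = 2(1 + a)(1 + b), so the sum factors.  The delta term comes
-- from the degenerate case v = 0, i.e. 2x = 1.  Part (ii) is part (i) at
-- 1/(1 - x).

open import Defs
open import Data.Nat as ℕ using (ℕ; zero; suc; _∸_; _%_; _/_; NonZero)
import Data.Nat.Properties as ℕₚ
import Data.Nat.Divisibility as ∣
open import Data.Nat.Divisibility using (_∣_; divides; m%n≡0⇒n∣m)
open import Data.Nat.DivMod using (m≡m%n+[m/n]*n; m%n<n)
open import Data.Nat.Coprimality using (Coprime; coprime-Bézout; prime⇒coprime)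
open import Data.Nat.GCD using (module Bézout)
open import Data.Nat.Primality using (Prime; prime⇒nonZero; prime⇒nonTrivial; euclidsLemma)
open import Data.Nat.Combinatorics using (_C_; nCk+nC[k+1]≡[n+1]C[k+1]; nC1≡n; nCn≡1)
open import Data.Nat.Solver using (module +-*-Solver)
open import Data.Integer as ℤ using (ℤ; -[1+_]) renaming (+_ to pos)
import Data.Integer.Properties as ℤₚ
open import Data.Fin as Fin using (Fin; toℕ)
import Data.Fin.Properties as Finₚ
open import Data.List using (List; []; _∷_; map; upTo; applyUpTo; length; lookup; _∷ʳ_)
import Data.List.Properties as Listₚ
open import Data.List.Membership.Propositional using (_∈_)
open import Data.List.Membership.Propositional.Properties
  using (∈-lookup; ∈-upTo⁺; ∈-upTo⁻; ∈-map⁺; ∈-applyUpTo⁻)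
open import Data.List.Relation.Unary.Any using (here; there; index)
open import Data.List.Relation.Unary.Any.Properties using (lookup-index)
open import Data.List.Relation.Unary.All as All using (All; []; _∷_)
open import Data.List.Relation.Unary.AllPairs using ([]; _∷_)
open import Data.List.Relation.Unary.Unique.Propositional using (Unique)
import Data.List.Relation.Unary.Unique.Propositional.Properties as Uniqueₚ
open import Data.Maybe using (Maybe; just; nothing)
open import Data.Product using (∃; _×_; _,_; proj₁; proj₂)
open import Data.Sum using (_⊎_; inj₁; inj₂)
open import Relation.Binary.Definitions using (tri<; tri≈; tri>)
open import Relation.Binary.PropositionalEquality hiding (J)
open import Relation.Nullary using (¬_; Dec; yes; no; contradiction)
open import Algebra.Bundles using (CommutativeRing; Semiring; Monoid)
import Algebra.Properties.Ring as RingProperties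
import Algebra.Properties.CommutativeSemiring.Binomial as Binomial
import Algebra.Properties.Semiring.Sum as Sum
import Algebra.Definitions.RawMonoid as RawMonoidOps
import Algebra.Definitions.RawSemiring as RawSemiringOps
import Algebra.Solver.Ring as RingSolver
open import Algebra.Solver.Ring.AlmostCommutativeRing
  using (fromCommutativeRing; _-Raw-AlmostCommutative⟶_)

-- The condition on A enters as A⁸ ≠ ε: the values at g of the four excluded characters are the
-- fourth roots of unity 1, -1, i, -i. It keeps the product of the two characters in each of the
-- four Jacobi sums nontrivial for every χ, so no exceptional χ has to be split off, and it keeps
-- the final Jacobi sum away from J(ε, ε), where the formula in Gauss sums fails. The shape of the
-- parameters is what lets duplication run twice. The upper characters A²χ, A²φχ, A²χ₄χ, A²χ₄⁻¹χ
-- form two pairs differing by φ; since χ₄² = φ, the two resulting squares again differ by φ and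
-- merge into the fourth power A⁸χ⁴. The lower characters merge only once, which leaves squares. K
-- is an arbitrary field of characteristic 0, without absolute value or conjugation. Gauss sums are
-- shown to be nonzero through G(u) G(u⁻¹) = u(-1) q, which rests on the additive character being
-- nontrivial, hence on an element of nonzero trace. All denominators are cleared before the
-- computation and cancelled at its end.

module _ {X : Set} where

  lookup-injective : ∀ {xs : List X} → Unique xs → ∀ i j → lookup xs i ≡ lookup xs j → i ≡ j
  lookup-injective (_ ∷ _) Fin.zero Fin.zero e = refl
  lookup-injective (x∉ ∷ _) Fin.zero (Fin.suc j) e = contradiction e (All.lookup x∉ (∈-lookup j))
  lookup-injective (x∉ ∷ _) (Fin.suc i) Fin.zero e = contradiction (sym e) (All.lookup x∉ (∈-lookup i))
  lookup-injective (_ ∷ u) (Fin.suc i) (Fin.suc j) e = cong Fin.suc (lookup-injective u i j e)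

  -- The counting principle behind the bound on q, the order of g and the number of Frobenius fixed
  -- points: sending a position in `xs` to the position of the same element in `ys` is injective.
  unique-⊆⇒length-≤ : ∀ {xs ys : List X} → Unique xs → (∀ {x} → x ∈ xs → x ∈ ys) →
    length xs ℕ.≤ length ys
  unique-⊆⇒length-≤ {xs} {ys} u sub = Finₚ.injective⇒≤ {f = λ i → index (sub (∈-lookup i))}
    (λ {i} {j} e → lookup-injective u i j
      (trans (lookup-index (sub (∈-lookup i)))
        (trans (cong (lookup ys) e) (sym (lookup-index (sub (∈-lookup j)))))))

  findL-just : {P : X → Set} (P? : ∀ x → Dec (P x)) → ∀ xs {y} → findL P? xs ≡ just y → y ∈ xs × P y
  findL-just P? (x ∷ xs) e with P? x
  findL-just P? (x ∷ xs) refl | yes px = here refl , px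
  ... | no _ = there (proj₁ (findL-just P? xs e)) , proj₂ (findL-just P? xs e)

  findL-nothing : {P : X → Set} (P? : ∀ x → Dec (P x)) → ∀ xs → findL P? xs ≡ nothing →
    ∀ {x} → x ∈ xs → ¬ P x
  findL-nothing P? (x ∷ xs) e m with P? x
  findL-nothing P? (x ∷ xs) () m | yes px
  findL-nothing P? (x ∷ xs) e (here refl) | no ¬px = ¬px
  findL-nothing P? (x ∷ xs) e (there m)   | no ¬px = findL-nothing P? xs e m

-- Absorption identity. For prime `suc n` it lets Euclid's lemma show that the inner binomial
-- coefficients are divisible by `suc n`.
k*nCk : ∀ n k → suc k ℕ.* (suc n C suc k) ≡ suc n ℕ.* (n C k)
k*nCk n zero = trans (ℕₚ.*-identityˡ _) (trans (nC1≡n (suc n)) (sym (ℕₚ.*-identityʳ (suc n))))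
k*nCk zero (suc k) = ℕₚ.*-zeroʳ (suc (suc k))
k*nCk (suc n) (suc k) = begin
  2+k ℕ.* (suc (suc n) C 2+k)                      ≡⟨ cong (2+k ℕ.*_) (nCk+nC[k+1]≡[n+1]C[k+1] (suc n) (suc k)) ⟨
  2+k ℕ.* (a ℕ.+ b)                                ≡⟨ solve 3 (λ k a b → (con 2 :+ k) :* (a :+ b) := a :+ ((con 1 :+ k) :* a) :+ (con 2 :+ k) :* b) refl k a b ⟩
  a ℕ.+ (suc k ℕ.* a) ℕ.+ 2+k ℕ.* b                ≡⟨ cong₂ (λ u v → a ℕ.+ u ℕ.+ v) (k*nCk n k) (k*nCk n (suc k)) ⟩
  a ℕ.+ (suc n ℕ.* (n C k)) ℕ.+ suc n ℕ.* (n C suc k)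
      ≡⟨ solve 4 (λ n a u v → a :+ ((con 1 :+ n) :* u) :+ (con 1 :+ n) :* v := a :+ (con 1 :+ n) :* (u :+ v)) refl n a (n C k) (n C suc k) ⟩
  a ℕ.+ suc n ℕ.* ((n C k) ℕ.+ (n C suc k))        ≡⟨ cong (λ u → a ℕ.+ suc n ℕ.* u) (nCk+nC[k+1]≡[n+1]C[k+1] n k) ⟩
  a ℕ.+ suc n ℕ.* a                                ∎
  where
  open ≡-Reasoning
  open +-*-Solver
  2+k = suc (suc k)
  a = suc n C suc k
  b = suc n C 2+k

-- Arithmetic in a field, with a ring solver over integer coefficients

module FieldProperties (L : Fld) where
  open Fld L

  commRing : CommutativeRing _ _
  commRing = record { isCommutativeRing = isCommRing }

  open CommutativeRing commRing public
    using (+-assoc; +-comm; +-identityˡ; +-identityʳ; -‿inverseʳ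
          ; *-assoc; *-comm; *-identityˡ; *-identityʳ; distribˡ; distribʳ; zeroˡ; zeroʳ)
  open RingProperties (CommutativeRing.ring commRing) public
    using (-‿distribˡ-*; -‿distribʳ-*; -‿involutive; -0#≈0#; -‿+-comm)
  open ≡-Reasoning

  ×1-+ : ∀ m n → (m ℕ.+ n) ×1 ≡ m ×1 + n ×1
  ×1-+ zero    n = sym (+-identityˡ _)
  ×1-+ (suc m) n = trans (cong (1# +_) (×1-+ m n)) (sym (+-assoc _ _ _))

  ×1-* : ∀ m n → (m ℕ.* n) ×1 ≡ m ×1 * n ×1
  ×1-* zero    n = sym (zeroˡ _)
  ×1-* (suc m) n = begin
    (n ℕ.+ m ℕ.* n) ×1           ≡⟨ ×1-+ n (m ℕ.* n) ⟩
    n ×1 + (m ℕ.* n) ×1          ≡⟨ cong₂ _+_ (sym (*-identityˡ _)) (×1-* m n) ⟩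
    1# * n ×1 + m ×1 * n ×1      ≡⟨ distribʳ _ _ _ ⟨
    (1# + m ×1) * n ×1           ∎

  -- Agrees with _×1, but sends 1 to 1# definitionally, so that the
  -- solver's constants match both 1# and the numerals n ×1 with n ≠ 1.
  fromℕ : ℕ → Carrier
  fromℕ zero          = 0#
  fromℕ (suc zero)    = 1#
  fromℕ (suc (suc n)) = suc (suc n) ×1

  fromℕ≡×1 : ∀ n → fromℕ n ≡ n ×1
  fromℕ≡×1 zero          = refl
  fromℕ≡×1 (suc zero)    = sym (+-identityʳ 1#)
  fromℕ≡×1 (suc (suc n)) = refl

  fromℤ : ℤ → Carrier
  fromℤ (pos n)      = fromℕ n
  fromℤ (-[1+ n ]) = - fromℕ (suc n)

  private
    -- Follows the recursion of `_×1` without the exception at 1, so the homomorphism laws are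
    -- proved here by induction and carried over to `fromℤ` by `fromℤ≡`.
    fromℤ′ : ℤ → Carrier
    fromℤ′ (pos n)      = n ×1
    fromℤ′ (-[1+ n ]) = - (suc n ×1)

    fromℤ≡ : ∀ i → fromℤ i ≡ fromℤ′ i
    fromℤ≡ (pos n)      = fromℕ≡×1 n
    fromℤ≡ (-[1+ n ]) = cong -_ (fromℕ≡×1 (suc n))

    cancel-1 : ∀ x y → (1# + x) - (1# + y) ≡ x - y
    cancel-1 x y = begin
      (1# + x) + (- (1# + y))     ≡⟨ cong₂ _+_ (+-comm 1# x) (sym (-‿+-comm 1# y)) ⟩
      (x + 1#) + (- 1# + (- y))   ≡⟨ +-assoc x 1# _ ⟩
      x + (1# + (- 1# + (- y)))   ≡⟨ cong (x +_) (+-assoc 1# _ _) ⟨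
      x + ((1# + (- 1#)) + (- y)) ≡⟨ cong (λ z → x + (z + (- y))) (-‿inverseʳ 1#) ⟩
      x + (0# + (- y))            ≡⟨ cong (x +_) (+-identityˡ _) ⟩
      x + (- y)                   ∎

    ⊖-homo : ∀ m n → fromℤ′ (m ℤ.⊖ n) ≡ m ×1 - n ×1
    ⊖-homo m zero = begin
      fromℤ′ (m ℤ.⊖ 0)   ≡⟨ cong fromℤ′ (ℤₚ.⊖-≥ {m} {0} ℕ.z≤n) ⟩
      m ×1              ≡⟨ +-identityʳ _ ⟨
      m ×1 + 0#         ≡⟨ cong (m ×1 +_) -0#≈0# ⟨
      m ×1 + (- 0#)     ∎
    ⊖-homo zero    (suc n) = sym (+-identityˡ _)
    ⊖-homo (suc m) (suc n) = begin
      fromℤ′ (suc m ℤ.⊖ suc n)       ≡⟨ cong fromℤ′ (ℤₚ.[1+m]⊖[1+n]≡m⊖n m n) ⟩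
      fromℤ′ (m ℤ.⊖ n)               ≡⟨ ⊖-homo m n ⟩
      m ×1 - n ×1                   ≡⟨ cancel-1 _ _ ⟨
      (1# + m ×1) - (1# + n ×1)     ∎

    +-homo′ : ∀ i j → fromℤ′ (i ℤ.+ j) ≡ fromℤ′ i + fromℤ′ j
    +-homo′ (pos m)      (pos n)      = ×1-+ m n
    +-homo′ (pos m)      (-[1+ n ]) = ⊖-homo m (suc n)
    +-homo′ (-[1+ m ]) (pos n)      = trans (⊖-homo n (suc m)) (+-comm _ _)
    +-homo′ (-[1+ m ]) (-[1+ n ]) = begin
      - (suc (suc (m ℕ.+ n)) ×1)       ≡⟨ cong (λ k → - (suc k ×1)) (ℕₚ.+-suc m n) ⟨
      - ((suc m ℕ.+ suc n) ×1)         ≡⟨ cong -_ (×1-+ (suc m) (suc n)) ⟩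
      - (suc m ×1 + suc n ×1)          ≡⟨ -‿+-comm _ _ ⟨
      - (suc m ×1) + - (suc n ×1)      ∎

    -‿homo′ : ∀ i → fromℤ′ (ℤ.- i) ≡ - fromℤ′ i
    -‿homo′ (pos zero)   = sym -0#≈0#
    -‿homo′ (pos (suc n))  = refl
    -‿homo′ (-[1+ n ]) = sym (-‿involutive _)

    *-homo⁺ : ∀ m j → fromℤ′ (pos m ℤ.* j) ≡ m ×1 * fromℤ′ j
    *-homo⁺ m (pos n) = trans (cong fromℤ′ (sym (ℤₚ.pos-* m n))) (×1-* m n)
    *-homo⁺ m (-[1+ n ]) = begin
      fromℤ′ (pos m ℤ.* (ℤ.- (pos (suc n))))   ≡⟨ cong fromℤ′ (ℤₚ.neg-distribʳ-* (pos m) (pos (suc n))) ⟨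
      fromℤ′ (ℤ.- (pos m ℤ.* pos (suc n)))     ≡⟨ -‿homo′ (pos m ℤ.* pos (suc n)) ⟩
      - fromℤ′ (pos m ℤ.* pos (suc n))         ≡⟨ cong -_ (*-homo⁺ m (pos (suc n))) ⟩
      - (m ×1 * suc n ×1)               ≡⟨ -‿distribʳ-* _ _ ⟩
      m ×1 * (- (suc n ×1))             ∎

    *-homo′ : ∀ i j → fromℤ′ (i ℤ.* j) ≡ fromℤ′ i * fromℤ′ j
    *-homo′ (pos m)      j = *-homo⁺ m j
    *-homo′ (-[1+ m ]) j = begin
      fromℤ′ ((ℤ.- (pos (suc m))) ℤ.* j)   ≡⟨ cong fromℤ′ (ℤₚ.neg-distribˡ-* (pos (suc m)) j) ⟨
      fromℤ′ (ℤ.- (pos (suc m) ℤ.* j))     ≡⟨ -‿homo′ (pos (suc m) ℤ.* j) ⟩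
      - fromℤ′ (pos (suc m) ℤ.* j)         ≡⟨ cong -_ (*-homo⁺ (suc m) j) ⟩
      - (suc m ×1 * fromℤ′ j)         ≡⟨ -‿distribˡ-* _ _ ⟩
      (- (suc m ×1)) * fromℤ′ j       ∎

    ℤ-morphism : CommutativeRing.rawRing ℤₚ.+-*-commutativeRing
                 -Raw-AlmostCommutative⟶ fromCommutativeRing commRing
    ℤ-morphism = record
      { ⟦_⟧    = fromℤ
      ; +-homo = λ i j → trans (fromℤ≡ (i ℤ.+ j)) (trans (+-homo′ i j) (sym (cong₂ _+_ (fromℤ≡ i) (fromℤ≡ j))))
      ; *-homo = λ i j → trans (fromℤ≡ (i ℤ.* j)) (trans (*-homo′ i j) (sym (cong₂ _*_ (fromℤ≡ i) (fromℤ≡ j))))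
      ; -‿homo = λ i → trans (fromℤ≡ (ℤ.- i)) (trans (-‿homo′ i) (sym (cong -_ (fromℤ≡ i))))
      ; 0-homo = refl
      ; 1-homo = refl
      }

    weakly≟ : ∀ i j → Maybe (fromℤ i ≡ fromℤ j)
    weakly≟ i j with i ℤ.≟ j
    ... | yes i≡j = just (cong fromℤ i≡j)
    ... | no  _   = nothing

  open RingSolver (CommutativeRing.rawRing ℤₚ.+-*-commutativeRing)
    (fromCommutativeRing commRing) ℤ-morphism weakly≟ public
    using (solve; _:=_; con; _:+_; _:*_; :-_; _:-_; Polynomial)

  :0 :1 :2 :4 : ∀ {n} → Polynomial n
  :0 = con (pos 0)
  :1 = con (pos 1)
  :2 = con (pos 2)
  :4 = con (pos 4)

  x-y≡0⇒x≡y : ∀ {x y} → x - y ≡ 0# → x ≡ y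
  x-y≡0⇒x≡y {x} {y} e = begin
    x           ≡⟨ solve 2 (λ x y → x := (x :- y) :+ y) refl x y ⟩
    (x - y) + y ≡⟨ cong (_+ y) e ⟩
    0# + y      ≡⟨ +-identityˡ y ⟩
    y           ∎

  x≡y⇒x-y≡0 : ∀ {x y} → x ≡ y → x - y ≡ 0#
  x≡y⇒x-y≡0 {x} refl = -‿inverseʳ x

  +-cancelˡ : ∀ x {y z} → x + y ≡ x + z → y ≡ z
  +-cancelˡ x {y} {z} e = begin
    y                ≡⟨ solve 2 (λ x y → y := (:- x) :+ (x :+ y)) refl x y ⟩
    (- x) + (x + y)  ≡⟨ cong ((- x) +_) e ⟩
    (- x) + (x + z)  ≡⟨ solve 2 (λ x y → (:- x) :+ (x :+ y) := y) refl x z ⟩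
    z                ∎

  *-cancelˡ : ∀ {x y z} → ¬ x ≡ 0# → x * y ≡ x * z → y ≡ z
  *-cancelˡ {x} {y} {z} x≢0 e = begin
    y                 ≡⟨ undo y ⟩
    (x ⁻¹) * (x * y)  ≡⟨ cong ((x ⁻¹) *_) e ⟩
    (x ⁻¹) * (x * z)  ≡⟨ undo z ⟨
    z                 ∎
    where
    undo : ∀ y → y ≡ (x ⁻¹) * (x * y)
    undo y = begin
      y                ≡⟨ *-identityˡ y ⟨
      1# * y           ≡⟨ cong (_* y) (inverse x x≢0) ⟨
      (x * x ⁻¹) * y   ≡⟨ solve 3 (λ x i y → x :* i :* y := i :* (x :* y)) refl x (x ⁻¹) y ⟩
      (x ⁻¹) * (x * y) ∎

  *-zero-cases : ∀ {x y} → x * y ≡ 0# → x ≡ 0# ⊎ y ≡ 0#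
  *-zero-cases {x} {y} e with x ≟ 0#
  ... | yes x≡0 = inj₁ x≡0
  ... | no  x≢0 = inj₂ (*-cancelˡ x≢0 (trans e (sym (zeroʳ x))))

  *-nonzero : ∀ {x y} → ¬ x ≡ 0# → ¬ y ≡ 0# → ¬ x * y ≡ 0#
  *-nonzero x≢0 y≢0 e with *-zero-cases e
  ... | inj₁ x≡0 = x≢0 x≡0
  ... | inj₂ y≡0 = y≢0 y≡0

  unit⇒nonzero : ∀ {x y} → x * y ≡ 1# → ¬ x ≡ 0#
  unit⇒nonzero {x} {y} e refl = 0≢1 (trans (sym (zeroˡ y)) e)

  ⁻¹-nonzero : ∀ {x} → ¬ x ≡ 0# → ¬ x ⁻¹ ≡ 0#
  ⁻¹-nonzero {x} x≢0 = unit⇒nonzero (trans (*-comm (x ⁻¹) x) (inverse x x≢0))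

  ⁻¹-unique : ∀ {x y} → x * y ≡ 1# → x ⁻¹ ≡ y
  ⁻¹-unique {x} {y} e = *-cancelˡ (unit⇒nonzero e) (trans (inverse x (unit⇒nonzero e)) (sym e))

  neg-nonzero : ∀ {x} → ¬ x ≡ 0# → ¬ - x ≡ 0#
  neg-nonzero {x} x≢0 e = x≢0 (trans (sym (-‿involutive x)) (trans (cong -_ e) -0#≈0#))

  square≡1 : ∀ {x} → x * x ≡ 1# → x ≡ 1# ⊎ x ≡ - 1#
  square≡1 {x} e with *-zero-cases {x - 1#} {x + 1#}
      (trans (solve 1 (λ x → (x :- :1) :* (x :+ :1) := x :* x :- :1) refl x) (x≡y⇒x-y≡0 e))
  ... | inj₁ h = inj₁ (x-y≡0⇒x≡y h)
  ... | inj₂ h = inj₂ (x-y≡0⇒x≡y (trans (cong (x +_) (-‿involutive 1#)) h))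

  square≡square : ∀ {x y} → x * x ≡ y * y → x ≡ y ⊎ x ≡ - y
  square≡square {x} {y} e with *-zero-cases {x - y} {x + y}
      (trans (solve 2 (λ x y → (x :- y) :* (x :+ y) := x :* x :- y :* y) refl x y) (x≡y⇒x-y≡0 e))
  ... | inj₁ h = inj₁ (x-y≡0⇒x≡y h)
  ... | inj₂ h = inj₂ (x-y≡0⇒x≡y (trans (cong (x +_) (-‿involutive y)) h))

  ^-+ : ∀ x m n → x ^ (m ℕ.+ n) ≡ (x ^ m) * (x ^ n)
  ^-+ x zero    n = sym (*-identityˡ _)
  ^-+ x (suc m) n = trans (cong (x *_) (^-+ x m n)) (sym (*-assoc _ _ _))

  1^ : ∀ n → 1# ^ n ≡ 1#
  1^ zero    = refl
  1^ (suc n) = trans (*-identityˡ _) (1^ n)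

  ^-* : ∀ x m n → x ^ (m ℕ.* n) ≡ (x ^ m) ^ n
  ^-* x m zero    = cong (x ^_) (ℕₚ.*-zeroʳ m)
  ^-* x m (suc n) = begin
    x ^ (m ℕ.* suc n)          ≡⟨ cong (x ^_) (ℕₚ.*-suc m n) ⟩
    x ^ (m ℕ.+ m ℕ.* n)        ≡⟨ ^-+ x m (m ℕ.* n) ⟩
    (x ^ m) * x ^ (m ℕ.* n)    ≡⟨ cong ((x ^ m) *_) (^-* x m n) ⟩
    (x ^ m) * (x ^ m) ^ n      ∎

  ^-distrib-* : ∀ x y n → (x * y) ^ n ≡ (x ^ n) * (y ^ n)
  ^-distrib-* x y zero    = sym (*-identityˡ _)
  ^-distrib-* x y (suc n) = trans (cong ((x * y) *_) (^-distrib-* x y n))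
    (solve 4 (λ x y a b → x :* y :* (a :* b) := x :* a :* (y :* b)) refl x y (x ^ n) (y ^ n))

  ^-nonzero : ∀ {x} n → ¬ x ≡ 0# → ¬ x ^ n ≡ 0#
  ^-nonzero zero    x≢0 e = 0≢1 (sym e)
  ^-nonzero (suc n) x≢0   = *-nonzero x≢0 (^-nonzero n x≢0)

  -- Finite sums indexed by lists

  module _ {X : Set} where

    sumL-cong : ∀ {f h : X → Carrier} → (∀ x → f x ≡ h x) → ∀ xs → sumL f xs ≡ sumL h xs
    sumL-cong e []       = refl
    sumL-cong e (x ∷ xs) = cong₂ _+_ (e x) (sumL-cong e xs)

    sumL-0 : ∀ xs → sumL {X} (λ _ → 0#) xs ≡ 0#
    sumL-0 []       = refl
    sumL-0 (x ∷ xs) = trans (+-identityˡ _) (sumL-0 xs)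

    sumL-const : ∀ c xs → sumL {X} (λ _ → c) xs ≡ length xs ×1 * c
    sumL-const c []       = sym (zeroˡ c)
    sumL-const c (x ∷ xs) = begin
      c + sumL (λ _ → c) xs          ≡⟨ cong₂ _+_ (sym (*-identityˡ c)) (sumL-const c xs) ⟩
      1# * c + length xs ×1 * c      ≡⟨ distribʳ _ _ _ ⟨
      (1# + length xs ×1) * c        ∎

    sumL-+ : ∀ (f h : X → Carrier) xs → sumL (λ x → f x + h x) xs ≡ sumL f xs + sumL h xs
    sumL-+ f h []       = sym (+-identityˡ _)
    sumL-+ f h (x ∷ xs) = trans (cong ((f x + h x) +_) (sumL-+ f h xs))
      (solve 4 (λ a b s t → a :+ b :+ (s :+ t) := a :+ s :+ (b :+ t)) refl (f x) (h x) _ _)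

    sumL-*ˡ : ∀ c (f : X → Carrier) xs → sumL (λ x → c * f x) xs ≡ c * sumL f xs
    sumL-*ˡ c f []       = sym (zeroʳ c)
    sumL-*ˡ c f (x ∷ xs) = trans (cong ((c * f x) +_) (sumL-*ˡ c f xs)) (sym (distribˡ _ _ _))

    sumL-map : ∀ {Y : Set} (f : X → Carrier) (k : Y → X) ys → sumL f (map k ys) ≡ sumL (λ y → f (k y)) ys
    sumL-map f k []       = refl
    sumL-map f k (y ∷ ys) = cong (f (k y) +_) (sumL-map f k ys)

    sumL-swap : ∀ {Y : Set} (f : X → Y → Carrier) xs ys →
      sumL (λ x → sumL (f x) ys) xs ≡ sumL (λ y → sumL (λ x → f x y) xs) ys
    sumL-swap f []       ys = sym (sumL-0ʸ ys)
      where
      sumL-0ʸ : ∀ {Y : Set} (ys : List Y) → sumL (λ _ → 0#) ys ≡ 0#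
      sumL-0ʸ []       = refl
      sumL-0ʸ (y ∷ ys) = trans (+-identityˡ _) (sumL-0ʸ ys)
    sumL-swap {Y} f (x ∷ xs) ys = trans (cong (sumL (f x) ys +_) (sumL-swap f xs ys)) (sym (sumL-+ʸ ys))
      where
      sumL-+ʸ : ∀ ys → sumL (λ y → f x y + sumL (λ x → f x y) xs) ys
                     ≡ sumL (f x) ys + sumL (λ y → sumL (λ x → f x y) xs) ys
      sumL-+ʸ []       = sym (+-identityˡ _)
      sumL-+ʸ (y ∷ ys) = trans (cong ((f x y + sumL (λ x → f x y) xs) +_) (sumL-+ʸ ys))
        (solve 4 (λ a b s t → a :+ b :+ (s :+ t) := a :+ s :+ (b :+ t)) refl (f x y) _ _ _)

  -- Orders of elements and geometric sums

  ^-% : ∀ {w} n .{{_ : NonZero n}} → w ^ n ≡ 1# → ∀ j → w ^ (j % n) ≡ w ^ j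
  ^-% {w} n e j = begin
    w ^ (j % n)                        ≡⟨ *-identityʳ _ ⟨
    (w ^ (j % n)) * 1#                 ≡⟨ cong ((w ^ (j % n)) *_) (1^ (j / n)) ⟨
    (w ^ (j % n)) * 1# ^ (j / n)       ≡⟨ cong (λ z → (w ^ (j % n)) * z ^ (j / n)) e ⟨
    (w ^ (j % n)) * (w ^ n) ^ (j / n)  ≡⟨ cong ((w ^ (j % n)) *_) (^-* w n (j / n)) ⟨
    (w ^ (j % n)) * w ^ (n ℕ.* (j / n)) ≡⟨ ^-+ w (j % n) _ ⟨
    w ^ (j % n ℕ.+ n ℕ.* (j / n))      ≡⟨ cong (λ z → w ^ (j % n ℕ.+ z)) (ℕₚ.*-comm n (j / n)) ⟩
    w ^ (j % n ℕ.+ (j / n) ℕ.* n)      ≡⟨ cong (w ^_) (m≡m%n+[m/n]*n j n) ⟨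
    w ^ j                              ∎

  ×1-% : ∀ n .{{_ : NonZero n}} → n ×1 ≡ 0# → ∀ j → (j % n) ×1 ≡ j ×1
  ×1-% n e j = begin
    (j % n) ×1                          ≡⟨ +-identityʳ _ ⟨
    (j % n) ×1 + 0#                     ≡⟨ cong ((j % n) ×1 +_) (zeroʳ _) ⟨
    (j % n) ×1 + (j / n) ×1 * 0#        ≡⟨ cong (λ z → (j % n) ×1 + (j / n) ×1 * z) e ⟨
    (j % n) ×1 + (j / n) ×1 * n ×1      ≡⟨ cong ((j % n) ×1 +_) (×1-* (j / n) n) ⟨
    (j % n) ×1 + ((j / n) ℕ.* n) ×1     ≡⟨ ×1-+ (j % n) _ ⟨
    (j % n ℕ.+ (j / n) ℕ.* n) ×1        ≡⟨ cong _×1 (m≡m%n+[m/n]*n j n) ⟨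
    j ×1                                ∎

  private
    bézout-power : ∀ {w} x {m} → w ^ m ≡ 1# → ∀ y {n} → w ^ n ≡ 1# → 1 ℕ.+ y ℕ.* n ≡ x ℕ.* m → w ≡ 1#
    bézout-power {w} x {m} em y {n} en eq = begin
      w                         ≡⟨ *-identityʳ w ⟨
      w * 1#                    ≡⟨ cong (w *_) (trans (cong (_^ y) en) (1^ y)) ⟨
      w * (w ^ n) ^ y           ≡⟨ cong (w *_) (^-* w n y) ⟨
      w ^ suc (n ℕ.* y)         ≡⟨ cong (λ k → w ^ suc k) (ℕₚ.*-comm n y) ⟩
      w ^ (1 ℕ.+ y ℕ.* n)       ≡⟨ cong (w ^_) (trans eq (ℕₚ.*-comm x m)) ⟩
      w ^ (m ℕ.* x)             ≡⟨ ^-* w m x ⟩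
      (w ^ m) ^ x               ≡⟨ trans (cong (_^ x) em) (1^ x) ⟩
      1#                        ∎

  coprime-powers : ∀ {w m n} → Coprime m n → w ^ m ≡ 1# → w ^ n ≡ 1# → w ≡ 1#
  coprime-powers {w} c em en with coprime-Bézout c
  ... | Bézout.+- x y eq = bézout-power x em y en eq
  ... | Bézout.-+ x y eq = bézout-power y en x em eq

  coprime-multiples : ∀ {m n} → Coprime m n → m ×1 ≡ 0# → ¬ n ×1 ≡ 0#
  coprime-multiples {m} {n} c em en with coprime-Bézout c
  ... | Bézout.+- x y eq = 0≢1 (begin
      0#                        ≡⟨ trans (cong (x ×1 *_) em) (zeroʳ _) ⟨
      x ×1 * m ×1               ≡⟨ ×1-* x m ⟨
      (x ℕ.* m) ×1              ≡⟨ cong _×1 eq ⟨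
      1# + (y ℕ.* n) ×1         ≡⟨ cong (1# +_) (trans (×1-* y n) (trans (cong (y ×1 *_) en) (zeroʳ _))) ⟩
      1# + 0#                   ≡⟨ +-identityʳ 1# ⟩
      1#                        ∎)
  ... | Bézout.-+ x y eq = 0≢1 (begin
      0#                        ≡⟨ trans (cong (y ×1 *_) en) (zeroʳ _) ⟨
      y ×1 * n ×1               ≡⟨ ×1-* y n ⟨
      (y ℕ.* n) ×1              ≡⟨ cong _×1 eq ⟨
      1# + (x ℕ.* m) ×1         ≡⟨ cong (1# +_) (trans (×1-* x m) (trans (cong (x ×1 *_) em) (zeroʳ _))) ⟩
      1# + 0#                   ≡⟨ +-identityʳ 1# ⟩
      1#                        ∎)

  geometric : ∀ w m → (w - 1#) * sumL (w ^_) (upTo m) ≡ w ^ m - 1#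
  geometric w zero    = trans (zeroʳ _) (sym (-‿inverseʳ 1#))
  geometric w (suc m) = begin
    (w - 1#) * (1# + sumL (w ^_) (applyUpTo suc m))
      ≡⟨ cong (λ z → (w - 1#) * (1# + z)) shift ⟩
    (w - 1#) * (1# + w * s)
      ≡⟨ solve 2 (λ w s → (w :- :1) :* (:1 :+ w :* s) := w :* ((w :- :1) :* s) :+ (w :- :1)) refl w s ⟩
    w * ((w - 1#) * s) + (w - 1#)
      ≡⟨ cong (λ z → w * z + (w - 1#)) (geometric w m) ⟩
    w * (w ^ m - 1#) + (w - 1#)
      ≡⟨ solve 2 (λ w t → w :* (t :- :1) :+ (w :- :1) := w :* t :- :1) refl w (w ^ m) ⟩
    w * w ^ m - 1# ∎
    where
    s = sumL (w ^_) (upTo m)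
    shift : sumL (w ^_) (applyUpTo suc m) ≡ w * s
    shift = trans (cong (sumL (w ^_)) (sym (Listₚ.map-upTo suc m)))
      (trans (sumL-map (w ^_) suc (upTo m)) (sumL-*ˡ w (w ^_) (upTo m)))

  geometric-0 : ∀ {w} m → w ^ m ≡ 1# → ¬ w ≡ 1# → sumL (w ^_) (upTo m) ≡ 0#
  geometric-0 {w} m e w≢1 with *-zero-cases (trans (geometric w m) (x≡y⇒x-y≡0 e))
  ... | inj₁ h = contradiction (x-y≡0⇒x≡y h) w≢1
  ... | inj₂ h = h

  sumL-cong-∈ : {X : Set} {f h : X → Carrier} (xs : List X) → (∀ {x} → x ∈ xs → f x ≡ h x) → sumL f xs ≡ sumL h xs
  sumL-cong-∈ []       e = refl
  sumL-cong-∈ (x ∷ xs) e = cong₂ _+_ (e (here refl)) (sumL-cong-∈ xs (λ m → e (there m)))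

  sumL-∷ʳ : {X : Set} (f : X → Carrier) → ∀ xs y → sumL f (xs ∷ʳ y) ≡ sumL f xs + f y
  sumL-∷ʳ f []       y = +-comm _ _
  sumL-∷ʳ f (x ∷ xs) y = trans (cong (f x +_) (sumL-∷ʳ f xs y)) (sym (+-assoc _ _ _))

  sumL-upTo-first : ∀ f m → sumL f (upTo (suc m)) ≡ f 0 + sumL (λ i → f (suc i)) (upTo m)
  sumL-upTo-first f m = cong (f 0 +_)
    (trans (cong (sumL f) (sym (Listₚ.map-upTo suc m))) (sumL-map f suc (upTo m)))

  sumL-upTo-last : ∀ f m → sumL f (upTo (suc m)) ≡ sumL f (upTo m) + f m
  sumL-upTo-last f m = trans (cong (sumL f) (sym (Listₚ.upTo-∷ʳ m))) (sumL-∷ʳ f (upTo m) m)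

-- The multiplicative group of F_q is cyclic of order q - 1

module FiniteFieldProperties {p r : ℕ} (Fq : FiniteField p r) (p-prime : Prime p) (p≢2 : ¬ p ≡ 2)
  (q%4≡1 : (p ℕ.^ r) % 4 ≡ 1) (g : FiniteField.Carrier Fq)
  (gen : ∀ x → ¬ x ≡ FiniteField.0# Fq → ∃ λ j → Fld._^_ (FiniteField.fld Fq) g j ≡ x) where

  open FiniteField Fq
  open FieldProperties fld
  open ≡-Reasoning

  q n : ℕ
  q = p ℕ.^ r
  n = q ∸ 1

  -- The distinct elements 0 and 1 both occur in `elems`; in particular r = 0 is impossible.
  2≤q : 2 ℕ.≤ q
  2≤q = subst (2 ℕ.≤_) card (unique-⊆⇒length-≤ {xs = 0# ∷ 1# ∷ []} ((0≢1 ∷ []) ∷ [] ∷ []) (λ {x} _ → complete x))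

  1+n≡q : suc n ≡ q
  1+n≡q = ℕₚ.m+[n∸m]≡n (ℕₚ.≤-trans (ℕ.s≤s ℕ.z≤n) 2≤q)

  0<n : 0 ℕ.< n
  0<n = ℕₚ.m<n⇒0<n∸m 2≤q

  instance
    p≢0 : NonZero p
    p≢0 = prime⇒nonZero p-prime
    n≢0 : NonZero n
    n≢0 = ℕ.>-nonZero 0<n

  private
    multiple-of-p : ∀ k → (p ℕ.* k) ×1 ≡ 0#
    multiple-of-p k = trans (×1-* p k) (trans (cong (_* k ×1) charp) (zeroˡ _))

  0<r : 0 ℕ.< r
  0<r = ℕₚ.n≢0⇒n>0 (λ r≡0 → ℕₚ.<⇒≱ 2≤q (ℕₚ.≤-reflexive (cong (p ℕ.^_) r≡0)))

  q×1≡0 : q ×1 ≡ 0#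
  q×1≡0 = trans (cong (λ k → (p ℕ.^ k) ×1) (sym (ℕₚ.suc-pred r {{ℕ.>-nonZero 0<r}}))) (multiple-of-p (p ℕ.^ ℕ.pred r))

  n×1≡-1 : n ×1 ≡ - 1#
  n×1≡-1 = +-cancelˡ 1# (trans (cong _×1 1+n≡q) (trans q×1≡0 (sym (-‿inverseʳ 1#))))

  small-multiple≢0 : ∀ {k} → 0 ℕ.< k → k ℕ.< p → ¬ k ×1 ≡ 0#
  small-multiple≢0 {k} 0<k k<p = coprime-multiples (prime⇒coprime p-prime {{ℕ.>-nonZero 0<k}} k<p) charp

  2<p : 2 ℕ.< p
  2<p = ℕₚ.≤∧≢⇒< (ℕ.nonTrivial⇒n>1 p {{prime⇒nonTrivial p-prime}}) (λ e → p≢2 (sym e))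

  2≢0 : ¬ 2 ×1 ≡ 0#
  2≢0 = small-multiple≢0 (ℕ.s≤s ℕ.z≤n) 2<p

  -1≢1 : ¬ - 1# ≡ 1#
  -1≢1 e = 2≢0 (begin
    1# + (1# + 0#)  ≡⟨ cong (1# +_) (+-identityʳ 1#) ⟩
    1# + 1#         ≡⟨ cong (1# +_) e ⟨
    1# + - 1#       ≡⟨ -‿inverseʳ 1# ⟩
    0#              ∎)

  1≢0 : ¬ 1# ≡ 0#
  1≢0 e = 0≢1 (sym e)

  -- The powers of 0 are only 1 and 0, whereas -1 is a power of g and differs from both in odd
  -- characteristic.
  g≢0 : ¬ g ≡ 0#
  g≢0 e with gen (- 1#) (neg-nonzero 1≢0)
  ... | zero  , h = -1≢1 (sym h)
  ... | suc j , h = neg-nonzero 1≢0 (trans (sym h) (trans (cong (_* g ^ j) e) (zeroˡ _)))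

  private
    -- With 0 placed before g⁰, ..., g^(q-1) there are q + 1 entries, so two coincide. The entry 0
    -- is never one of them, and the exponents involved differ by at most q - 1, which bounds the
    -- period by `n` instead of q.
    powers : Fin (suc q) → Carrier
    powers Fin.zero    = 0#
    powers (Fin.suc i) = g ^ toℕ i

    g^-cancel : ∀ {i j} → i ℕ.≤ j → g ^ i ≡ g ^ j → g ^ (j ∸ i) ≡ 1#
    g^-cancel {i} {j} i≤j e = *-cancelˡ (^-nonzero i g≢0) (begin
      (g ^ i) * g ^ (j ∸ i)   ≡⟨ ^-+ g i (j ∸ i) ⟨
      g ^ (i ℕ.+ (j ∸ i))     ≡⟨ cong (g ^_) (ℕₚ.m+[n∸m]≡n i≤j) ⟩
      g ^ j                   ≡⟨ e ⟨
      g ^ i                   ≡⟨ *-identityʳ _ ⟨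
      (g ^ i) * 1#            ∎)

    some-period : ∃ λ d → 0 ℕ.< d × d ℕ.≤ n × g ^ d ≡ 1#
    some-period with Finₚ.pigeonhole (ℕₚ.≤-reflexive (cong suc card)) (λ i → index (complete (powers i)))
    ... | i , j , i<j , e = go i j i<j
        (trans (lookup-index (complete (powers i))) (trans (cong (lookup elems) e) (sym (lookup-index (complete (powers j))))))
      where
      go : ∀ i j → i Fin.< j → powers i ≡ powers j → ∃ λ d → 0 ℕ.< d × d ℕ.≤ n × g ^ d ≡ 1#
      go Fin.zero    (Fin.suc j) i<j e = contradiction (sym e) (^-nonzero (toℕ j) g≢0)
      go (Fin.suc i) (Fin.suc j) (ℕ.s≤s i<j) e =
        toℕ j ∸ toℕ i , ℕₚ.m<n⇒0<n∸m i<j ,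
        ℕₚ.≤-trans (ℕₚ.m∸n≤m (toℕ j) (toℕ i)) (ℕ.s≤s⁻¹ (subst (toℕ j ℕ.<_) (sym 1+n≡q) (Finₚ.toℕ<n j))) ,
        g^-cancel (ℕₚ.<⇒≤ i<j) e

  -- If g^d = 1, reducing exponents modulo d shows that 0 and the first d powers of g exhaust F_q,
  -- so q ≤ 1 + d. Together with `some-period` this pins the order of g to `n`.
  period-≥ : ∀ d → 0 ℕ.< d → g ^ d ≡ 1# → n ℕ.≤ d
  period-≥ d 0<d e = ℕ.s≤s⁻¹ (subst₂ ℕ._≤_ (trans card (sym 1+n≡q))
      (cong suc (trans (Listₚ.length-map (g ^_) (upTo d)) (Listₚ.length-upTo d)))
      (unique-⊆⇒length-≤ {ys = 0# ∷ map (g ^_) (upTo d)} unique sub))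
    where
    sub : ∀ {x} → x ∈ elems → x ∈ 0# ∷ map (g ^_) (upTo d)
    sub {x} _ with x ≟ 0#
    ... | yes x≡0 = here x≡0
    ... | no  x≢0 with gen x x≢0
    ... | j , h = there (subst (_∈ map (g ^_) (upTo d))
        (trans (^-% d {{ℕ.>-nonZero 0<d}} e j) h)
        (∈-map⁺ (g ^_) (∈-upTo⁺ (m%n<n j d {{ℕ.>-nonZero 0<d}}))))

  g^n≡1 : g ^ n ≡ 1#
  g^n≡1 with some-period
  ... | d , 0<d , d≤n , e = subst (λ k → g ^ k ≡ 1#) (ℕₚ.≤-antisym d≤n (period-≥ d 0<d e)) e

  g^k≢1 : ∀ {k} → 0 ℕ.< k → k ℕ.< n → ¬ g ^ k ≡ 1#
  g^k≢1 0<k k<n e = ℕₚ.<⇒≱ k<n (period-≥ _ 0<k e)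

  g^k≡1⇒n∣k : ∀ k → g ^ k ≡ 1# → n ∣ k
  g^k≡1⇒n∣k k e with k % n in eq
  ... | zero  = m%n≡0⇒n∣m k n eq
  ... | suc m = contradiction (trans (cong (g ^_) (sym eq)) (trans (^-% n g^n≡1 k) e))
      (g^k≢1 (ℕ.s≤s ℕ.z≤n) (subst (ℕ._< n) eq (m%n<n k n)))

  g^-injective : ∀ {i j} → i ℕ.< n → j ℕ.< n → g ^ i ≡ g ^ j → i ≡ j
  g^-injective {i} {j} i<n j<n e with ℕₚ.<-cmp i j
  ... | tri≈ _ i≡j _ = i≡j
  ... | tri< i<j _ _ = contradiction (g^-cancel (ℕₚ.<⇒≤ i<j) e)
      (g^k≢1 (ℕₚ.m<n⇒0<n∸m i<j) (ℕₚ.≤-<-trans (ℕₚ.m∸n≤m j i) j<n))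
  ... | tri> _ _ j<i = contradiction (g^-cancel (ℕₚ.<⇒≤ j<i) (sym e))
      (g^k≢1 (ℕₚ.m<n⇒0<n∸m j<i) (ℕₚ.≤-<-trans (ℕₚ.m∸n≤m i j) i<n))

  n≡4m : ∃ λ m → n ≡ 4 ℕ.* m
  n≡4m = q / 4 , (begin
    q ∸ 1                       ≡⟨ cong (_∸ 1) (m≡m%n+[m/n]*n q 4) ⟩
    (q % 4 ℕ.+ q / 4 ℕ.* 4) ∸ 1 ≡⟨ cong (λ k → (k ℕ.+ q / 4 ℕ.* 4) ∸ 1) q%4≡1 ⟩
    q / 4 ℕ.* 4                 ≡⟨ ℕₚ.*-comm (q / 4) 4 ⟩
    4 ℕ.* (q / 4)               ∎)

  x^n≡1 : ∀ {x} → ¬ x ≡ 0# → x ^ n ≡ 1#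
  x^n≡1 {x} x≢0 with gen x x≢0
  ... | j , refl = begin
    (g ^ j) ^ n     ≡⟨ ^-* g j n ⟨
    g ^ (j ℕ.* n)   ≡⟨ cong (g ^_) (ℕₚ.*-comm j n) ⟩
    g ^ (n ℕ.* j)   ≡⟨ ^-* g n j ⟩
    (g ^ n) ^ j     ≡⟨ trans (cong (_^ j) g^n≡1) (1^ j) ⟩
    1#              ∎

  x^q≡x : ∀ x → x ^ q ≡ x
  x^q≡x x with x ≟ 0#
  ... | no x≢0 = trans (cong (x ^_) (sym 1+n≡q)) (trans (cong (x *_) (x^n≡1 x≢0)) (*-identityʳ x))
  ... | yes refl = trans (cong (0# ^_) (sym 1+n≡q)) (zeroˡ _)

  -- Frobenius and its fixed points

  private
    module B = Binomial (CommutativeRing.commutativeSemiring commRing)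
    module S = Sum (CommutativeRing.semiring commRing)
    module M = RawMonoidOps (Monoid.rawMonoid (CommutativeRing.+-monoid commRing))
    module R = RawSemiringOps (Semiring.rawSemiring (CommutativeRing.semiring commRing))

    p′ : ℕ
    p′ = ℕ.pred p

    1+p′≡p : suc p′ ≡ p
    1+p′≡p = ℕₚ.suc-pred p

    ^-agrees : ∀ x m → x R.^ m ≡ x ^ m
    ^-agrees x zero    = refl
    ^-agrees x (suc m) = cong (x *_) (^-agrees x m)

    ×-agrees : ∀ m x → m M.× x ≡ m ×1 * x
    ×-agrees zero    x = sym (zeroˡ x)
    ×-agrees (suc m) x = trans (cong₂ _+_ (sym (*-identityˡ x)) (×-agrees m x)) (sym (distribʳ x 1# (m ×1)))

    p∣⇒×1≡0 : ∀ {k} → p ∣ k → k ×1 ≡ 0#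
    p∣⇒×1≡0 (divides m refl) = trans (×1-* m p) (trans (cong (m ×1 *_) charp) (zeroʳ _))

    p∣pCk : ∀ k → k ℕ.< p′ → p ∣ suc p′ C suc k
    p∣pCk k k<p′ with euclidsLemma (suc k) (suc p′ C suc k) p-prime
        (divides (p′ C k) (trans (k*nCk p′ k) (trans (ℕₚ.*-comm (suc p′) _) (cong ((p′ C k) ℕ.*_) 1+p′≡p))))
    ... | inj₂ h = h
    ... | inj₁ h = contradiction (∣.∣⇒≤ h) (ℕₚ.<⇒≱ (subst (suc k ℕ.<_) 1+p′≡p (ℕ.s≤s k<p′)))

  -- Binomial theorem with the inner terms killed by `p∣pCk`. The exponent is rewritten as `suc p′`
  -- so that the two end terms can be split off the sum.
  frobenius-+ : ∀ x y → (x + y) ^ p ≡ (x ^ p) + y ^ p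
  frobenius-+ x y = subst (λ m → (x + y) ^ m ≡ (x ^ m) + y ^ m) 1+p′≡p (begin
    (x + y) ^ suc p′                ≡⟨ ^-agrees _ (suc p′) ⟨
    (x + y) R.^ suc p′              ≡⟨ B.theorem (suc p′) x y ⟩
    t Fin.zero + S.sum (λ i → t (Fin.suc i))
      ≡⟨ cong₂ _+_ first (S.sum-init-last (λ i → t (Fin.suc i))) ⟩
    (y ^ suc p′) + (S.sum (λ i → t (Fin.suc (Fin.inject₁ i))) + t (Fin.suc (Fin.fromℕ p′)))
      ≡⟨ cong₂ (λ u v → (y ^ suc p′) + (u + v)) middle last ⟩
    (y ^ suc p′) + (0# + x ^ suc p′) ≡⟨ solve 2 (λ a b → b :+ (:0 :+ a) := a :+ b) refl (x ^ suc p′) (y ^ suc p′) ⟩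
    (x ^ suc p′) + y ^ suc p′       ∎)
    where
    t = B.binomialTerm x y (suc p′)
    first : t Fin.zero ≡ y ^ suc p′
    first = trans (+-identityʳ _) (trans (*-identityˡ _) (^-agrees y (suc p′)))
    last : t (Fin.suc (Fin.fromℕ p′)) ≡ x ^ suc p′
    last = begin
      (suc p′ C toℕ (Fin.fromℕ (suc p′))) M.× ((x R.^ toℕ (Fin.fromℕ (suc p′))) * (y R.^ (suc p′ ∸ toℕ (Fin.fromℕ (suc p′)))))
        ≡⟨ cong (λ k → (suc p′ C k) M.× ((x R.^ k) * (y R.^ (suc p′ ∸ k)))) (Finₚ.toℕ-fromℕ (suc p′)) ⟩
      (suc p′ C suc p′) M.× ((x R.^ suc p′) * (y R.^ (p′ ∸ p′)))
        ≡⟨ cong₂ (λ k m → k M.× ((x R.^ suc p′) * (y R.^ m))) (nCn≡1 (suc p′)) (ℕₚ.n∸n≡0 p′) ⟩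
      (x R.^ suc p′) * 1# + 0#  ≡⟨ trans (+-identityʳ _) (*-identityʳ _) ⟩
      x R.^ suc p′              ≡⟨ ^-agrees x (suc p′) ⟩
      x ^ suc p′                ∎
    vanish : ∀ i → t (Fin.suc (Fin.inject₁ i)) ≡ 0#
    vanish i = trans (×-agrees (suc p′ C suc (toℕ (Fin.inject₁ i))) _)
      (trans (cong₂ _*_ (p∣⇒×1≡0 (p∣pCk (toℕ (Fin.inject₁ i)) (subst (ℕ._< p′) (sym (Finₚ.toℕ-inject₁ i)) (Finₚ.toℕ<n i)))) refl) (zeroˡ _))
    middle : S.sum (λ i → t (Fin.suc (Fin.inject₁ i))) ≡ 0#
    middle = trans (S.sum-cong-≗ vanish) (S.sum-replicate-zero p′)

  0^p : 0# ^ p ≡ 0#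
  0^p = trans (cong (0# ^_) (sym 1+p′≡p)) (zeroˡ _)

  frobenius-sum : {X : Set} (f : X → Carrier) → ∀ xs → (sumL f xs) ^ p ≡ sumL (λ x → f x ^ p) xs
  frobenius-sum f []       = 0^p
  frobenius-sum f (x ∷ xs) = trans (frobenius-+ (f x) _) (cong ((f x ^ p) +_) (frobenius-sum f xs))

  frobenius-iterate-+ : ∀ i x y → (x + y) ^ (p ℕ.^ i) ≡ (x ^ (p ℕ.^ i)) + y ^ (p ℕ.^ i)
  frobenius-iterate-+ zero    x y = distribʳ 1# x y
  frobenius-iterate-+ (suc i) x y = begin
    (x + y) ^ (p ℕ.* p ℕ.^ i)                       ≡⟨ ^-* (x + y) p _ ⟩
    ((x + y) ^ p) ^ (p ℕ.^ i)                       ≡⟨ cong (_^ (p ℕ.^ i)) (frobenius-+ x y) ⟩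
    ((x ^ p) + y ^ p) ^ (p ℕ.^ i)                   ≡⟨ frobenius-iterate-+ i (x ^ p) (y ^ p) ⟩
    ((x ^ p) ^ (p ℕ.^ i)) + (y ^ p) ^ (p ℕ.^ i)     ≡⟨ cong₂ _+_ (^-* x p _) (^-* y p _) ⟨
    (x ^ (p ℕ.* p ℕ.^ i)) + y ^ (p ℕ.* p ℕ.^ i)     ∎

  ×1-fixed : ∀ k → (k ×1) ^ p ≡ k ×1
  ×1-fixed zero    = 0^p
  ×1-fixed (suc k) = trans (frobenius-+ 1# (k ×1)) (cong₂ _+_ (1^ p) (×1-fixed k))

  ×1-distinct : ∀ {k l} → k ℕ.< l → l ℕ.< p → ¬ k ×1 ≡ l ×1
  ×1-distinct {k} {l} k<l l<p e = small-multiple≢0 (ℕₚ.m<n⇒0<n∸m k<l) (ℕₚ.≤-<-trans (ℕₚ.m∸n≤m l k) l<p)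
    (+-cancelˡ (k ×1) (begin
      k ×1 + (l ∸ k) ×1   ≡⟨ ×1-+ k (l ∸ k) ⟨
      (k ℕ.+ (l ∸ k)) ×1  ≡⟨ cong _×1 (ℕₚ.m+[n∸m]≡n (ℕₚ.<⇒≤ k<l)) ⟩
      l ×1                ≡⟨ e ⟨
      k ×1                ≡⟨ +-identityʳ _ ⟨
      k ×1 + 0#           ∎))

  ×1-injective : ∀ {k l} → k ℕ.< p → l ℕ.< p → k ×1 ≡ l ×1 → k ≡ l
  ×1-injective {k} {l} k<p l<p e with ℕₚ.<-cmp k l
  ... | tri< k<l _ _ = contradiction e (×1-distinct k<l l<p)
  ... | tri≈ _ k≡l _ = k≡l
  ... | tri> _ _ l<k = contradiction (sym e) (×1-distinct l<k k<p)

  private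
    -- Since p is 1 modulo p - 1, so is every power of p. Hence q - 1 is a multiple of p - 1, and
    -- the quotient `m` makes g ^ m an element whose (p - 1)-st power is 1.
    p^r≡1+m*p′ : ∀ r → ∃ λ m → p ℕ.^ r ≡ 1 ℕ.+ m ℕ.* p′
    p^r≡1+m*p′ zero = 0 , refl
    p^r≡1+m*p′ (suc r) with p^r≡1+m*p′ r
    ... | m , e = 1 ℕ.+ p ℕ.* m , trans (cong₂ ℕ._*_ (sym 1+p′≡p) e) (trans
        (solveℕ 2 (λ k m → (conℕ 1 :+ℕ k) :*ℕ (conℕ 1 :+ℕ m :*ℕ k) :=ℕ conℕ 1 :+ℕ (conℕ 1 :+ℕ (conℕ 1 :+ℕ k) :*ℕ m) :*ℕ k) refl p′ m)
        (cong (λ k → 1 ℕ.+ (1 ℕ.+ k ℕ.* m) ℕ.* p′) 1+p′≡p))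
      where open +-*-Solver renaming (solve to solveℕ; _:+_ to _:+ℕ_; _:*_ to _:*ℕ_; _:=_ to _:=ℕ_; con to conℕ)

    m : ℕ
    m = proj₁ (p^r≡1+m*p′ r)

    n≡m*p′ : n ≡ m ℕ.* p′
    n≡m*p′ = cong (_∸ 1) (proj₂ (p^r≡1+m*p′ r))

    instance
      p′≢0 : NonZero p′
      p′≢0 = ℕ.>-nonZero (ℕ.s≤s⁻¹ (subst (1 ℕ.<_) (sym 1+p′≡p) (ℕₚ.<-trans (ℕ.s≤s (ℕ.s≤s ℕ.z≤n)) 2<p)))

    -- The fixed points of Frobenius are 0 and the powers of g ^ m, so
    -- there are at most p of them.
    fixed-points : List Carrier
    fixed-points = 0# ∷ map ((g ^ m) ^_) (upTo p′)

    -- For nonzero y = g ^ j, being fixed means g ^ (j (p - 1)) = 1, so q - 1 = m (p - 1) divides j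
    -- (p - 1) and m divides j.
    fixed⇒∈ : ∀ {y} → y ^ p ≡ y → y ∈ fixed-points
    fixed⇒∈ {y} fix with y ≟ 0#
    ... | yes y≡0 = here y≡0
    ... | no  y≢0 with gen y y≢0
    ... | j , refl with ∣.*-cancelʳ-∣ {m} {j} p′ (subst (_∣ j ℕ.* p′) n≡m*p′ (g^k≡1⇒n∣k (j ℕ.* p′)
          (trans (^-* g j p′) (*-cancelˡ y≢0 (trans (cong ((g ^ j) ^_) 1+p′≡p) (trans fix (sym (*-identityʳ _))))))))
    ... | divides i refl = there (subst (_∈ map ((g ^ m) ^_) (upTo p′))
          (trans (^-% p′ (trans (sym (^-* g m p′)) (trans (cong (g ^_) (sym n≡m*p′)) g^n≡1)) i)
            (trans (sym (^-* g m i)) (cong (g ^_) (ℕₚ.*-comm m i))))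
          (∈-map⁺ ((g ^ m) ^_) (∈-upTo⁺ (m%n<n i p′))))

  -- Otherwise y together with the p distinct multiples of 1 would give p + 1 fixed points. The
  -- conclusion speaks of the search itself because `trNat` is defined by that search.
  fixed⇒multiple : ∀ {y} → y ^ p ≡ y → ¬ findL (λ k → (k ×1) ≟ y) (upTo p) ≡ nothing
  fixed⇒multiple {y} fix e = ℕₚ.<⇒≱ (ℕₚ.≤-refl {suc (length (applyUpTo _×1 p))})
      (ℕₚ.≤-trans (unique-⊆⇒length-≤ {xs = y ∷ applyUpTo _×1 p} unique-list sub)
        (ℕₚ.≤-reflexive (begin
          suc (length (map ((g ^ m) ^_) (upTo p′)))  ≡⟨ cong suc (trans (Listₚ.length-map _ (upTo p′)) (Listₚ.length-upTo p′)) ⟩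
          suc p′                                     ≡⟨ 1+p′≡p ⟩
          p                                          ≡⟨ Listₚ.length-applyUpTo _×1 p ⟨
          length (applyUpTo _×1 p)                   ∎)))
    where
    y∉ : ∀ {x} → x ∈ applyUpTo _×1 p → ¬ y ≡ x
    y∉ x∈ refl with ∈-applyUpTo⁻ _×1 x∈
    ... | k , k<p , h = findL-nothing _ (upTo p) e (∈-upTo⁺ k<p) (sym h)
    unique-list = All.tabulate y∉ ∷ Uniqueₚ.applyUpTo⁺₁ _×1 p ×1-distinct
    sub : ∀ {x} → x ∈ y ∷ applyUpTo _×1 p → x ∈ fixed-points
    sub (here refl) = fixed⇒∈ fix
    sub (there x∈) with ∈-applyUpTo⁻ _×1 x∈
    ... | k , _ , refl = fixed⇒∈ (×1-fixed k)

  -- The trace to the prime field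

  trace : Carrier → Carrier
  trace α = sumL (λ i → α ^ (p ℕ.^ i)) (upTo r)

  trace-+ : ∀ x y → trace (x + y) ≡ trace x + trace y
  trace-+ x y = trans (sumL-cong (λ i → frobenius-iterate-+ i x y) (upTo r)) (sumL-+ _ _ (upTo r))

  -- Frobenius shifts the summands by one place. Adding α to both sides reduces the claim to two
  -- ways of splitting the sum of α^(p^i) over 0 ≤ i ≤ r, joined by α^q = α.
  trace-fixed : ∀ α → trace α ^ p ≡ trace α
  trace-fixed α = +-cancelˡ α (begin
    α + trace α ^ p                                ≡⟨ cong (α +_) (frobenius-sum s (upTo r)) ⟩
    α + sumL (λ i → s i ^ p) (upTo r)              ≡⟨ cong₂ _+_ (sym (*-identityʳ α)) (sumL-cong (λ i → trans (sym (^-* α (p ℕ.^ i) p)) (cong (α ^_) (ℕₚ.*-comm (p ℕ.^ i) p))) (upTo r)) ⟩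
    s 0 + sumL (λ i → s (suc i)) (upTo r)          ≡⟨ sumL-upTo-first s r ⟨
    sumL s (upTo (suc r))                          ≡⟨ sumL-upTo-last s r ⟩
    trace α + α ^ q                                ≡⟨ trans (+-comm _ _) (cong (_+ trace α) (x^q≡x α)) ⟩
    α + trace α                                    ∎)
    where
    s : ℕ → Carrier
    s i = α ^ (p ℕ.^ i)

  -- Σ_{j<n} trace(g^j) g^{-j} = -1: only the first conjugate contributes.
  trace-nontrivial : ¬ (∀ α → trace α ≡ 0#)
  trace-nontrivial tr≡0 = neg-nonzero 1≢0 (begin
    - 1#                                      ≡⟨ n×1≡-1 ⟨
    n ×1                                      ≡⟨ *-identityʳ _ ⟨
    n ×1 * 1#                                 ≡⟨ cong (λ k → k ×1 * 1#) (Listₚ.length-upTo n) ⟨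
    length (upTo n) ×1 * 1#                   ≡⟨ sumL-const 1# (upTo n) ⟨
    sumL (λ _ → 1#) (upTo n)                  ≡⟨ sumL-cong (λ j → trans (cong (_^ j) c0) (1^ j)) (upTo n) ⟨
    c 0                                       ≡⟨ +-identityʳ _ ⟨
    c 0 + 0#                                  ≡⟨ cong (c 0 +_) (trans (sumL-cong-∈ (upTo (ℕ.pred r)) c-suc) (sumL-0 (upTo (ℕ.pred r)))) ⟨
    c 0 + sumL (λ i → c (suc i)) (upTo (ℕ.pred r)) ≡⟨ sumL-upTo-first c (ℕ.pred r) ⟨
    sumL c (upTo (suc (ℕ.pred r)))            ≡⟨ cong (λ k → sumL c (upTo k)) (ℕₚ.suc-pred r {{ℕ.>-nonZero 0<r}}) ⟩
    sumL c (upTo r)                           ≡⟨ sumL-cong (λ i → sumL-cong (λ j → term i j) (upTo n)) (upTo r) ⟩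
    sumL (λ i → sumL (λ j → (g ⁻¹) ^ j * (g ^ j) ^ (p ℕ.^ i)) (upTo n)) (upTo r)
                                              ≡⟨ sumL-swap (λ i j → (g ⁻¹) ^ j * (g ^ j) ^ (p ℕ.^ i)) (upTo r) (upTo n) ⟩
    sumL (λ j → sumL (λ i → (g ⁻¹) ^ j * (g ^ j) ^ (p ℕ.^ i)) (upTo r)) (upTo n)
                                              ≡⟨ sumL-cong (λ j → trans (sumL-*ˡ ((g ⁻¹) ^ j) _ (upTo r)) (trans (cong ((g ⁻¹) ^ j *_) (tr≡0 (g ^ j))) (zeroʳ _))) (upTo n) ⟩
    sumL (λ j → 0#) (upTo n)                  ≡⟨ sumL-0 (upTo n) ⟩
    0#                                        ∎)
    where
    w : ℕ → Carrier
    w i = (g ⁻¹) * g ^ (p ℕ.^ i)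
    c : ℕ → Carrier
    c i = sumL (w i ^_) (upTo n)
    c0 : w 0 ≡ 1#
    c0 = trans (cong ((g ⁻¹) *_) (*-identityʳ g)) (trans (*-comm _ _) (inverse g g≢0))
    term : ∀ i j → w i ^ j ≡ (g ⁻¹) ^ j * (g ^ j) ^ (p ℕ.^ i)
    term i j = trans (^-distrib-* (g ⁻¹) _ j) (cong ((g ⁻¹) ^ j *_)
      (trans (sym (^-* g (p ℕ.^ i) j)) (trans (cong (g ^_) (ℕₚ.*-comm (p ℕ.^ i) j)) (^-* g j (p ℕ.^ i)))))
    -- `w (suc i)` is g^(p^(i+1) - 1), and this exponent lies strictly between 0 and n when i + 1 <
    -- r.
    w≢1 : ∀ {i} → suc i ℕ.< r → ¬ w (suc i) ≡ 1#
    w≢1 {i} 1+i<r e = g^k≢1 {k} 0<k k<n (*-cancelˡ g≢0 (begin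
      g ^ suc k                              ≡⟨ cong (g ^_) 1+k≡p^ ⟩
      g ^ (p ℕ.^ suc i)                      ≡⟨ *-identityˡ _ ⟨
      1# * g ^ (p ℕ.^ suc i)                 ≡⟨ cong (_* g ^ (p ℕ.^ suc i)) (inverse g g≢0) ⟨
      g * g ⁻¹ * g ^ (p ℕ.^ suc i)           ≡⟨ *-assoc _ _ _ ⟩
      g * w (suc i)                          ≡⟨ cong (g *_) e ⟩
      g * 1#                                 ∎))
      where
      k = p ℕ.^ suc i ∸ 1
      1<p^ : 1 ℕ.< p ℕ.^ suc i
      1<p^ = ℕₚ.<-≤-trans (ℕₚ.<-trans (ℕ.s≤s (ℕ.s≤s ℕ.z≤n)) 2<p)
        (subst (ℕ._≤ p ℕ.^ suc i) (ℕₚ.*-identityʳ p) (ℕₚ.*-monoʳ-≤ p (ℕ.>-nonZero⁻¹ _ {{ℕₚ.m^n≢0 p i}})))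
      1+k≡p^ : suc k ≡ p ℕ.^ suc i
      1+k≡p^ = ℕₚ.m+[n∸m]≡n (ℕₚ.<⇒≤ 1<p^)
      0<k : 0 ℕ.< k
      0<k = ℕₚ.m<n⇒0<n∸m 1<p^
      k<n : k ℕ.< n
      k<n = ℕ.s≤s⁻¹ (subst₂ ℕ._<_ (sym 1+k≡p^) (sym 1+n≡q) (ℕₚ.^-monoʳ-< p (ℕₚ.<-trans (ℕ.s≤s (ℕ.s≤s ℕ.z≤n)) 2<p) 1+i<r))
    c-suc : ∀ {i} → i ∈ upTo (ℕ.pred r) → c (suc i) ≡ 0#
    c-suc {i} i∈ = geometric-0 n
      (x^n≡1 (*-nonzero (⁻¹-nonzero g≢0) (^-nonzero (p ℕ.^ suc i) g≢0)))
      (w≢1 (subst (suc i ℕ.<_) (ℕₚ.suc-pred r {{ℕ.>-nonZero 0<r}}) (ℕ.s≤s (∈-upTo⁻ i∈))))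

-- Characters of F_q with values in K

module CharacterSums {p r : ℕ} (Fq : FiniteField p r) (p-prime : Prime p) (p≢2 : ¬ p ≡ 2)
  (q%4≡1 : (p ℕ.^ r) % 4 ≡ 1) (g : FiniteField.Carrier Fq)
  (gen : ∀ x → ¬ x ≡ FiniteField.0# Fq → ∃ λ j → Fld._^_ (FiniteField.fld Fq) g j ≡ x)
  (K : Fld) (K-char0 : Fld.CharZero K)
  (ζ ω : Fld.Carrier K) (ζ-root : Setup.PrimitivePthRoot Fq K ζ ω g)
  (ω-root : Setup.PrimitiveRoot-q-1 Fq K ζ ω g) where

  open Setup Fq K ζ ω g
  open FiniteFieldProperties Fq p-prime p≢2 q%4≡1 g gen hiding (q)
  private
    module KP = FieldProperties K
    module FP = FieldProperties F.fld
  open ≡-Reasoning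

  0F 1F 2F -1F : F.Carrier
  0F = F.0#
  1F = F.1#
  2F = 2 F.×1
  -1F = F.- F.1#

  0K 1K -1K : K.Carrier
  0K = K.0#
  1K = K.1#
  -1K = K.- K.1#

  -- Indicator functions and sums over F_q

  ⟦_⟧ : {P : Set} → Dec P → K.Carrier
  ⟦ yes _ ⟧ = 1K
  ⟦ no  _ ⟧ = 0K

  ⟦⟧-yes : {P : Set} (d : Dec P) → P → ⟦ d ⟧ ≡ 1K
  ⟦⟧-yes (yes _) _ = refl
  ⟦⟧-yes (no ¬p) p = contradiction p ¬p

  ⟦⟧-no : {P : Set} (d : Dec P) → ¬ P → ⟦ d ⟧ ≡ 0K
  ⟦⟧-no (yes p) ¬p = contradiction p ¬p
  ⟦⟧-no (no _)  _  = refl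

  ⟦⟧-cong : {P Q : Set} (d : Dec P) (e : Dec Q) → (P → Q) → (Q → P) → ⟦ d ⟧ ≡ ⟦ e ⟧
  ⟦⟧-cong (yes p) e f _ = sym (⟦⟧-yes e (f p))
  ⟦⟧-cong (no ¬p) e _ h = sym (⟦⟧-no e (λ x → ¬p (h x)))

  ⟦⟧*-yes : {P : Set} (d : Dec P) → P → ∀ x → ⟦ d ⟧ K.* x ≡ x
  ⟦⟧*-yes d p x = trans (cong (K._* x) (⟦⟧-yes d p)) (KP.*-identityˡ x)

  ⟦⟧*-no : {P : Set} (d : Dec P) → ¬ P → ∀ x → ⟦ d ⟧ K.* x ≡ 0K
  ⟦⟧*-no d ¬p x = trans (cong (K._* x) (⟦⟧-no d ¬p)) (KP.zeroˡ x)

  ⟦⟧*-cong : {P : Set} (d : Dec P) {x y : K.Carrier} → (P → x ≡ y) → ⟦ d ⟧ K.* x ≡ ⟦ d ⟧ K.* y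
  ⟦⟧*-cong (yes p) f = cong (1K K.*_) (f p)
  ⟦⟧*-cong (no _)  f = trans (KP.zeroˡ _) (sym (KP.zeroˡ _))

  ∑ : (F.Carrier → K.Carrier) → K.Carrier
  ∑ f = K.sumL f F.elems

  ∑-cong : ∀ {f h} → (∀ x → f x ≡ h x) → ∑ f ≡ ∑ h
  ∑-cong e = KP.sumL-cong e F.elems

  ∑-0 : ∑ (λ _ → 0K) ≡ 0K
  ∑-0 = KP.sumL-0 F.elems

  ∑-const : ∀ c → ∑ (λ _ → c) ≡ qK K.* c
  ∑-const c = trans (KP.sumL-const c F.elems) (cong (λ k → k K.×1 K.* c) F.card)

  ∑-+ : ∀ f h → ∑ (λ x → f x K.+ h x) ≡ ∑ f K.+ ∑ h
  ∑-+ f h = KP.sumL-+ f h F.elems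

  ∑-*ˡ : ∀ c f → ∑ (λ x → c K.* f x) ≡ c K.* ∑ f
  ∑-*ˡ c f = KP.sumL-*ˡ c f F.elems

  ∑-*ʳ : ∀ f c → ∑ (λ x → f x K.* c) ≡ ∑ f K.* c
  ∑-*ʳ f c = trans (∑-cong (λ x → KP.*-comm (f x) c)) (trans (∑-*ˡ c f) (KP.*-comm c _))

  ∑-swap : ∀ f → ∑ (λ x → ∑ (f x)) ≡ ∑ (λ y → ∑ (λ x → f x y))
  ∑-swap f = KP.sumL-swap f F.elems F.elems

  ∑-pick : ∀ y (h : F.Carrier → K.Carrier) → ∑ (λ x → ⟦ x F.≟ y ⟧ K.* h x) ≡ h y
  ∑-pick y h = go F.elems F.unique (F.complete y)
    where
    absent : ∀ xs → All (λ x → ¬ y ≡ x) xs → K.sumL (λ x → ⟦ x F.≟ y ⟧ K.* h x) xs ≡ 0K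
    absent []       []       = refl
    absent (x ∷ xs) (n ∷ ns) = trans (cong₂ K._+_ (⟦⟧*-no (x F.≟ y) (λ e → n (sym e)) (h x)) (absent xs ns)) (KP.+-identityˡ 0K)
    go : ∀ xs → Unique xs → y ∈ xs → K.sumL (λ x → ⟦ x F.≟ y ⟧ K.* h x) xs ≡ h y
    go (x ∷ xs) (x∉ ∷ u) (here refl) = trans (cong₂ K._+_ (⟦⟧*-yes (x F.≟ y) refl (h x)) (absent xs x∉)) (KP.+-identityʳ _)
    go (x ∷ xs) (x∉ ∷ u) (there m)   = trans (cong₂ K._+_ (⟦⟧*-no (x F.≟ y) (All.lookup x∉ m) (h x)) (go xs u m)) (KP.+-identityˡ _)

  ∑-pick′ : ∀ y (h : F.Carrier → K.Carrier) → ∑ (λ x → ⟦ y F.≟ x ⟧ K.* h x) ≡ h y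
  ∑-pick′ y h = trans (∑-cong (λ x → cong (K._* h x) (⟦⟧-cong (y F.≟ x) (x F.≟ y) sym sym))) (∑-pick y h)

  -- σ and τ need only be mutually inverse on the supports of f and h.
  ∑-reindex-support : ∀ {f h} (σ τ : F.Carrier → F.Carrier) →
    (∀ x → f x ≡ 0K ⊎ (τ (σ x) ≡ x × h (σ x) ≡ f x)) →
    (∀ y → h y ≡ 0K ⊎ (σ (τ y) ≡ y × f (τ y) ≡ h y)) → ∑ f ≡ ∑ h
  ∑-reindex-support {f} {h} σ τ good-f good-h = begin
    ∑ f                                                ≡⟨ ∑-cong (λ x → ∑-pick (σ x) (λ _ → f x)) ⟨
    ∑ (λ x → ∑ (λ y → ⟦ y F.≟ σ x ⟧ K.* f x))          ≡⟨ ∑-swap _ ⟩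
    ∑ (λ y → ∑ (λ x → ⟦ y F.≟ σ x ⟧ K.* f x))          ≡⟨ ∑-cong (λ y → ∑-cong (λ x → match x y)) ⟩
    ∑ (λ y → ∑ (λ x → ⟦ x F.≟ τ y ⟧ K.* h y))          ≡⟨ ∑-cong (λ y → ∑-pick (τ y) (λ _ → h y)) ⟩
    ∑ h                                                ∎
    where
    -- Both sides weight a graph, that of σ by f and that of τ by h. Where the two graphs disagree,
    -- the support conditions make the weight zero.
    match : ∀ x y → ⟦ y F.≟ σ x ⟧ K.* f x ≡ ⟦ x F.≟ τ y ⟧ K.* h y
    match x y with y F.≟ σ x | x F.≟ τ y
    ... | no _ | no _ = trans (KP.zeroˡ _) (sym (KP.zeroˡ _))
    match x y | yes refl | yes e with good-f x | good-h y
    ... | inj₂ (_ , b) | _ = cong (1K K.*_) (sym b)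
    ... | inj₁ a | inj₁ b = cong (1K K.*_) (trans a (sym b))
    ... | inj₁ a | inj₂ (_ , b) = cong (1K K.*_) (trans (cong f e) b)
    match x y | yes refl | no x≢ with good-f x
    ... | inj₁ a = trans (KP.*-identityˡ _) (trans a (sym (KP.zeroˡ _)))
    ... | inj₂ (a , _) = contradiction (sym a) x≢
    match x y | no y≢ | yes refl with good-h y
    ... | inj₁ a = trans (KP.zeroˡ _) (sym (trans (KP.*-identityˡ _) a))
    ... | inj₂ (a , _) = contradiction (sym a) y≢

  ∑-reindex : ∀ f (σ τ : F.Carrier → F.Carrier) → (∀ x → τ (σ x) ≡ x) → (∀ y → σ (τ y) ≡ y) →
    ∑ (λ x → f (σ x)) ≡ ∑ f
  ∑-reindex f σ τ τσ στ = ∑-reindex-support σ τ (λ x → inj₂ (τσ x , refl)) (λ y → inj₂ (στ y , cong f (στ y)))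

  ∑-translate : ∀ f c → ∑ (λ x → f (c F.+ x)) ≡ ∑ f
  ∑-translate f c = ∑-reindex f (c F.+_) ((F.- c) F.+_)
    (λ x → FP.solve 2 (λ c x → (FP.:- c) FP.:+ (c FP.:+ x) FP.:= x) refl c x)
    (λ x → FP.solve 2 (λ c x → c FP.:+ ((FP.:- c) FP.:+ x) FP.:= x) refl c x)

  ∑-reflect : ∀ f c → ∑ (λ x → f (c F.- x)) ≡ ∑ f
  ∑-reflect f c = ∑-reindex f (λ x → c F.- x) (λ x → c F.- x) invol invol
    where
    invol : ∀ x → c F.- (c F.- x) ≡ x
    invol x = FP.solve 2 (λ c x → c FP.:- (c FP.:- x) FP.:= x) refl c x

  ∑-scale : ∀ f {c} → ¬ c ≡ 0F → ∑ (λ x → f (c F.* x)) ≡ ∑ f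
  ∑-scale f {c} c≢0 = ∑-reindex f (c F.*_) ((c F.⁻¹) F.*_)
    (λ x → trans (FP.solve 3 (λ c i x → i FP.:* (c FP.:* x) FP.:= (c FP.:* i) FP.:* x) refl c (c F.⁻¹) x) (unit x))
    (λ x → trans (sym (FP.*-assoc _ _ _)) (unit x))
    where
    unit : ∀ x → (c F.* c F.⁻¹) F.* x ≡ x
    unit x = trans (cong (F._* x) (F.inverse c c≢0)) (FP.*-identityˡ x)

  -- Every multiplicative character is ch w with w its value at g, so identities
  -- between characters become identities between roots of unity in K.

  ch : K.Carrier → Char
  ch w x with x F.≟ 0F
  ... | yes _ = 0K
  ... | no  _ = w K.^ dlog x

  Root : K.Carrier → Set
  Root w = w K.^ n ≡ 1K

  root-nonzero : ∀ {w} → Root w → ¬ w ≡ 0K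
  root-nonzero e refl = K.0≢1 (trans (sym (KP.zeroˡ _)) (trans (cong (0K K.^_) (ℕₚ.suc-pred n)) e))

  root-1 : Root 1K
  root-1 = KP.1^ n

  root-* : ∀ {u v} → Root u → Root v → Root (u K.* v)
  root-* {u} {v} eu ev = trans (KP.^-distrib-* u v n) (trans (cong₂ K._*_ eu ev) (KP.*-identityˡ 1K))

  root-inv : ∀ {u v} → u K.* v ≡ 1K → Root u → Root v
  root-inv {u} {v} e eu = begin
    v K.^ n                  ≡⟨ KP.*-identityˡ _ ⟨
    1K K.* v K.^ n           ≡⟨ cong (K._* v K.^ n) eu ⟨
    u K.^ n K.* v K.^ n      ≡⟨ KP.^-distrib-* u v n ⟨
    (u K.* v) K.^ n          ≡⟨ trans (cong (K._^ n) e) root-1 ⟩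
    1K                       ∎

  -1*-1 : -1K K.* -1K ≡ 1K
  -1*-1 = KP.solve 0 ((KP.:- KP.:1) KP.:* (KP.:- KP.:1) KP.:= KP.:1) refl

  root--1 : Root -1K
  root--1 with n≡4m
  ... | m , e = begin
    -1K K.^ n                ≡⟨ cong (-1K K.^_) e ⟩
    -1K K.^ (4 ℕ.* m)        ≡⟨ KP.^-* -1K 4 m ⟩
    (-1K K.^ 4) K.^ m        ≡⟨ cong (K._^ m) (KP.solve 0 (m1 KP.:* (m1 KP.:* (m1 KP.:* (m1 KP.:* KP.:1))) KP.:= KP.:1) refl) ⟩
    1K K.^ m                 ≡⟨ KP.1^ m ⟩
    1K                       ∎
    where m1 = KP.:- KP.:1

  ch-0 : ∀ w → ch w 0F ≡ 0K
  ch-0 w with 0F F.≟ 0F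
  ... | yes _ = refl
  ... | no  h = contradiction refl h

  ch-nz : ∀ w {x} → ¬ x ≡ 0F → ch w x ≡ w K.^ dlog x
  ch-nz w {x} x≢0 with x F.≟ 0F
  ... | yes h = contradiction h x≢0
  ... | no  _ = refl

  -- The exponent provided by `gen` may exceed n; its residue modulo n lies in the range searched,
  -- so the default of `dlog` is not reached at nonzero x.
  dlog-spec : ∀ {x} → ¬ x ≡ 0F → dlog x ℕ.< n × g F.^ dlog x ≡ x
  dlog-spec {x} x≢0 with findL (λ j → (g F.^ j) F.≟ x) (upTo n) in eq
  ... | just k  = ∈-upTo⁻ (proj₁ (findL-just _ (upTo n) eq)) , proj₂ (findL-just _ (upTo n) eq)
  ... | nothing with gen x x≢0
  ... | j , h = contradiction (trans (FP.^-% n g^n≡1 j) h) (findL-nothing _ (upTo n) eq (∈-upTo⁺ (m%n<n j n)))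

  ch-g^ : ∀ {w} → Root w → ∀ j → ch w (g F.^ j) ≡ w K.^ j
  ch-g^ {w} ew j = begin
    ch w (g F.^ j)           ≡⟨ ch-nz w g^j≢0 ⟩
    w K.^ dlog (g F.^ j)     ≡⟨ cong (w K.^_) (g^-injective (proj₁ (dlog-spec g^j≢0)) (m%n<n j n) (trans (proj₂ (dlog-spec g^j≢0)) (sym (FP.^-% n g^n≡1 j)))) ⟩
    w K.^ (j % n)            ≡⟨ KP.^-% n ew j ⟩
    w K.^ j                  ∎
    where g^j≢0 = FP.^-nonzero j g≢0

  ch-g : ∀ {w} → Root w → ch w g ≡ w
  ch-g {w} ew = trans (cong (ch w) (sym (FP.*-identityʳ g))) (trans (ch-g^ ew 1) (KP.*-identityʳ w))

  ch-1 : ∀ {w} → Root w → ch w 1F ≡ 1K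
  ch-1 ew = ch-g^ ew 0

  ch-* : ∀ {w} → Root w → ∀ x y → ch w (x F.* y) ≡ ch w x K.* ch w y
  ch-* {w} ew x y with x F.≟ 0F | y F.≟ 0F
  ... | yes refl | _ = trans (cong (ch w) (FP.zeroˡ y)) (trans (ch-0 w) (sym (KP.zeroˡ _)))
  ... | no _ | yes refl = trans (cong (ch w) (FP.zeroʳ x)) (trans (ch-0 w) (sym (KP.zeroʳ _)))
  ... | no x≢0 | no y≢0 = begin
    ch w (x F.* y)                               ≡⟨ cong₂ (λ a b → ch w (a F.* b)) (proj₂ (dlog-spec x≢0)) (proj₂ (dlog-spec y≢0)) ⟨
    ch w (g F.^ dlog x F.* g F.^ dlog y)         ≡⟨ cong (ch w) (FP.^-+ g (dlog x) (dlog y)) ⟨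
    ch w (g F.^ (dlog x ℕ.+ dlog y))             ≡⟨ ch-g^ ew (dlog x ℕ.+ dlog y) ⟩
    w K.^ (dlog x ℕ.+ dlog y)                    ≡⟨ KP.^-+ w (dlog x) (dlog y) ⟩
    w K.^ dlog x K.* w K.^ dlog y                ∎

  ch-⊗ : ∀ u v x → ch (u K.* v) x ≡ ch u x K.* ch v x
  ch-⊗ u v x with x F.≟ 0F
  ... | yes _ = sym (KP.zeroˡ _)
  ... | no  _ = KP.^-distrib-* u v (dlog x)

  ch-trivial : ∀ {x} → ¬ x ≡ 0F → ch 1K x ≡ 1K
  ch-trivial {x} x≢0 = trans (ch-nz 1K x≢0) (KP.1^ (dlog x))

  ch-nonzero : ∀ {w} → Root w → ∀ {x} → ¬ x ≡ 0F → ¬ ch w x ≡ 0K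
  ch-nonzero {w} ew {x} x≢0 e = KP.^-nonzero (dlog x) (root-nonzero ew) (trans (sym (ch-nz w x≢0)) e)

  ch-inv : ∀ {u v} → u K.* v ≡ 1K → ∀ {x} → ¬ x ≡ 0F → ch u x K.* ch v x ≡ 1K
  ch-inv {u} {v} e {x} x≢0 = trans (sym (ch-⊗ u v x)) (trans (cong (λ w → ch w x) e) (ch-trivial x≢0))

  ch-⁻¹ : ∀ {w} → Root w → ∀ {x} → ¬ x ≡ 0F → ch w x K.* ch w (x F.⁻¹) ≡ 1K
  ch-⁻¹ {w} ew {x} x≢0 = trans (sym (ch-* ew x _)) (trans (cong (ch w) (F.inverse x x≢0)) (ch-1 ew))

  ch-⁻¹-inv : ∀ {u v} → u K.* v ≡ 1K → Root u → ∀ {x} → ¬ x ≡ 0F → ch u (x F.⁻¹) ≡ ch v x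
  ch-⁻¹-inv e eu x≢0 = KP.*-cancelˡ (ch-nonzero eu x≢0) (trans (ch-⁻¹ eu x≢0) (sym (ch-inv e x≢0)))

  ch-square : ∀ {w} → Root w → ∀ x → ch w (x F.* x) ≡ ch (w K.* w) x
  ch-square {w} ew x = trans (ch-* ew x x) (sym (ch-⊗ w w x))

  ch-square-neg1 : ∀ {w} → Root w → ch (w K.* w) -1F ≡ 1K
  ch-square-neg1 {w} ew = trans (sym (ch-square ew -1F))
    (trans (cong (ch w) (FP.solve 0 ((FP.:- FP.:1) FP.:* (FP.:- FP.:1) FP.:= FP.:1) refl)) (ch-1 ew))

  ch-neg1-square : ∀ {w} → Root w → ch w -1F K.* ch w -1F ≡ 1K
  ch-neg1-square {w} ew = trans (sym (ch-⊗ w w -1F)) (ch-square-neg1 ew)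

  -1F≢0 : ¬ -1F ≡ 0F
  -1F≢0 = FP.neg-nonzero 1≢0

  char-g^ : ∀ {χ} → IsChar χ → ∀ j → χ (g F.^ j) ≡ χ g K.^ j
  char-g^ (_ , h1 , hm) zero    = h1
  char-g^ {χ} c@(_ , h1 , hm) (suc j) = trans (hm g (g F.^ j)) (cong (χ g K.*_) (char-g^ c j))

  char-root : ∀ {χ} → IsChar χ → Root (χ g)
  char-root {χ} c@(_ , h1 , _) = trans (sym (char-g^ c n)) (trans (cong χ g^n≡1) h1)

  char≐ch : ∀ {χ} → IsChar χ → χ ≐ ch (χ g)
  char≐ch {χ} c@(h0 , _ , _) x with x F.≟ 0F
  ... | yes refl = h0
  ... | no  x≢0  = trans (cong χ (sym (proj₂ (dlog-spec x≢0)))) (char-g^ c (dlog x))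

  ε≐ch : ε ≐ ch 1K
  ε≐ch x with x F.≟ 0F
  ... | yes _ = refl
  ... | no  _ = sym (KP.1^ (dlog x))

  charK≐ch : ∀ k → charK k ≐ ch (ω K.^ k)
  charK≐ch k x with x F.≟ 0F
  ... | yes _ = refl
  ... | no  _ = KP.^-* ω k (dlog x)

  bar≐ch : ∀ {χ u v} → χ ≐ ch u → u K.* v ≡ 1K → Root u → bar χ ≐ ch v
  bar≐ch {χ} {u} {v} e uv eu x with x F.≟ 0F
  ... | yes _   = refl
  ... | no  x≢0 = trans (e (x F.⁻¹)) (trans (ch-⁻¹-inv uv eu x≢0) (ch-nz v x≢0))

  φ-square : ∀ {x s} → ¬ x ≡ 0F → s F.* s ≡ x → φ x ≡ 1K
  φ-square {x} {s} x≢0 e with x F.≟ 0F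
  ... | yes h = contradiction h x≢0
  ... | no  _ with sqrtM x in eq
  ...   | just _  = refl
  ...   | nothing = contradiction e (findL-nothing _ F.elems eq (F.complete s))

  φ-nonsquare : ∀ {x} → (∀ s → ¬ s F.* s ≡ x) → φ x ≡ -1K
  φ-nonsquare {x} ns with x F.≟ 0F
  ... | yes h = contradiction (trans (FP.zeroˡ 0F) (sym h)) (ns 0F)
  ... | no  _ with sqrtM x in eq
  ...   | just s  = contradiction (proj₂ (findL-just _ F.elems eq)) (ns s)
  ...   | nothing = refl

  square? : ∀ x → (∃ λ s → s F.* s ≡ x) ⊎ (∀ s → ¬ s F.* s ≡ x)
  square? x with sqrtM x in eq
  ... | just s  = inj₁ (s , proj₂ (findL-just _ F.elems eq))
  ... | nothing = inj₂ (λ s → findL-nothing _ F.elems eq (F.complete s))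

  sqrt-spec : ∀ {x s} → s F.* s ≡ x → sqrt x F.* sqrt x ≡ x
  sqrt-spec {x} {s} e with sqrtM x in eq
  ... | just t  = proj₂ (findL-just _ F.elems eq)
  ... | nothing = contradiction e (findL-nothing _ F.elems eq (F.complete s))

  even⊎-1^ : ∀ j → (∃ λ i → j ≡ i ℕ.+ i) ⊎ -1K K.^ j ≡ -1K
  even⊎-1^ zero          = inj₁ (0 , refl)
  even⊎-1^ (suc zero)    = inj₂ (KP.*-identityʳ -1K)
  even⊎-1^ (suc (suc j)) with even⊎-1^ j
  ... | inj₁ (i , e) = inj₁ (suc i , cong suc (trans (cong suc e) (sym (ℕₚ.+-suc i i))))
  ... | inj₂ e = inj₂ (trans (sym (KP.*-assoc _ _ _)) (trans (cong₂ K._*_ -1*-1 e) (KP.*-identityˡ -1K)))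

  φ-0 : φ 0F ≡ 0K
  φ-0 with 0F F.≟ 0F
  ... | yes _ = refl
  ... | no  h = contradiction refl h

  root-of-nonzero : ∀ {x s} → ¬ x ≡ 0F → s F.* s ≡ x → ¬ s ≡ 0F
  root-of-nonzero x≢0 e refl = x≢0 (trans (sym e) (FP.zeroˡ 0F))

  -- On a square s² the character with value -1 at g gives ch 1 at s, which is 1. A nonsquare has
  -- odd discrete logarithm, because g^(2i) would have the root g^i.
  φ≐ch-nonzero : ∀ {x} → ¬ x ≡ 0F → φ x ≡ ch -1K x
  φ≐ch-nonzero {x} x≢0 with square? x
  ... | inj₁ (s , refl) = trans (φ-square x≢0 refl) (sym (begin
      ch -1K (s F.* s)          ≡⟨ ch-square root--1 s ⟩
      ch (-1K K.* -1K) s        ≡⟨ cong (λ w → ch w s) -1*-1 ⟩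
      ch 1K s                   ≡⟨ ch-trivial (root-of-nonzero x≢0 refl) ⟩
      1K                        ∎))
  ... | inj₂ ns with even⊎-1^ (dlog x)
  ... | inj₂ e = trans (φ-nonsquare ns) (sym (trans (ch-nz -1K x≢0) e))
  ... | inj₁ (i , e) = contradiction
      (trans (sym (FP.^-+ g i i)) (trans (cong (g F.^_) (sym e)) (proj₂ (dlog-spec x≢0)))) (ns (g F.^ i))

  φ≐ch : φ ≐ ch -1K
  φ≐ch x = decide (x F.≟ 0F)
    where
    decide : Dec (x ≡ 0F) → φ x ≡ ch -1K x
    decide (yes refl) = trans φ-0 (sym (ch-0 -1K))
    decide (no x≢0)   = φ≐ch-nonzero x≢0

  -- The additive character

  -- The default 0 of `trNat` is never reached through a failed search: the trace is fixed by
  -- Frobenius, hence is one of the multiples of 1 below p.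
  trNat-spec : ∀ α → trNat α ℕ.< p × trNat α F.×1 ≡ trace α
  trNat-spec α with findL (λ k → (k F.×1) F.≟ trace α) (upTo p) in eq
  ... | just k  = ∈-upTo⁻ (proj₁ (findL-just _ (upTo p) eq)) , proj₂ (findL-just _ (upTo p) eq)
  ... | nothing = contradiction eq (fixed⇒multiple (trace-fixed α))

  θ-+ : ∀ x y → θ (x F.+ y) ≡ θ x K.* θ y
  θ-+ x y = begin
    ζ K.^ trNat (x F.+ y)               ≡⟨ cong (ζ K.^_) (×1-injective (proj₁ (trNat-spec (x F.+ y))) (m%n<n s p) (begin
        trNat (x F.+ y) F.×1              ≡⟨ proj₂ (trNat-spec (x F.+ y)) ⟩
        trace (x F.+ y)                   ≡⟨ trace-+ x y ⟩
        trace x F.+ trace y               ≡⟨ cong₂ F._+_ (proj₂ (trNat-spec x)) (proj₂ (trNat-spec y)) ⟨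
        trNat x F.×1 F.+ trNat y F.×1     ≡⟨ FP.×1-+ (trNat x) (trNat y) ⟨
        s F.×1                            ≡⟨ FP.×1-% p F.charp s ⟨
        (s % p) F.×1                      ∎)) ⟩
    ζ K.^ (s % p)                       ≡⟨ KP.^-% p (proj₁ ζ-root) s ⟩
    ζ K.^ s                             ≡⟨ KP.^-+ ζ (trNat x) (trNat y) ⟩
    θ x K.* θ y                         ∎
    where s = trNat x ℕ.+ trNat y

  -- A positive exponent below the prime p is coprime to p, so ζ^k = 1 together with ζ^p = 1 would
  -- force ζ = 1.
  θ≡1⇒trace≡0 : ∀ {x} → θ x ≡ K.1# → trace x ≡ F.0#
  θ≡1⇒trace≡0 {x} e with trNat x | trNat-spec x
  ... | zero  | _ , h = sym h
  ... | suc k | k<p , _ = contradiction (KP.coprime-powers (prime⇒coprime p-prime k<p) (proj₁ ζ-root) e) (proj₂ ζ-root)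

  θ-nontrivial : ¬ (∀ x → θ x ≡ K.1#)
  θ-nontrivial h = trace-nontrivial (λ α → θ≡1⇒trace≡0 (h α))

  -- Gauss and Jacobi sums

  G : K.Carrier → K.Carrier
  G w = gauss (ch w)

  J : K.Carrier → K.Carrier → K.Carrier
  J u v = ∑ (λ x → ch u x K.* ch v (1F F.- x))

  qK≢0 : ¬ qK ≡ 0K
  qK≢0 e = ℕₚ.<⇒≢ (ℕₚ.<-trans (ℕ.s≤s ℕ.z≤n) 2≤q) (sym (K-char0 q e))

  nK : K.Carrier
  nK = n K.×1

  nK≢0 : ¬ nK ≡ 0K
  nK≢0 e = ℕₚ.<⇒≢ 0<n (sym (K-char0 n e))

  qK≡1+nK : qK ≡ 1K K.+ nK
  qK≡1+nK = cong K._×1 (sym 1+n≡q)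

  ch-1-indicator : ∀ x → ch 1K x ≡ 1K K.- ⟦ x F.≟ 0F ⟧
  ch-1-indicator x with x F.≟ 0F
  ... | yes _ = sym (KP.-‿inverseʳ 1K)
  ... | no  _ = trans (KP.1^ (dlog x)) (KP.solve 0 (KP.:1 KP.:= KP.:1 KP.:- KP.:0) refl)

  ∑-− : ∀ f h → ∑ (λ x → f x K.- h x) ≡ ∑ f K.- ∑ h
  ∑-− f h = begin
    ∑ (λ x → f x K.+ K.- h x)        ≡⟨ ∑-cong (λ x → cong (f x K.+_) (KP.solve 1 (λ a → KP.:- a KP.:= (KP.:- KP.:1) KP.:* a) refl (h x))) ⟩
    ∑ (λ x → f x K.+ -1K K.* h x)    ≡⟨ ∑-+ f (λ x → -1K K.* h x) ⟩
    ∑ f K.+ ∑ (λ x → -1K K.* h x)    ≡⟨ cong (∑ f K.+_) (∑-*ˡ -1K h) ⟩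
    ∑ f K.+ -1K K.* ∑ h              ≡⟨ KP.solve 2 (λ a b → a KP.:+ (KP.:- KP.:1) KP.:* b KP.:= a KP.:- b) refl (∑ f) (∑ h) ⟩
    ∑ f K.- ∑ h                      ∎

  ∑-ch-1 : ∑ (ch 1K) ≡ nK
  ∑-ch-1 = begin
    ∑ (ch 1K)                                   ≡⟨ ∑-cong ch-1-indicator ⟩
    ∑ (λ x → 1K K.- ⟦ x F.≟ 0F ⟧)               ≡⟨ ∑-− (λ _ → 1K) (λ x → ⟦ x F.≟ 0F ⟧) ⟩
    ∑ (λ _ → 1K) K.- ∑ (λ x → ⟦ x F.≟ 0F ⟧)     ≡⟨ cong₂ K._-_ (∑-const 1K) (∑-cong (λ x → sym (KP.*-identityʳ _))) ⟩
    qK K.* 1K K.- ∑ (λ x → ⟦ x F.≟ 0F ⟧ K.* 1K) ≡⟨ cong₂ (λ a b → a K.* 1K K.- b) qK≡1+nK (∑-pick 0F (λ _ → 1K)) ⟩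
    (1K K.+ nK) K.* 1K K.- 1K                   ≡⟨ KP.solve 1 (λ m → (KP.:1 KP.:+ m) KP.:* KP.:1 KP.:- KP.:1 KP.:= m) refl nK ⟩
    nK                                          ∎

  fixed⇒0 : ∀ {c s} → ¬ c ≡ 1K → c K.* s ≡ s → s ≡ 0K
  fixed⇒0 {c} {s} c≢1 e with KP.*-zero-cases {c K.- 1K} {s}
      (trans (KP.solve 2 (λ c s → (c KP.:- KP.:1) KP.:* s KP.:= c KP.:* s KP.:- s) refl c s) (KP.x≡y⇒x-y≡0 e))
  ... | inj₁ h = contradiction (KP.x-y≡0⇒x≡y h) c≢1
  ... | inj₂ h = h

  -- Replacing x by g x permutes F_q and multiplies the sum by w ≠ 1.
  ∑-ch-0 : ∀ {w} → Root w → ¬ w ≡ 1K → ∑ (ch w) ≡ 0K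
  ∑-ch-0 {w} ew w≢1 = fixed⇒0 w≢1 (begin
    w K.* ∑ (ch w)              ≡⟨ ∑-*ˡ w (ch w) ⟨
    ∑ (λ x → w K.* ch w x)      ≡⟨ ∑-cong (λ x → trans (cong (K._* ch w x) (sym (ch-g ew))) (sym (ch-* ew g x))) ⟩
    ∑ (λ x → ch w (g F.* x))    ≡⟨ ∑-scale (ch w) g≢0 ⟩
    ∑ (ch w)                    ∎)

  θ-0 : θ 0F ≡ 1K
  θ-0 = KP.*-cancelˡ θ0≢0 (begin
    θ 0F K.* θ 0F   ≡⟨ θ-+ 0F 0F ⟨
    θ (0F F.+ 0F)   ≡⟨ cong θ (FP.+-identityˡ 0F) ⟩
    θ 0F            ≡⟨ KP.*-identityʳ _ ⟨
    θ 0F K.* 1K     ∎)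
    where
    ζ≢0 : ¬ ζ ≡ 0K
    ζ≢0 refl = K.0≢1 (trans (sym (KP.zeroˡ _)) (trans (cong (0K K.^_) (ℕₚ.suc-pred p)) (proj₁ ζ-root)))
    θ0≢0 : ¬ θ 0F ≡ 0K
    θ0≢0 = KP.^-nonzero (trNat 0F) ζ≢0

  -- Translation by a multiplies the sum by θ a. A nonzero sum would therefore make θ identically 1.
  ∑-θ : ∑ θ ≡ 0K
  ∑-θ with ∑ θ K.≟ 0K
  ... | yes e = e
  ... | no  S≢0 = contradiction (λ a → KP.*-cancelˡ S≢0 (begin
      ∑ θ K.* θ a                ≡⟨ KP.*-comm _ _ ⟩
      θ a K.* ∑ θ                ≡⟨ ∑-*ˡ (θ a) θ ⟨
      ∑ (λ x → θ a K.* θ x)      ≡⟨ ∑-cong (λ x → sym (θ-+ a x)) ⟩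
      ∑ (λ x → θ (a F.+ x))      ≡⟨ ∑-translate θ a ⟩
      ∑ θ                        ≡⟨ KP.*-identityʳ _ ⟨
      ∑ θ K.* 1K                 ∎)) θ-nontrivial

  G-1 : G 1K ≡ -1K
  G-1 = begin
    ∑ (λ x → ch 1K x K.* θ x)                    ≡⟨ ∑-cong (λ x → trans (cong (K._* θ x) (ch-1-indicator x))
        (KP.solve 2 (λ i t → (KP.:1 KP.:- i) KP.:* t KP.:= t KP.:- i KP.:* t) refl _ (θ x))) ⟩
    ∑ (λ x → θ x K.- ⟦ x F.≟ 0F ⟧ K.* θ x)       ≡⟨ ∑-− θ _ ⟩
    ∑ θ K.- ∑ (λ x → ⟦ x F.≟ 0F ⟧ K.* θ x)       ≡⟨ cong₂ K._-_ ∑-θ (trans (∑-pick 0F θ) θ-0) ⟩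
    0K K.- 1K                                    ≡⟨ KP.+-identityˡ _ ⟩
    -1K                                          ∎

  -- For s ≠ 0 the substitution a = s x extracts (uv)(s). At s = 0 the product collapses to v(-1)
  -- (uv)(a), while the first term on the right vanishes, so one formula covers both cases.
  convolution : ∀ {u v} → Root u → Root v → ∀ s → ∑ (λ a → ch u a K.* ch v (s F.- a))
    ≡ ch (u K.* v) s K.* J u v K.+ ⟦ s F.≟ 0F ⟧ K.* (ch v -1F K.* ∑ (ch (u K.* v)))
  convolution {u} {v} eu ev s with s F.≟ 0F
  ... | yes refl = trans (begin
    ∑ (λ a → ch u a K.* ch v (0F F.- a))          ≡⟨ ∑-cong (λ a → cong (ch u a K.*_) (trans (cong (ch v) (FP.solve 1 (λ a → FP.:0 FP.:- a FP.:= (FP.:- FP.:1) FP.:* a) refl a)) (ch-* ev -1F a))) ⟩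
    ∑ (λ a → ch u a K.* (ch v -1F K.* ch v a))    ≡⟨ ∑-cong (λ a → KP.solve 3 (λ a b c → a KP.:* (b KP.:* c) KP.:= b KP.:* (a KP.:* c)) refl (ch u a) (ch v -1F) (ch v a)) ⟩
    ∑ (λ a → ch v -1F K.* (ch u a K.* ch v a))    ≡⟨ ∑-*ˡ (ch v -1F) _ ⟩
    ch v -1F K.* ∑ (λ a → ch u a K.* ch v a)      ≡⟨ cong (ch v -1F K.*_) (∑-cong (λ a → sym (ch-⊗ u v a))) ⟩
    ch v -1F K.* ∑ (ch (u K.* v))                 ∎)
    (KP.solve 2 (λ j c → c KP.:= KP.:0 KP.:* j KP.:+ KP.:1 KP.:* c) refl (J u v) _)
  ... | no s≢0 = trans (begin
    ∑ (λ a → ch u a K.* ch v (s F.- a))                     ≡⟨ ∑-scale (λ a → ch u a K.* ch v (s F.- a)) s≢0 ⟨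
    ∑ (λ x → ch u (s F.* x) K.* ch v (s F.- s F.* x))       ≡⟨ ∑-cong (λ x → cong₂ K._*_ (ch-* eu s x)
        (trans (cong (ch v) (FP.solve 2 (λ s x → s FP.:- s FP.:* x FP.:= s FP.:* (FP.:1 FP.:- x)) refl s x)) (ch-* ev s _))) ⟩
    ∑ (λ x → (ch u s K.* ch u x) K.* (ch v s K.* ch v (1F F.- x))) ≡⟨ ∑-cong (λ x → KP.solve 4 (λ a b c d → (a KP.:* b) KP.:* (c KP.:* d) KP.:= (a KP.:* c) KP.:* (b KP.:* d)) refl (ch u s) (ch u x) (ch v s) (ch v (1F F.- x))) ⟩
    ∑ (λ x → (ch u s K.* ch v s) K.* (ch u x K.* ch v (1F F.- x))) ≡⟨ ∑-*ˡ _ _ ⟩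
    (ch u s K.* ch v s) K.* J u v                           ≡⟨ cong (K._* J u v) (trans (sym (ch-⊗ u v s)) (ch-nz (u K.* v) s≢0)) ⟩
    (u K.* v) K.^ dlog s K.* J u v                          ∎)
    (KP.solve 2 (λ j c → j KP.:= j KP.:+ KP.:0 KP.:* c) refl _ _)

  -- The double sum is sorted by s = a + b. The extra term survives only for uv = 1, so both the
  -- Jacobi relation and the value of G(u) G(u⁻¹) are read off from here.
  G-product : ∀ {u v} → Root u → Root v →
    G u K.* G v ≡ G (u K.* v) K.* J u v K.+ ch v -1F K.* ∑ (ch (u K.* v))
  G-product {u} {v} eu ev = begin
    G u K.* G v                                             ≡⟨ ∑-*ʳ (λ a → ch u a K.* θ a) (G v) ⟨
    ∑ (λ a → (ch u a K.* θ a) K.* G v)                      ≡⟨ ∑-cong (λ a → trans (cong ((ch u a K.* θ a) K.*_) (sym (∑-translate (λ b → ch v b K.* θ b) (F.- a)))) (sym (∑-*ˡ _ _))) ⟩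
    ∑ (λ a → ∑ (λ s → (ch u a K.* θ a) K.* (ch v ((F.- a) F.+ s) K.* θ ((F.- a) F.+ s)))) ≡⟨ ∑-cong (λ a → ∑-cong (λ s → combine a s)) ⟩
    ∑ (λ a → ∑ (λ s → θ s K.* (ch u a K.* ch v (s F.- a)))) ≡⟨ ∑-swap _ ⟩
    ∑ (λ s → ∑ (λ a → θ s K.* (ch u a K.* ch v (s F.- a)))) ≡⟨ ∑-cong (λ s → trans (∑-*ˡ (θ s) _) (cong (θ s K.*_) (convolution eu ev s))) ⟩
    ∑ (λ s → θ s K.* (ch (u K.* v) s K.* J u v K.+ ⟦ s F.≟ 0F ⟧ K.* c))
      ≡⟨ ∑-cong (λ s → KP.solve 5 (λ t x j i c → t KP.:* (x KP.:* j KP.:+ i KP.:* c) KP.:= (x KP.:* t) KP.:* j KP.:+ i KP.:* (t KP.:* c)) refl (θ s) (ch (u K.* v) s) (J u v) ⟦ s F.≟ 0F ⟧ c) ⟩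
    ∑ (λ s → (ch (u K.* v) s K.* θ s) K.* J u v K.+ ⟦ s F.≟ 0F ⟧ K.* (θ s K.* c)) ≡⟨ ∑-+ _ _ ⟩
    ∑ (λ s → (ch (u K.* v) s K.* θ s) K.* J u v) K.+ ∑ (λ s → ⟦ s F.≟ 0F ⟧ K.* (θ s K.* c))
      ≡⟨ cong₂ K._+_ (∑-*ʳ _ (J u v)) (∑-pick 0F (λ s → θ s K.* c)) ⟩
    G (u K.* v) K.* J u v K.+ θ 0F K.* c                    ≡⟨ cong (λ t → G (u K.* v) K.* J u v K.+ t) (trans (cong (K._* c) θ-0) (KP.*-identityˡ c)) ⟩
    G (u K.* v) K.* J u v K.+ c                             ∎
    where
    c = ch v -1F K.* ∑ (ch (u K.* v))
    combine : ∀ a s → (ch u a K.* θ a) K.* (ch v ((F.- a) F.+ s) K.* θ ((F.- a) F.+ s)) ≡ θ s K.* (ch u a K.* ch v (s F.- a))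
    combine a s = begin
      (ch u a K.* θ a) K.* (ch v ((F.- a) F.+ s) K.* θ ((F.- a) F.+ s))
        ≡⟨ KP.solve 4 (λ a b c d → (a KP.:* b) KP.:* (c KP.:* d) KP.:= (b KP.:* d) KP.:* (a KP.:* c)) refl (ch u a) (θ a) (ch v ((F.- a) F.+ s)) _ ⟩
      (θ a K.* θ ((F.- a) F.+ s)) K.* (ch u a K.* ch v ((F.- a) F.+ s))
        ≡⟨ cong₂ (λ x y → x K.* (ch u a K.* ch v y)) (trans (sym (θ-+ a _)) (cong θ (FP.solve 2 (λ a s → a FP.:+ ((FP.:- a) FP.:+ s) FP.:= s) refl a s))) (FP.+-comm (F.- a) s) ⟩
      θ s K.* (ch u a K.* ch v (s F.- a)) ∎

  G-jacobi : ∀ {u v} → Root u → Root v → ¬ u K.* v ≡ 1K → G u K.* G v ≡ G (u K.* v) K.* J u v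
  G-jacobi {u} {v} eu ev uv≢1 = begin
    G u K.* G v                                                       ≡⟨ G-product eu ev ⟩
    G (u K.* v) K.* J u v K.+ ch v -1F K.* ∑ (ch (u K.* v))           ≡⟨ cong (λ s → G (u K.* v) K.* J u v K.+ ch v -1F K.* s) (∑-ch-0 (root-* eu ev) uv≢1) ⟩
    G (u K.* v) K.* J u v K.+ ch v -1F K.* 0K                         ≡⟨ KP.solve 2 (λ a b → a KP.:+ b KP.:* KP.:0 KP.:= a) refl _ (ch v -1F) ⟩
    G (u K.* v) K.* J u v                                             ∎

  -- Substitute x = 2 / (1 + y).
  J-parametrised : ∀ {u v m} → Root u → Root v → Root m → u K.* (v K.* m) ≡ 1K →
    J u v ≡ ch u 2F K.* ∑ (λ y → ch m (1F F.+ y) K.* ch v (y F.- 1F))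
  J-parametrised {u} {v} {m} eu ev em uvm = trans (∑-reindex-support σ τ good-f good-h) (∑-*ˡ (ch u 2F) _)
    where
    f h : F.Carrier → K.Carrier
    f x = ch u x K.* ch v (1F F.- x)
    h y = ch u 2F K.* (ch m (1F F.+ y) K.* ch v (y F.- 1F))
    σ τ : F.Carrier → F.Carrier
    σ x = 2F F.* x F.⁻¹ F.- 1F
    τ y = 2F F.* (1F F.+ y) F.⁻¹
    τσ : ∀ {x} → ¬ x ≡ 0F → τ (σ x) ≡ x
    τσ {x} x≢0 = begin
      2F F.* (1F F.+ σ x) F.⁻¹        ≡⟨ cong (λ z → 2F F.* z F.⁻¹) (FP.solve 1 (λ a → FP.:1 FP.:+ (a FP.:- FP.:1) FP.:= a) refl (2F F.* x F.⁻¹)) ⟩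
      2F F.* (2F F.* x F.⁻¹) F.⁻¹     ≡⟨ cong (2F F.*_) (FP.⁻¹-unique (begin
          2F F.* x F.⁻¹ F.* (x F.* 2F F.⁻¹)        ≡⟨ FP.solve 4 (λ t i x j → t FP.:* i FP.:* (x FP.:* j) FP.:= (x FP.:* i) FP.:* (t FP.:* j)) refl 2F (x F.⁻¹) x (2F F.⁻¹) ⟩
          x F.* x F.⁻¹ F.* (2F F.* 2F F.⁻¹)        ≡⟨ cong₂ F._*_ (F.inverse x x≢0) (F.inverse 2F 2≢0) ⟩
          1F F.* 1F                                ≡⟨ FP.*-identityˡ 1F ⟩
          1F                                       ∎)) ⟩
      2F F.* (x F.* 2F F.⁻¹)          ≡⟨ FP.solve 3 (λ t x j → t FP.:* (x FP.:* j) FP.:= x FP.:* (t FP.:* j)) refl 2F x (2F F.⁻¹) ⟩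
      x F.* (2F F.* 2F F.⁻¹)          ≡⟨ trans (cong (x F.*_) (F.inverse 2F 2≢0)) (FP.*-identityʳ x) ⟩
      x                               ∎
    hσ : ∀ {x} → ¬ x ≡ 0F → h (σ x) ≡ f x
    hσ {x} x≢0 = begin
      ch u 2F K.* (ch m (1F F.+ σ x) K.* ch v (σ x F.- 1F))
        ≡⟨ cong₂ (λ a b → ch u 2F K.* (ch m a K.* ch v b))
             (FP.solve 1 (λ a → FP.:1 FP.:+ (a FP.:- FP.:1) FP.:= a) refl (2F F.* i))
             -- The solver does not know that x i = 1, so the two ones in 2i - 1 - 1 are replaced by
             -- x i one after the other; the result factors as 2i (1 - x).
             (trans (cong (λ z → 2F F.* i F.- 1F F.- z) (sym (F.inverse x x≢0)))
                (trans (FP.solve 2 (λ x i → FP.:2 FP.:* i FP.:- FP.:1 FP.:- x FP.:* i FP.:= FP.:2 FP.:* i FP.:- (FP.:1 FP.:+ x FP.:* i)) refl x i)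
                (trans (cong (λ z → 2F F.* i F.- (z F.+ x F.* i)) (sym (F.inverse x x≢0)))
                (FP.solve 2 (λ x i → FP.:2 FP.:* i FP.:- (x FP.:* i FP.:+ x FP.:* i) FP.:= FP.:2 FP.:* i FP.:* (FP.:1 FP.:- x)) refl x i)))) ⟩
      ch u 2F K.* (ch m (2F F.* i) K.* ch v (2F F.* i F.* (1F F.- x)))
        ≡⟨ cong₂ (λ a b → ch u 2F K.* (a K.* b)) (ch-* em 2F i) (trans (ch-* ev _ _) (cong (K._* ch v (1F F.- x)) (ch-* ev 2F i))) ⟩
      ch u 2F K.* ((ch m 2F K.* ch m i) K.* ((ch v 2F K.* ch v i) K.* ch v (1F F.- x)))
        ≡⟨ KP.solve 6 (λ a b c d e f → a KP.:* ((b KP.:* c) KP.:* ((d KP.:* e) KP.:* f)) KP.:= (a KP.:* (d KP.:* b)) KP.:* ((e KP.:* c) KP.:* f)) refl (ch u 2F) (ch m 2F) (ch m i) (ch v 2F) (ch v i) (ch v (1F F.- x)) ⟩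
      (ch u 2F K.* (ch v 2F K.* ch m 2F)) K.* ((ch v i K.* ch m i) K.* ch v (1F F.- x))
        -- As u v m = 1, the three factors at 2 cancel, and v m takes the value u(x) at 1/x.
        ≡⟨ cong₂ (λ a b → a K.* (b K.* ch v (1F F.- x))) (all-three 2≢0) inverse-part ⟩
      1K K.* (ch u x K.* ch v (1F F.- x)) ≡⟨ KP.*-identityˡ _ ⟩
      f x ∎
      where
      i = x F.⁻¹
      all-three : ∀ {y} → ¬ y ≡ 0F → ch u y K.* (ch v y K.* ch m y) ≡ 1K
      all-three {y} y≢0 = trans (cong (ch u y K.*_) (sym (ch-⊗ v m y))) (ch-inv uvm y≢0)
      i≢0 = FP.⁻¹-nonzero x≢0
      inverse-part : ch v i K.* ch m i ≡ ch u x
      inverse-part = KP.*-cancelˡ (ch-nonzero eu i≢0) (trans (all-three i≢0)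
        (sym (trans (KP.*-comm _ _) (ch-⁻¹ eu x≢0))))
    τ≢0 : ∀ {y} → ¬ 1F F.+ y ≡ 0F → ¬ τ y ≡ 0F
    τ≢0 y≢ = FP.*-nonzero 2≢0 (FP.⁻¹-nonzero y≢)
    στ : ∀ {y} → ¬ 1F F.+ y ≡ 0F → σ (τ y) ≡ y
    στ {y} y≢ = begin
      2F F.* (2F F.* z F.⁻¹) F.⁻¹ F.- 1F   ≡⟨ cong (F._- 1F) halves ⟩
      z F.- 1F                             ≡⟨ FP.solve 1 (λ y → FP.:1 FP.:+ y FP.:- FP.:1 FP.:= y) refl y ⟩
      y                                    ∎
      where
      z = 1F F.+ y
      halves : 2F F.* (2F F.* z F.⁻¹) F.⁻¹ ≡ z
      halves = trans (cong (λ a → 2F F.* a F.⁻¹) (sym (FP.solve 1 (λ a → FP.:1 FP.:+ (a FP.:- FP.:1) FP.:= a) refl (2F F.* z F.⁻¹)))) (τσ y≢)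
    good-f : ∀ x → f x ≡ 0K ⊎ (τ (σ x) ≡ x × h (σ x) ≡ f x)
    good-f x with x F.≟ 0F
    ... | yes refl = inj₁ (KP.zeroˡ _)
    ... | no  x≢0  = inj₂ (τσ x≢0 , trans (hσ x≢0) (cong (K._* ch v (1F F.- x)) (ch-nz u x≢0)))
    good-h : ∀ y → h y ≡ 0K ⊎ (σ (τ y) ≡ y × f (τ y) ≡ h y)
    good-h y with (1F F.+ y) F.≟ 0F
    ... | yes e = inj₁ (KP.solve 2 (λ a b → a KP.:* (KP.:0 KP.:* b) KP.:= KP.:0) refl (ch u 2F) (ch v (y F.- 1F)))
    ... | no  y≢ = inj₂ (στ y≢ , trans (sym (hσ (τ≢0 y≢))) (trans (cong h (στ y≢)) (cong (λ a → ch u 2F K.* (a K.* ch v (y F.- 1F))) (ch-nz m y≢))))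

  -- With the third character trivial, the parametrised sum is the complete sum of v, which is 0,
  -- without its term v(-2) at y = -1. The powers of 2 then cancel.
  J-inverse : ∀ {u v} → Root u → u K.* v ≡ 1K → ¬ u ≡ 1K → J u v ≡ K.- ch u -1F
  J-inverse {u} {v} eu uv u≢1 = begin
    J u v                                                        ≡⟨ J-parametrised eu ev root-1 (trans (cong (u K.*_) (KP.*-identityʳ v)) uv) ⟩
    ch u 2F K.* ∑ (λ y → ch 1K (1F F.+ y) K.* ch v (y F.- 1F))   ≡⟨ cong (ch u 2F K.*_) (∑-cong drop) ⟩
    ch u 2F K.* ∑ (λ y → ch v (y F.- 1F) K.- ⟦ y F.≟ -1F ⟧ K.* ch v (y F.- 1F))
      ≡⟨ cong (ch u 2F K.*_) (trans (∑-− _ _) (cong₂ K._-_ all-zero (∑-pick -1F (λ y → ch v (y F.- 1F))))) ⟩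
    ch u 2F K.* (0K K.- ch v (-1F F.- 1F))                       ≡⟨ cong (λ z → ch u 2F K.* (0K K.- z)) (trans (cong (ch v) (FP.solve 0 ((FP.:- FP.:1) FP.:- FP.:1 FP.:= FP.:2 FP.:* (FP.:- FP.:1)) refl)) (ch-* ev 2F -1F)) ⟩
    ch u 2F K.* (0K K.- ch v 2F K.* ch v -1F)                    ≡⟨ KP.solve 3 (λ a b c → a KP.:* (KP.:0 KP.:- b KP.:* c) KP.:= KP.:- ((a KP.:* b) KP.:* c)) refl (ch u 2F) (ch v 2F) (ch v -1F) ⟩
    K.- ((ch u 2F K.* ch v 2F) K.* ch v -1F)                     ≡⟨ cong (λ z → K.- z) (trans (cong₂ K._*_ (ch-inv uv 2≢0) same-sign) (KP.*-identityˡ _)) ⟩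
    K.- ch u -1F                                                 ∎
    where
    ev = root-inv uv eu
    v≢1 : ¬ v ≡ 1K
    v≢1 refl = u≢1 (trans (sym (KP.*-identityʳ u)) uv)
    same-sign : ch v -1F ≡ ch u -1F
    same-sign = KP.*-cancelˡ (ch-nonzero eu -1F≢0) (trans (ch-inv uv -1F≢0) (sym (ch-neg1-square eu)))
    drop : ∀ y → ch 1K (1F F.+ y) K.* ch v (y F.- 1F) ≡ ch v (y F.- 1F) K.- ⟦ y F.≟ -1F ⟧ K.* ch v (y F.- 1F)
    drop y = trans (cong (K._* ch v (y F.- 1F)) (trans (ch-1-indicator (1F F.+ y))
        (cong (λ i → 1K K.- i) (⟦⟧-cong ((1F F.+ y) F.≟ 0F) (y F.≟ -1F)
          (λ e → FP.+-cancelˡ 1F (trans e (sym (FP.-‿inverseʳ 1F)))) (λ { refl → FP.-‿inverseʳ 1F })))))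
      (KP.solve 2 (λ i t → (KP.:1 KP.:- i) KP.:* t KP.:= t KP.:- i KP.:* t) refl _ _)
    all-zero : ∑ (λ y → ch v (y F.- 1F)) ≡ 0K
    all-zero = trans (∑-cong (λ y → cong (ch v) (FP.+-comm y -1F))) (trans (∑-translate (ch v) -1F) (∑-ch-0 ev v≢1))

  G-inverse : ∀ {u v} → Root u → u K.* v ≡ 1K → ¬ u ≡ 1K → G u K.* G v ≡ ch u -1F K.* qK
  G-inverse {u} {v} eu uv u≢1 = begin
    G u K.* G v                                                  ≡⟨ G-product eu ev ⟩
    G (u K.* v) K.* J u v K.+ ch v -1F K.* ∑ (ch (u K.* v))      ≡⟨ cong (λ w → G w K.* J u v K.+ ch v -1F K.* ∑ (ch w)) uv ⟩
    G 1K K.* J u v K.+ ch v -1F K.* ∑ (ch 1K)                    ≡⟨ cong₂ (λ a b → a K.* J u v K.+ ch v -1F K.* b) G-1 ∑-ch-1 ⟩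
    -1K K.* J u v K.+ ch v -1F K.* nK                            ≡⟨ cong₂ (λ a b → -1K K.* a K.+ b K.* nK) (J-inverse eu uv u≢1) same-sign ⟩
    -1K K.* (K.- ch u -1F) K.+ ch u -1F K.* nK                   ≡⟨ KP.solve 2 (λ c m → (KP.:- KP.:1) KP.:* (KP.:- c) KP.:+ c KP.:* m KP.:= c KP.:* (KP.:1 KP.:+ m)) refl (ch u -1F) nK ⟩
    ch u -1F K.* (1K K.+ nK)                                     ≡⟨ cong (ch u -1F K.*_) qK≡1+nK ⟨
    ch u -1F K.* qK                                              ∎
    where
    ev = root-inv uv eu
    same-sign : ch v -1F ≡ ch u -1F
    same-sign = KP.*-cancelˡ (ch-nonzero eu -1F≢0) (trans (ch-inv uv -1F≢0) (sym (ch-neg1-square eu)))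

  -- Replaces the usual argument by absolute value: G(u) G(u⁻¹) is a unit times q, and q ≠ 0 in
  -- characteristic 0.
  G-nonzero : ∀ {u v} → Root u → u K.* v ≡ 1K → ¬ u ≡ 1K → ¬ G u ≡ 0K
  G-nonzero eu uv u≢1 e = KP.*-nonzero (ch-nonzero eu -1F≢0) qK≢0
    (trans (sym (G-inverse eu uv u≢1)) (trans (cong (K._* _) e) (KP.zeroˡ _)))

  inverse-root : ∀ {w} → Root w → w K.* w K.⁻¹ ≡ 1K
  inverse-root ew = K.inverse _ (root-nonzero ew)

  -- Sums over square roots and the Hasse-Davenport relation for duplication

  x≢-x : ∀ {x} → ¬ x ≡ 0F → ¬ x ≡ F.- x
  x≢-x {x} x≢0 e = FP.*-nonzero 2≢0 x≢0 (begin
    2F F.* x        ≡⟨ FP.solve 1 (λ x → FP.:2 FP.:* x FP.:= x FP.:+ x) refl x ⟩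
    x F.+ x         ≡⟨ cong (x F.+_) e ⟩
    x F.- x         ≡⟨ FP.-‿inverseʳ x ⟩
    0F              ∎)

  ∑-over-roots : ∀ {e s} → s F.* s ≡ e → ¬ e ≡ 0F → ∀ (f : F.Carrier → K.Carrier) →
    ∑ (λ y → ⟦ (y F.* y) F.≟ e ⟧ K.* f y) ≡ f s K.+ f (F.- s)
  ∑-over-roots {e} {s} refl e≢0 f = begin
    ∑ (λ y → ⟦ (y F.* y) F.≟ (s F.* s) ⟧ K.* f y)                            ≡⟨ ∑-cong split ⟩
    ∑ (λ y → ⟦ y F.≟ s ⟧ K.* f y K.+ ⟦ y F.≟ (F.- s) ⟧ K.* f y)            ≡⟨ ∑-+ _ _ ⟩
    ∑ (λ y → ⟦ y F.≟ s ⟧ K.* f y) K.+ ∑ (λ y → ⟦ y F.≟ (F.- s) ⟧ K.* f y)  ≡⟨ cong₂ K._+_ (∑-pick s f) (∑-pick (F.- s) f) ⟩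
    f s K.+ f (F.- s)                                                        ∎
    where
    s≢-s = x≢-x (root-of-nonzero e≢0 refl)
    split : ∀ y → ⟦ (y F.* y) F.≟ (s F.* s) ⟧ K.* f y ≡ ⟦ y F.≟ s ⟧ K.* f y K.+ ⟦ y F.≟ (F.- s) ⟧ K.* f y
    split y with y F.≟ s | y F.≟ (F.- s)
    ... | yes refl | yes h = contradiction h s≢-s
    ... | yes refl | no  _ = trans (⟦⟧*-yes ((y F.* y) F.≟ (y F.* y)) refl (f y)) (KP.solve 1 (λ a → a KP.:= KP.:1 KP.:* a KP.:+ KP.:0 KP.:* a) refl (f y))
    ... | no  _ | yes refl = trans (⟦⟧*-yes (((F.- s) F.* (F.- s)) F.≟ (s F.* s)) (FP.solve 1 (λ s → (FP.:- s) FP.:* (FP.:- s) FP.:= s FP.:* s) refl s) (f (F.- s))) (KP.solve 1 (λ a → a KP.:= KP.:0 KP.:* a KP.:+ KP.:1 KP.:* a) refl (f (F.- s)))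
    ... | no a | no b = trans (⟦⟧*-no ((y F.* y) F.≟ (s F.* s)) neither (f y)) (KP.solve 1 (λ a → KP.:0 KP.:= KP.:0 KP.:* a KP.:+ KP.:0 KP.:* a) refl (f y))
      where
      neither : ¬ y F.* y ≡ s F.* s
      neither h with FP.square≡square h
      ... | inj₁ h′ = a h′
      ... | inj₂ h′ = b h′

  ∑-over-no-roots : ∀ {e} → (∀ s → ¬ s F.* s ≡ e) → ∀ (f : F.Carrier → K.Carrier) →
    ∑ (λ y → ⟦ (y F.* y) F.≟ e ⟧ K.* f y) ≡ 0K
  ∑-over-no-roots ns f = trans (∑-cong (λ y → ⟦⟧*-no ((y F.* y) F.≟ _) (ns y) (f y))) ∑-0

  square-count : ∀ e → ∑ (λ y → ⟦ (y F.* y) F.≟ e ⟧ K.* 1K) ≡ 1K K.+ φ e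
  square-count e = decide (e F.≟ 0F) (square? e)
    where
    decide : Dec (e ≡ 0F) → (∃ λ s → s F.* s ≡ e) ⊎ (∀ s → ¬ s F.* s ≡ e) →
      ∑ (λ y → ⟦ (y F.* y) F.≟ e ⟧ K.* 1K) ≡ 1K K.+ φ e
    decide (yes refl) _ = begin
      ∑ (λ y → ⟦ (y F.* y) F.≟ 0F ⟧ K.* 1K)  ≡⟨ ∑-cong (λ y → cong (K._* 1K) (⟦⟧-cong ((y F.* y) F.≟ 0F) (y F.≟ 0F) square-zero (λ { refl → FP.zeroˡ 0F }))) ⟩
      ∑ (λ y → ⟦ y F.≟ 0F ⟧ K.* 1K)          ≡⟨ ∑-pick 0F (λ _ → 1K) ⟩
      1K                                     ≡⟨ KP.+-identityʳ 1K ⟨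
      1K K.+ 0K                              ≡⟨ cong (1K K.+_) φ-0 ⟨
      1K K.+ φ 0F                            ∎
      where
      square-zero : ∀ {y} → y F.* y ≡ 0F → y ≡ 0F
      square-zero h with FP.*-zero-cases h
      ... | inj₁ h′ = h′
      ... | inj₂ h′ = h′
    decide (no e≢0) (inj₁ (s , h)) = trans (∑-over-roots h e≢0 (λ _ → 1K)) (cong (1K K.+_) (sym (φ-square e≢0 h)))
    decide (no e≢0) (inj₂ ns) = trans (∑-over-no-roots ns (λ _ → 1K)) (trans (sym (KP.-‿inverseʳ 1K)) (cong (1K K.+_) (sym (φ-nonsquare ns))))

  ∑-of-squares : ∀ (f : F.Carrier → K.Carrier) → ∑ (λ y → f (y F.* y)) ≡ ∑ (λ e → (1K K.+ φ e) K.* f e)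
  ∑-of-squares f = begin
    ∑ (λ y → f (y F.* y))                                       ≡⟨ ∑-cong (λ y → ∑-pick′ (y F.* y) f) ⟨
    ∑ (λ y → ∑ (λ e → ⟦ (y F.* y) F.≟ e ⟧ K.* f e))             ≡⟨ ∑-swap _ ⟩
    ∑ (λ e → ∑ (λ y → ⟦ (y F.* y) F.≟ e ⟧ K.* f e))             ≡⟨ ∑-cong (λ e → ∑-cong (λ y → cong (K._* f e) (sym (KP.*-identityʳ _)))) ⟩
    ∑ (λ e → ∑ (λ y → (⟦ (y F.* y) F.≟ e ⟧ K.* 1K) K.* f e))    ≡⟨ ∑-cong (λ e → trans (∑-*ʳ _ (f e)) (cong (K._* f e) (square-count e))) ⟩
    ∑ (λ e → (1K K.+ φ e) K.* f e)                              ∎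

  4F : F.Carrier
  4F = 4 F.×1

  -- Completing the square, 4x(1 - x) = 1 - (1 - 2x)², turns the sum into one over squares.
  -- Weighting e by its 1 + φ(e) square roots leaves a complete sum of w, which is 0, and J(φ, w).
  J-duplication : ∀ {w} → Root w → ¬ w ≡ 1K → ch w 4F K.* J w w ≡ J -1K w
  J-duplication {w} ew w≢1 = begin
    ch w 4F K.* J w w                                            ≡⟨ ∑-*ˡ (ch w 4F) _ ⟨
    ∑ (λ x → ch w 4F K.* (ch w x K.* ch w (1F F.- x)))           ≡⟨ ∑-cong (λ x → trans (cong (ch w 4F K.*_) (sym (ch-* ew x _))) (trans (sym (ch-* ew 4F _)) (cong (ch w) (complete-square x)))) ⟩
    ∑ (λ x → h (1F F.- 2F F.* x))                                ≡⟨ ∑-scale (λ x → h (1F F.- x)) 2≢0 ⟩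
    ∑ (λ x → h (1F F.- x))                                       ≡⟨ ∑-reflect h 1F ⟩
    ∑ h                                                          ≡⟨ ∑-of-squares (λ e → ch w (1F F.- e)) ⟩
    ∑ (λ e → (1K K.+ φ e) K.* ch w (1F F.- e))                   ≡⟨ ∑-cong (λ e → trans (cong (λ z → (1K K.+ z) K.* ch w (1F F.- e)) (φ≐ch e)) (KP.solve 2 (λ a b → (KP.:1 KP.:+ a) KP.:* b KP.:= b KP.:+ a KP.:* b) refl (ch -1K e) (ch w (1F F.- e)))) ⟩
    ∑ (λ e → ch w (1F F.- e) K.+ ch -1K e K.* ch w (1F F.- e))   ≡⟨ ∑-+ _ _ ⟩
    ∑ (λ e → ch w (1F F.- e)) K.+ J -1K w                        ≡⟨ cong (K._+ J -1K w) (trans (∑-reflect (ch w) 1F) (∑-ch-0 ew w≢1)) ⟩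
    0K K.+ J -1K w                                               ≡⟨ KP.+-identityˡ _ ⟩
    J -1K w                                                      ∎
    where
    h : F.Carrier → K.Carrier
    h y = ch w (1F F.- y F.* y)
    complete-square : ∀ x → 4F F.* (x F.* (1F F.- x)) ≡ 1F F.- (1F F.- 2F F.* x) F.* (1F F.- 2F F.* x)
    complete-square = FP.solve 1 (λ x → FP.:4 FP.:* (x FP.:* (FP.:1 FP.:- x)) FP.:= FP.:1 FP.:- (FP.:1 FP.:- FP.:2 FP.:* x) FP.:* (FP.:1 FP.:- FP.:2 FP.:* x)) refl

  4≢0 : ¬ 4F ≡ 0F
  4≢0 e = FP.*-nonzero 2≢0 2≢0 (trans (FP.solve 0 (FP.:2 FP.:* FP.:2 FP.:= FP.:4) refl) e)

  4≡2*2 : 4F ≡ 2F F.* 2F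
  4≡2*2 = FP.solve 0 (FP.:4 FP.:= FP.:2 FP.:* FP.:2) refl

  -1K≢1 : ¬ -1K ≡ 1K
  -1K≢1 e with K-char0 2 (trans (cong (1K K.+_) (KP.+-identityʳ 1K)) (trans (cong (1K K.+_) (sym e)) (KP.-‿inverseʳ 1K)))
  ... | ()

  -- If w² ≠ 1, multiply by G(w): G(w)² gives G(w²) J(w, w), duplication turns J(w, w) into J(φ, w),
  -- and G(φw) J(φ, w) is G(φ) G(w). If w² = 1, then w(4) = 1 and {w, -w} = {1, -1}, so both sides
  -- are the same product.
  hasse-davenport : ∀ {w} → Root w → ch w 4F K.* (G w K.* G (-1K K.* w)) ≡ G -1K K.* G (w K.* w)
  hasse-davenport {w} ew with (w K.* w) K.≟ 1K
  ... | no w²≢1 = KP.*-cancelˡ (G-nonzero ew (inverse-root ew) w≢1) (begin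
      G w K.* (ch w 4F K.* (G w K.* G (-1K K.* w)))         ≡⟨ KP.solve 3 (λ a c b → a KP.:* (c KP.:* (a KP.:* b)) KP.:= c KP.:* ((a KP.:* a) KP.:* b)) refl (G w) (ch w 4F) (G (-1K K.* w)) ⟩
      ch w 4F K.* ((G w K.* G w) K.* G (-1K K.* w))         ≡⟨ cong (λ z → ch w 4F K.* (z K.* G (-1K K.* w))) (G-jacobi ew ew w²≢1) ⟩
      ch w 4F K.* ((G (w K.* w) K.* J w w) K.* G (-1K K.* w)) ≡⟨ KP.solve 4 (λ c g j h → c KP.:* ((g KP.:* j) KP.:* h) KP.:= g KP.:* (h KP.:* (c KP.:* j))) refl (ch w 4F) (G (w K.* w)) (J w w) (G (-1K K.* w)) ⟩
      G (w K.* w) K.* (G (-1K K.* w) K.* (ch w 4F K.* J w w)) ≡⟨ cong (λ z → G (w K.* w) K.* (G (-1K K.* w) K.* z)) (J-duplication ew w≢1) ⟩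
      G (w K.* w) K.* (G (-1K K.* w) K.* J -1K w)           ≡⟨ cong (G (w K.* w) K.*_) (G-jacobi root--1 ew -w≢1) ⟨
      G (w K.* w) K.* (G -1K K.* G w)                       ≡⟨ KP.solve 3 (λ a b c → a KP.:* (b KP.:* c) KP.:= c KP.:* (b KP.:* a)) refl (G (w K.* w)) (G -1K) (G w) ⟩
      G w K.* (G -1K K.* G (w K.* w))                       ∎)
    where
    w≢1 : ¬ w ≡ 1K
    w≢1 refl = w²≢1 (KP.*-identityˡ 1K)
    -w≢1 : ¬ -1K K.* w ≡ 1K
    -w≢1 h = w²≢1 (begin
      w K.* w                            ≡⟨ KP.solve 1 (λ w → w KP.:* w KP.:= ((KP.:- KP.:1) KP.:* w) KP.:* ((KP.:- KP.:1) KP.:* w)) refl w ⟩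
      (-1K K.* w) K.* (-1K K.* w)        ≡⟨ trans (cong₂ K._*_ h h) (KP.*-identityˡ 1K) ⟩
      1K                                 ∎)
  ... | yes w²≡1 = begin
      ch w 4F K.* (G w K.* G (-1K K.* w))   ≡⟨ cong (K._* (G w K.* G (-1K K.* w))) (trans (cong (ch w) 4≡2*2) (trans (ch-square ew 2F) (trans (cong (λ z → ch z 2F) w²≡1) (ch-trivial 2≢0)))) ⟩
      1K K.* (G w K.* G (-1K K.* w))        ≡⟨ KP.*-identityˡ _ ⟩
      G w K.* G (-1K K.* w)                 ≡⟨ cases (KP.square≡1 w²≡1) ⟩
      G -1K K.* G 1K                        ≡⟨ cong (λ z → G -1K K.* G z) w²≡1 ⟨
      G -1K K.* G (w K.* w)                 ∎
    where
    cases : w ≡ 1K ⊎ w ≡ -1K → G w K.* G (-1K K.* w) ≡ G -1K K.* G 1K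
    cases (inj₁ refl) = trans (KP.*-comm _ _) (cong (λ z → G z K.* G 1K) (KP.*-identityʳ -1K))
    cases (inj₂ refl) = cong (λ z → G -1K K.* G z) -1*-1

  -- The summands of the hypergeometric series

  *-1ʳ : ∀ {x} y → x ≡ 1K → y K.* x ≡ y
  *-1ʳ y e = trans (cong (y K.*_) e) (KP.*-identityʳ y)

  *-1-1 : ∀ {x y} → x ≡ 1K → y ≡ 1K → x K.* y ≡ 1K
  *-1-1 ex ey = trans (cong₂ K._*_ ex ey) (KP.*-identityˡ 1K)

  -- If uv ≠ 1, combine the Jacobi relation for (u, v) with G(uv) G(m) = (uv)(-1) q. If uv = 1, then
  -- m = 1, and G(1) = -1 matches the sign in J(u, v) = -u(-1). At u = v = 1 the left side is -1 and
  -- the right side q(q - 2), hence the exclusion.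
  G-triple : ∀ {u v m} → Root u → Root v → (u K.* v) K.* m ≡ 1K → ¬ (u K.* v ≡ 1K × u ≡ 1K) →
    (G u K.* G v) K.* G m ≡ ch (u K.* v) -1F K.* (qK K.* J u v)
  G-triple {u} {v} {m} eu ev uvm ok with (u K.* v) K.≟ 1K
  ... | no uv≢1 = begin
      (G u K.* G v) K.* G m                       ≡⟨ cong (K._* G m) (G-jacobi eu ev uv≢1) ⟩
      (G (u K.* v) K.* J u v) K.* G m             ≡⟨ KP.solve 3 (λ a j b → (a KP.:* j) KP.:* b KP.:= (a KP.:* b) KP.:* j) refl (G (u K.* v)) (J u v) (G m) ⟩
      (G (u K.* v) K.* G m) K.* J u v             ≡⟨ cong (K._* J u v) (G-inverse (root-* eu ev) uvm uv≢1) ⟩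
      (ch (u K.* v) -1F K.* qK) K.* J u v         ≡⟨ KP.*-assoc _ _ _ ⟩
      ch (u K.* v) -1F K.* (qK K.* J u v)         ∎
  ... | yes uv≡1 = begin
      (G u K.* G v) K.* G m                       ≡⟨ cong₂ (λ a w → a K.* G w) (G-inverse eu uv≡1 u≢1) m≡1 ⟩
      (ch u -1F K.* qK) K.* G 1K                  ≡⟨ cong ((ch u -1F K.* qK) K.*_) G-1 ⟩
      (ch u -1F K.* qK) K.* -1K                   ≡⟨ KP.solve 2 (λ c q → (c KP.:* q) KP.:* (KP.:- KP.:1) KP.:= KP.:1 KP.:* (q KP.:* (KP.:- c))) refl (ch u -1F) qK ⟩
      1K K.* (qK K.* (K.- ch u -1F))              ≡⟨ cong₂ (λ c j → c K.* (qK K.* j)) (sym (trans (cong (λ w → ch w -1F) uv≡1) (ch-trivial -1F≢0))) (sym (J-inverse eu uv≡1 u≢1)) ⟩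
      ch (u K.* v) -1F K.* (qK K.* J u v)         ∎
    where
    u≢1 : ¬ u ≡ 1K
    u≢1 h = ok (uv≡1 , h)
    m≡1 : m ≡ 1K
    m≡1 = trans (sym (KP.*-identityˡ m)) (trans (cong (K._* m) (sym uv≡1)) uvm)

  ⊗≐ch : ∀ {χ ψ u v} → χ ≐ ch u → ψ ≐ ch v → (χ ⊗ ψ) ≐ ch (u K.* v)
  ⊗≐ch {u = u} {v} eχ eψ x = trans (cong₂ K._*_ (eχ x) (eψ x)) (sym (ch-⊗ u v x))

  pow≐ch : ∀ {χ u} → χ ≐ ch u → ∀ k → pow χ k ≐ ch (u K.^ k)
  pow≐ch e zero    = ε≐ch
  pow≐ch e (suc k) = ⊗≐ch e (pow≐ch e k)

  gauss-cong : ∀ {χ u} → χ ≐ ch u → gauss χ ≡ G u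
  gauss-cong e = ∑-cong (λ x → cong (K._* θ x) (e x))

  binom-ch : ∀ {χ ψ u v v′} → χ ≐ ch u → ψ ≐ ch v → v K.* v′ ≡ 1K → Root v →
    binom χ ψ ≡ ch v -1F K.* (qK K.⁻¹ K.* J u v′)
  binom-ch eχ eψ vv′ ev = cong₂ (λ a b → a K.* (qK K.⁻¹ K.* b)) (eψ -1F)
    (∑-cong (λ x → cong₂ K._*_ (eχ x) (bar≐ch eψ vv′ ev (1F F.- x))))

  ω^k-root : ∀ k → Root (ω K.^ k)
  ω^k-root k = trans (sym (KP.^-* ω k n)) (trans (cong (ω K.^_) (ℕₚ.*-comm k n))
    (trans (KP.^-* ω n k) (trans (cong (K._^ k) (proj₁ ω-root)) (KP.1^ k))))

  -- For s ≠ 0 the k-th term is the k-th power of ω^d with d = dlog (t/s), so the sum is geometric;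
  -- d = 0 only if s = t. For s = 0 every term vanishes.
  orthogonality : ∀ {t} s → ¬ t ≡ 0F →
    K.sumL (λ k → ch (ω K.^ k) t K.* ch ((ω K.^ k) K.⁻¹) s) (upTo n) ≡ ⟦ s F.≟ t ⟧ K.* nK
  orthogonality {t} s t≢0 with s F.≟ t
  ... | yes refl = begin
      K.sumL (λ k → ch (ω K.^ k) t K.* ch ((ω K.^ k) K.⁻¹) t) (upTo n) ≡⟨ KP.sumL-cong (λ k → ch-inv (inverse-root (ω^k-root k)) t≢0) (upTo n) ⟩
      K.sumL (λ k → 1K) (upTo n)                        ≡⟨ KP.sumL-const 1K (upTo n) ⟩
      length (upTo n) K.×1 K.* 1K                       ≡⟨ cong (λ m → m K.×1 K.* 1K) (Listₚ.length-upTo n) ⟩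
      nK K.* 1K                                         ≡⟨ KP.*-comm _ _ ⟩
      1K K.* nK                                         ∎
  ... | no s≢t with s F.≟ 0F
  ... | yes refl = trans (KP.sumL-cong (λ k → KP.zeroʳ _) (upTo n)) (trans (KP.sumL-0 (upTo n)) (sym (KP.zeroˡ _)))
  ... | no s≢0 = begin
      K.sumL (λ k → ch (ω K.^ k) t K.* ((ω K.^ k) K.⁻¹) K.^ dlog s) (upTo n) ≡⟨ KP.sumL-cong term (upTo n) ⟩
      K.sumL ((ω K.^ d) K.^_) (upTo n)                  ≡⟨ KP.geometric-0 n (ω^k-root d) ω^d≢1 ⟩
      0K                                                ≡⟨ KP.zeroˡ _ ⟨
      0K K.* nK                                         ∎
    where
    z = t F.* s F.⁻¹
    z≢0 = FP.*-nonzero t≢0 (FP.⁻¹-nonzero s≢0)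
    d = dlog z
    term : ∀ k → ch (ω K.^ k) t K.* ((ω K.^ k) K.⁻¹) K.^ dlog s ≡ (ω K.^ d) K.^ k
    term k = begin
      ch (ω K.^ k) t K.* ((ω K.^ k) K.⁻¹) K.^ dlog s    ≡⟨ cong (ch (ω K.^ k) t K.*_) (sym (trans (ch-⁻¹-inv (inverse-root (ω^k-root k)) (ω^k-root k) s≢0) (ch-nz _ s≢0))) ⟩
      ch (ω K.^ k) t K.* ch (ω K.^ k) (s F.⁻¹)          ≡⟨ ch-* (ω^k-root k) t _ ⟨
      ch (ω K.^ k) z                                    ≡⟨ ch-nz _ z≢0 ⟩
      (ω K.^ k) K.^ d                                   ≡⟨ KP.^-* ω k d ⟨
      ω K.^ (k ℕ.* d)                                   ≡⟨ cong (ω K.^_) (ℕₚ.*-comm k d) ⟩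
      ω K.^ (d ℕ.* k)                                   ≡⟨ KP.^-* ω d k ⟩
      (ω K.^ d) K.^ k                                   ∎
    d≢0 : ¬ d ≡ 0
    d≢0 d≡0 = s≢t (begin
      s                          ≡⟨ FP.*-identityˡ s ⟨
      1F F.* s                   ≡⟨ cong (F._* s) (trans (cong (g F.^_) (sym d≡0)) (proj₂ (dlog-spec z≢0))) ⟩
      t F.* s F.⁻¹ F.* s         ≡⟨ FP.solve 3 (λ t i s → t FP.:* i FP.:* s FP.:= t FP.:* (s FP.:* i)) refl t (s F.⁻¹) s ⟩
      t F.* (s F.* s F.⁻¹)       ≡⟨ trans (cong (t F.*_) (F.inverse s s≢0)) (FP.*-identityʳ t) ⟩
      t                          ∎)
    ω^d≢1 : ¬ ω K.^ d ≡ 1K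
    ω^d≢1 = proj₂ ω-root d (ℕₚ.n≢0⇒n>0 d≢0) (proj₁ (dlog-spec z≢0))

  -- The product of four Jacobi sums attached to one character χ

  module Parameters (a a′ i : K.Carrier) (aa′ : a K.* a′ ≡ 1K) (a-root : Root a)
    (i²≡-1 : i K.* i ≡ -1K) (i-root : Root i) where

    b b′ : K.Carrier
    b  = a K.* a
    b′ = a′ K.* a′

    bb′ : b K.* b′ ≡ 1K
    bb′ = trans (KP.solve 2 (λ a c → (a KP.:* a) KP.:* (c KP.:* c) KP.:= (a KP.:* c) KP.:* (a KP.:* c)) refl a a′) (*-1-1 aa′ aa′)

    b-root : Root b
    b-root = root-* a-root a-root

    b′-root : Root b′
    b′-root = root-inv bb′ b-root

    φ₂ gφ NG : K.Carrier
    φ₂ = ch -1K 2F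
    gφ = G -1K
    NG = G (b K.* i) K.* G (b′ K.* i)

    φ₂² : φ₂ K.* φ₂ ≡ 1K
    φ₂² = ch-inv -1*-1 2≢0

    -- The quartic character enters here: φ is the square of a character, so φ(-1) = 1 and g(φ)² is
    -- q without a sign.
    ch--1-neg1 : ch -1K -1F ≡ 1K
    ch--1-neg1 = trans (cong (λ w → ch w -1F) (sym i²≡-1)) (ch-square-neg1 i-root)

    gφ² : gφ K.* gφ ≡ qK
    gφ² = trans (G-inverse root--1 -1*-1 -1K≢1) (trans (cong (K._* qK) ch--1-neg1) (KP.*-identityˡ qK))

    fourth-power : K.Carrier → K.Carrier
    fourth-power x = (x K.* x) K.* (x K.* x)

    E : F.Carrier → K.Carrier
    E = ch (b′ K.* b′)

    s : F.Carrier → F.Carrier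
    s y = (y F.* y F.- 1F) F.* (y F.* y F.- 1F)

    module _ (b⁴≢1 : ¬ fourth-power b ≡ 1K) where

      i⁴ : fourth-power i ≡ 1K
      i⁴ = trans (cong₂ K._*_ i²≡-1 i²≡-1) -1*-1

      fourth-power-* : ∀ x y → fourth-power (x K.* y) ≡ fourth-power x K.* fourth-power y
      fourth-power-* = KP.solve 2 (λ x y → ((x KP.:* y) KP.:* (x KP.:* y)) KP.:* ((x KP.:* y) KP.:* (x KP.:* y)) KP.:= ((x KP.:* x) KP.:* (x KP.:* x)) KP.:* ((y KP.:* y) KP.:* (y KP.:* y))) refl

      fourth-power-1 : fourth-power 1K ≡ 1K
      fourth-power-1 = KP.solve 0 ((KP.:1 KP.:* KP.:1) KP.:* (KP.:1 KP.:* KP.:1) KP.:= KP.:1) refl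

      -- This and its companions for bi, b′ and b′i concern the products of the two characters in
      -- the four Jacobi sums below. Since i⁴ = 1, the one condition b⁴ ≠ 1 handles them all,
      -- independently of w.
      b≢1 : ¬ b ≡ 1K
      b≢1 h = b⁴≢1 (trans (cong fourth-power h) fourth-power-1)

      bi≢1 : ¬ b K.* i ≡ 1K
      bi≢1 h = b⁴≢1 (trans (sym (*-1ʳ _ i⁴)) (trans (sym (fourth-power-* b i)) (trans (cong fourth-power h) fourth-power-1)))

      b′⁴≢1 : ¬ fourth-power b′ ≡ 1K
      b′⁴≢1 h = b⁴≢1 (trans (sym (*-1ʳ _ h)) (trans (sym (fourth-power-* b b′)) (trans (cong fourth-power bb′) fourth-power-1)))

      b′≢1 : ¬ b′ ≡ 1K
      b′≢1 h = b′⁴≢1 (trans (cong fourth-power h) fourth-power-1)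

      b′i≢1 : ¬ b′ K.* i ≡ 1K
      b′i≢1 h = b′⁴≢1 (trans (sym (*-1ʳ _ i⁴)) (trans (sym (fourth-power-* b′ i)) (trans (cong fourth-power h) fourth-power-1)))

      bi-root : Root (b K.* i)
      bi-root = root-* b-root i-root
      b′i-root : Root (b′ K.* i)
      b′i-root = root-* b′-root i-root

      NG≢0 : ¬ NG ≡ 0K
      NG≢0 = KP.*-nonzero (G-nonzero bi-root (inverse-root bi-root) bi≢1) (G-nonzero b′i-root (inverse-root b′i-root) b′i≢1)

      module _ {w w′ : K.Carrier} (ww′ : w K.* w′ ≡ 1K) (w-root : Root w) where

        w′-root : Root w′
        w′-root = root-inv ww′ w-root

        -- The second arguments are written so that the four pairs of Gauss
        -- sums of the Hasse-Davenport relation appear literally.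
        J₁ J₂ J₃ J₄ : K.Carrier
        J₁ = J (b K.* w) w′
        J₂ = J (-1K K.* (b K.* w)) (-1K K.* ((b′ K.* b′) K.* w′))
        J₃ = J ((b K.* i) K.* w) ((b′ K.* b′) K.* w′)
        J₄ = J (-1K K.* ((b K.* i) K.* w)) (-1K K.* w′)

        private
          bw = b K.* w
          biw = (b K.* i) K.* w
          c = (b′ K.* b′) K.* w′
          u = (bw K.* bw) K.* (bw K.* bw)
          v = w′ K.* w′
          m = c K.* c
          bw-root : Root bw
          bw-root = root-* b-root w-root
          biw-root : Root biw
          biw-root = root-* (root-* b-root i-root) w-root
          c-root : Root c
          c-root = root-* (root-* b′-root b′-root) w′-root
          u-root : Root u
          u-root = root-* (root-* bw-root bw-root) (root-* bw-root bw-root)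
          v-root : Root v
          v-root = root-* w′-root w′-root
          m-root : Root m
          m-root = root-* c-root c-root

          pair : ∀ {x y z} → Root x → Root y → x K.* y ≡ z → ¬ z ≡ 1K → G x K.* G y ≡ G z K.* J x y
          pair ex ey refl z≢1 = G-jacobi ex ey z≢1

          R₁ : G bw K.* G w′ ≡ G b K.* J₁
          R₁ = pair bw-root w′-root (trans (KP.*-assoc b w w′) (*-1ʳ b ww′)) b≢1

          R₂ : G (-1K K.* bw) K.* G (-1K K.* c) ≡ G b′ K.* J₂
          R₂ = pair (root-* root--1 bw-root) (root-* root--1 c-root) (trans
            (KP.solve 4 (λ b d w x → ((KP.:- KP.:1) KP.:* (b KP.:* w)) KP.:* ((KP.:- KP.:1) KP.:* ((d KP.:* d) KP.:* x)) KP.:= d KP.:* ((b KP.:* d) KP.:* (w KP.:* x))) refl b b′ w w′)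
            (*-1ʳ b′ (*-1-1 bb′ ww′))) b′≢1

          R₃ : G biw K.* G c ≡ G (b′ K.* i) K.* J₃
          R₃ = pair biw-root c-root (trans
            (KP.solve 5 (λ b d w x i → ((b KP.:* i) KP.:* w) KP.:* ((d KP.:* d) KP.:* x) KP.:= (d KP.:* i) KP.:* ((b KP.:* d) KP.:* (w KP.:* x))) refl b b′ w w′ i)
            (*-1ʳ _ (*-1-1 bb′ ww′))) b′i≢1

          R₄ : G (-1K K.* biw) K.* G (-1K K.* w′) ≡ G (b K.* i) K.* J₄
          R₄ = pair (root-* root--1 biw-root) (root-* root--1 w′-root) (trans
            (KP.solve 4 (λ b w x i → ((KP.:- KP.:1) KP.:* ((b KP.:* i) KP.:* w)) KP.:* ((KP.:- KP.:1) KP.:* x) KP.:= (b KP.:* i) KP.:* (w KP.:* x)) refl b w w′ i)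
            (*-1ʳ _ ww′)) bi≢1

          Gb : G b K.* G b′ ≡ qK
          Gb = trans (G-inverse b-root bb′ b≢1) (trans (cong (K._* qK) (ch-square-neg1 a-root)) (KP.*-identityˡ qK))

          G₈ : K.Carrier
          G₈ = ((G bw K.* G (-1K K.* bw)) K.* (G biw K.* G (-1K K.* biw))) K.* ((G w′ K.* G (-1K K.* w′)) K.* (G c K.* G (-1K K.* c)))

          -- The same eight Gauss sums grouped in two ways: by the two arguments of each Jacobi sum,
          -- and by pairs differing by φ. The products free of w contribute NG and G(b) G(b′) = q,
          -- the sign b(-1) being 1 because b = a².
          eight : (qK K.* NG) K.* (J₁ K.* J₂ K.* J₃ K.* J₄) ≡ G₈
          eight = begin
            (qK K.* NG) K.* (J₁ K.* J₂ K.* J₃ K.* J₄)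
              ≡⟨ cong (λ z → (z K.* NG) K.* (J₁ K.* J₂ K.* J₃ K.* J₄)) (sym Gb) ⟩
            ((G b K.* G b′) K.* NG) K.* (J₁ K.* J₂ K.* J₃ K.* J₄)
              ≡⟨ KP.solve 8 (λ x y p q j₁ j₂ j₃ j₄ → ((x KP.:* y) KP.:* (p KP.:* q)) KP.:* (j₁ KP.:* j₂ KP.:* j₃ KP.:* j₄)
                   KP.:= ((x KP.:* j₁) KP.:* (y KP.:* j₂)) KP.:* ((q KP.:* j₃) KP.:* (p KP.:* j₄))) refl (G b) (G b′) (G (b K.* i)) (G (b′ K.* i)) J₁ J₂ J₃ J₄ ⟩
            ((G b K.* J₁) K.* (G b′ K.* J₂)) K.* ((G (b′ K.* i) K.* J₃) K.* (G (b K.* i) K.* J₄))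
              ≡⟨ cong₂ K._*_ (cong₂ K._*_ R₁ R₂) (cong₂ K._*_ R₃ R₄) ⟨
            ((G bw K.* G w′) K.* (G (-1K K.* bw) K.* G (-1K K.* c))) K.* ((G biw K.* G c) K.* (G (-1K K.* biw) K.* G (-1K K.* w′)))
              ≡⟨ KP.solve 8 (λ x y p q j₁ j₂ j₃ j₄ → ((x KP.:* y) KP.:* (p KP.:* q)) KP.:* ((j₁ KP.:* j₂) KP.:* (j₃ KP.:* j₄))
                   KP.:= ((x KP.:* p) KP.:* (j₁ KP.:* j₃)) KP.:* ((y KP.:* j₄) KP.:* (j₂ KP.:* q))) refl (G bw) (G w′) (G (-1K K.* bw)) (G (-1K K.* c)) (G biw) (G c) (G (-1K K.* biw)) (G (-1K K.* w′)) ⟩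
            G₈ ∎

          c₂ : K.Carrier
          c₂ = ch (bw K.* bw) 4F

          -- In the product of the four characters b and w cancel against b′ and w′, leaving i, and
          -- i(4) = i²(2) = φ(2). This is the origin of φ(2) in the constant.
          four-factor : (ch bw 4F K.* ch biw 4F) K.* (ch w′ 4F K.* ch c 4F) ≡ φ₂
          four-factor = begin
            (ch bw 4F K.* ch biw 4F) K.* (ch w′ 4F K.* ch c 4F)    ≡⟨ cong₂ K._*_ (ch-⊗ bw biw 4F) (ch-⊗ w′ c 4F) ⟨
            ch (bw K.* biw) 4F K.* ch (w′ K.* c) 4F                ≡⟨ ch-⊗ _ _ 4F ⟨
            ch ((bw K.* biw) K.* (w′ K.* c)) 4F                    ≡⟨ cong (λ z → ch z 4F) (trans
              (KP.solve 5 (λ b d w x i → ((b KP.:* w) KP.:* ((b KP.:* i) KP.:* w)) KP.:* (x KP.:* ((d KP.:* d) KP.:* x))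
                 KP.:= i KP.:* (((b KP.:* d) KP.:* (b KP.:* d)) KP.:* ((w KP.:* x) KP.:* (w KP.:* x)))) refl b b′ w w′ i)
              (*-1ʳ i (*-1-1 (*-1-1 bb′ bb′) (*-1-1 ww′ ww′)))) ⟩
            ch i 4F                                                ≡⟨ trans (cong (ch i) 4≡2*2) (ch-square i-root 2F) ⟩
            ch (i K.* i) 2F                                        ≡⟨ cong (λ z → ch z 2F) i²≡-1 ⟩
            φ₂                                                     ∎

          -- Because i² = -1, the squares produced by the first two pairs again differ by φ, which
          -- makes a second round of Hasse-Davenport possible.
          biw²≡-bw² : biw K.* biw ≡ -1K K.* (bw K.* bw)
          biw²≡-bw² = trans (KP.solve 3 (λ b w i → ((b KP.:* i) KP.:* w) KP.:* ((b KP.:* i) KP.:* w) KP.:= (i KP.:* i) KP.:* ((b KP.:* w) KP.:* (b KP.:* w))) refl b w i)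
            (cong (K._* (bw K.* bw)) i²≡-1)

          uvm : (u K.* v) K.* m ≡ 1K
          uvm = trans (KP.solve 4 (λ b d w x → ((((b KP.:* w) KP.:* (b KP.:* w)) KP.:* ((b KP.:* w) KP.:* (b KP.:* w))) KP.:* (x KP.:* x)) KP.:* (((d KP.:* d) KP.:* x) KP.:* ((d KP.:* d) KP.:* x))
                KP.:= (((b KP.:* d) KP.:* (b KP.:* d)) KP.:* ((b KP.:* d) KP.:* (b KP.:* d))) KP.:* (((w KP.:* x) KP.:* (w KP.:* x)) KP.:* ((w KP.:* x) KP.:* (w KP.:* x)))) refl b b′ w w′)
            (*-1-1 (trans (cong fourth-power bb′) fourth-power-1) (trans (cong fourth-power ww′) fourth-power-1))

          -- If u and v were both 1, then u v² = b⁴ would be 1 as well.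
          not-both : ¬ (u K.* v ≡ 1K × u ≡ 1K)
          not-both (uv , u1) = b⁴≢1 (begin
            fourth-power b                                ≡⟨ *-1ʳ _ (*-1-1 (*-1-1 ww′ ww′) (*-1-1 ww′ ww′)) ⟨
            fourth-power b K.* fourth-power (w K.* w′)
              ≡⟨ KP.solve 3 (λ b w x → ((b KP.:* b) KP.:* (b KP.:* b)) KP.:* (((w KP.:* x) KP.:* (w KP.:* x)) KP.:* ((w KP.:* x) KP.:* (w KP.:* x)))
                 KP.:= (((b KP.:* w) KP.:* (b KP.:* w)) KP.:* ((b KP.:* w) KP.:* (b KP.:* w))) KP.:* ((x KP.:* x) KP.:* (x KP.:* x))) refl b w w′ ⟩
            u K.* (v K.* v)                               ≡⟨ *-1-1 u1 (*-1-1 v1 v1) ⟩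
            1K                                            ∎)
            where
            v1 : v ≡ 1K
            v1 = trans (sym (KP.*-identityˡ v)) (trans (cong (K._* v) (sym u1)) uv)

          triple : (G u K.* G v) K.* G m ≡ qK K.* J u v
          triple = trans (G-triple u-root v-root uvm not-both) (trans (cong (K._* (qK K.* J u v)) uv-sign) (KP.*-identityˡ _))
            where
            uv-sign : ch (u K.* v) -1F ≡ 1K
            uv-sign = trans (cong (λ z → ch z -1F) (KP.solve 2 (λ x y → (x KP.:* x) KP.:* (y KP.:* y) KP.:= (x KP.:* y) KP.:* (x KP.:* y)) refl (bw K.* bw) w′))
              (ch-square-neg1 (root-* (root-* bw-root bw-root) w′-root))

          -- Hasse-Davenport is applied to each of the four pairs in `G₈`, then once more to the
          -- pair (bw)², φ(bw)². The four factors g(φ) of the first round give q²; the fifth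
          -- remains.
          φ₂c₂G₈ : (φ₂ K.* c₂) K.* G₈ ≡ (qK K.* qK K.* gφ) K.* (qK K.* J u v)
          φ₂c₂G₈ = begin
            (φ₂ K.* c₂) K.* G₈     ≡⟨ cong (λ z → (z K.* c₂) K.* G₈) four-factor ⟨
            (((ch bw 4F K.* ch biw 4F) K.* (ch w′ 4F K.* ch c 4F)) K.* c₂) K.* G₈
              ≡⟨ KP.solve 9 (λ c₁ c₂ c₃ c₄ d g₁ g₂ g₃ g₄ → (((c₁ KP.:* c₂) KP.:* (c₃ KP.:* c₄)) KP.:* d) KP.:* ((g₁ KP.:* g₂) KP.:* (g₃ KP.:* g₄))
                   KP.:= d KP.:* (((c₁ KP.:* g₁) KP.:* (c₂ KP.:* g₂)) KP.:* ((c₃ KP.:* g₃) KP.:* (c₄ KP.:* g₄)))) refl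
                   (ch bw 4F) (ch biw 4F) (ch w′ 4F) (ch c 4F) c₂ (G bw K.* G (-1K K.* bw)) (G biw K.* G (-1K K.* biw)) (G w′ K.* G (-1K K.* w′)) (G c K.* G (-1K K.* c)) ⟩
            c₂ K.* (((ch bw 4F K.* (G bw K.* G (-1K K.* bw))) K.* (ch biw 4F K.* (G biw K.* G (-1K K.* biw)))) K.* ((ch w′ 4F K.* (G w′ K.* G (-1K K.* w′))) K.* (ch c 4F K.* (G c K.* G (-1K K.* c)))))
              ≡⟨ cong (c₂ K.*_) (cong₂ K._*_ (cong₂ K._*_ (hasse-davenport bw-root) (trans (hasse-davenport biw-root) (cong (λ z → gφ K.* G z) biw²≡-bw²))) (cong₂ K._*_ (hasse-davenport w′-root) (hasse-davenport c-root))) ⟩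
            c₂ K.* (((gφ K.* G (bw K.* bw)) K.* (gφ K.* G (-1K K.* (bw K.* bw)))) K.* ((gφ K.* G v) K.* (gφ K.* G m)))
              ≡⟨ KP.solve 6 (λ d f x y v m → d KP.:* (((f KP.:* x) KP.:* (f KP.:* y)) KP.:* ((f KP.:* v) KP.:* (f KP.:* m)))
                   KP.:= ((f KP.:* f) KP.:* (f KP.:* f)) KP.:* ((d KP.:* (x KP.:* y)) KP.:* (v KP.:* m))) refl c₂ gφ (G (bw K.* bw)) (G (-1K K.* (bw K.* bw))) (G v) (G m) ⟩
            ((gφ K.* gφ) K.* (gφ K.* gφ)) K.* ((c₂ K.* (G (bw K.* bw) K.* G (-1K K.* (bw K.* bw)))) K.* (G v K.* G m))
              ≡⟨ cong₂ (λ x y → (x K.* x) K.* (y K.* (G v K.* G m))) gφ² (hasse-davenport (root-* bw-root bw-root)) ⟩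
            (qK K.* qK) K.* ((gφ K.* G u) K.* (G v K.* G m))
              ≡⟨ KP.solve 5 (λ q f x y z → (q KP.:* q) KP.:* ((f KP.:* x) KP.:* (y KP.:* z)) KP.:= (q KP.:* q KP.:* f) KP.:* ((x KP.:* y) KP.:* z)) refl qK gφ (G u) (G v) (G m) ⟩
            (qK K.* qK K.* gφ) K.* ((G u K.* G v) K.* G m)
              ≡⟨ cong ((qK K.* qK K.* gφ) K.*_) triple ⟩
            (qK K.* qK K.* gφ) K.* (qK K.* J u v) ∎

          -- The factor u(2) of the parametrised Jacobi sum equals the one that the second round of
          -- Hasse-Davenport introduced, (bw)²(4). They cancel in `jacobi-product`, which is why no
          -- power of w(2) is left there.
          ch-u-2 : ch u 2F ≡ c₂
          ch-u-2 = trans (sym (ch-square (root-* bw-root bw-root) 2F)) (cong (ch (bw K.* bw)) (sym 4≡2*2))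

          -- Both m = c² and v = w′² are squares and c contains w′ once, so the w-dependence gathers
          -- into the single value of w′ at (1 + y)²(y - 1)² = `s y`.
          Juv : J u v ≡ c₂ K.* ∑ (λ y → E ((1F F.+ y) F.* (1F F.+ y)) K.* ch w′ (s y))
          Juv = trans (J-parametrised u-root v-root m-root (trans (sym (KP.*-assoc u v m)) uvm))
            (cong₂ K._*_ ch-u-2 (∑-cong summand))
            where
            b′²-root : Root (b′ K.* b′)
            b′²-root = root-* b′-root b′-root
            summand : ∀ y → ch m (1F F.+ y) K.* ch v (y F.- 1F) ≡ E ((1F F.+ y) F.* (1F F.+ y)) K.* ch w′ (s y)
            summand y = begin
              ch m (1F F.+ y) K.* ch v (y F.- 1F)
                ≡⟨ cong₂ K._*_ (sym (ch-square c-root (1F F.+ y))) (sym (ch-square w′-root (y F.- 1F))) ⟩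
              ch c Y K.* ch w′ ((y F.- 1F) F.* (y F.- 1F))
                ≡⟨ cong (K._* ch w′ ((y F.- 1F) F.* (y F.- 1F))) (ch-⊗ (b′ K.* b′) w′ Y) ⟩
              (E Y K.* ch w′ Y) K.* ch w′ ((y F.- 1F) F.* (y F.- 1F))
                ≡⟨ KP.*-assoc _ _ _ ⟩
              E Y K.* (ch w′ Y K.* ch w′ ((y F.- 1F) F.* (y F.- 1F)))
                ≡⟨ cong (E Y K.*_) (trans (sym (ch-* w′-root Y _)) (cong (ch w′) (FP.solve 1 (λ y → ((FP.:1 FP.:+ y) FP.:* (FP.:1 FP.:+ y)) FP.:* ((y FP.:- FP.:1) FP.:* (y FP.:- FP.:1)) FP.:= (y FP.:* y FP.:- FP.:1) FP.:* (y FP.:* y FP.:- FP.:1)) refl y))) ⟩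
              E Y K.* ch w′ (s y) ∎
              where Y = (1F F.+ y) F.* (1F F.+ y)

          c₂≢0 : ¬ c₂ ≡ 0K
          c₂≢0 = ch-nonzero (root-* bw-root bw-root) 4≢0

        jacobi-product : NG K.* (J₁ K.* J₂ K.* J₃ K.* J₄)
          ≡ ((φ₂ K.* gφ) K.* (qK K.* qK)) K.* ∑ (λ y → E ((1F F.+ y) F.* (1F F.+ y)) K.* ch w′ (s y))
        jacobi-product = KP.*-cancelˡ (KP.*-nonzero c₂≢0 qK≢0) (begin
          (c₂ K.* qK) K.* (NG K.* jj)                         ≡⟨ *-1ʳ _ φ₂² ⟨
          ((c₂ K.* qK) K.* (NG K.* jj)) K.* (φ₂ K.* φ₂)       ≡⟨ KP.solve 5 (λ c q N j f → ((c KP.:* q) KP.:* (N KP.:* j)) KP.:* (f KP.:* f) KP.:= f KP.:* ((f KP.:* c) KP.:* ((q KP.:* N) KP.:* j))) refl c₂ qK NG jj φ₂ ⟩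
          φ₂ K.* ((φ₂ K.* c₂) K.* ((qK K.* NG) K.* jj))       ≡⟨ cong (λ z → φ₂ K.* ((φ₂ K.* c₂) K.* z)) eight ⟩
          φ₂ K.* ((φ₂ K.* c₂) K.* G₈)                         ≡⟨ cong (φ₂ K.*_) φ₂c₂G₈ ⟩
          φ₂ K.* ((qK K.* qK K.* gφ) K.* (qK K.* J u v))      ≡⟨ cong (λ z → φ₂ K.* ((qK K.* qK K.* gφ) K.* (qK K.* z))) Juv ⟩
          φ₂ K.* ((qK K.* qK K.* gφ) K.* (qK K.* (c₂ K.* S))) ≡⟨ KP.solve 5 (λ f q h c S → f KP.:* ((q KP.:* q KP.:* h) KP.:* (q KP.:* (c KP.:* S))) KP.:= (c KP.:* q) KP.:* (((f KP.:* h) KP.:* (q KP.:* q)) KP.:* S)) refl φ₂ qK gφ c₂ S ⟩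
          (c₂ K.* qK) K.* (((φ₂ K.* gφ) K.* (qK K.* qK)) K.* S) ∎)
          where
          jj = J₁ K.* J₂ K.* J₃ K.* J₄
          S = ∑ (λ y → E ((1F F.+ y) F.* (1F F.+ y)) K.* ch w′ (s y))

  ch-cong : ∀ {χ : Char} {u v} → u ≡ v → χ ≐ ch u → χ ≐ ch v
  ch-cong refl e = e

  ⟦⟧-pair-cong : {P Q R S : Set} (d : Dec P) (e : Dec Q) (f : Dec R) (h : Dec S) →
    (P → Q → R × S) → (R → S → P × Q) → ∀ z → ⟦ d ⟧ K.* (⟦ e ⟧ K.* z) ≡ ⟦ f ⟧ K.* (⟦ h ⟧ K.* z)
  ⟦⟧-pair-cong d e f h to from z with d | e | f | h
  ... | yes p | yes q | f | h = cong₂ (λ x y → x K.* (y K.* z)) (sym (⟦⟧-yes f (proj₁ (to p q)))) (sym (⟦⟧-yes h (proj₂ (to p q))))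
  ... | no ¬p | e | yes r | yes s = contradiction (proj₁ (from r s)) ¬p
  ... | yes _ | no ¬q | yes r | yes s = contradiction (proj₂ (from r s)) ¬q
  ... | no _ | e | no _ | h = trans (KP.zeroˡ _) (sym (KP.zeroˡ _))
  ... | yes _ | no _ | no _ | h = trans (cong (1K K.*_) (KP.zeroˡ z)) (trans (KP.zeroʳ 1K) (sym (KP.zeroˡ _)))
  ... | no _ | e | yes _ | no _ = trans (KP.zeroˡ _) (sym (trans (cong (1K K.*_) (KP.zeroˡ z)) (KP.zeroʳ 1K)))
  ... | yes _ | no _ | yes _ | no _ = refl

  -- Evaluation of the series by orthogonality

  module WithCharacters (A χ4 : Char) (A-char : IsChar A) (χ4-char : IsChar χ4)
    (χ4⁴ : pow χ4 4 ≐ ε) (χ4²≢ε : ¬ pow χ4 2 ≐ ε)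
    (A²≢ε : ¬ pow A 2 ≐ ε) (A²≢φ : ¬ pow A 2 ≐ φ) (A²≢χ4 : ¬ pow A 2 ≐ χ4) (A²≢χ4ᵇ : ¬ pow A 2 ≐ bar χ4) where

    open Thm A χ4 renaming (c to A⁻⁴φ₂)

    a i : K.Carrier
    a = A g
    i = χ4 g

    a-root : Root a
    a-root = char-root A-char

    i-root : Root i
    i-root = char-root χ4-char

    A≐ : A ≐ ch a
    A≐ = char≐ch A-char

    χ4≐ : χ4 ≐ ch i
    χ4≐ = char≐ch χ4-char

    square-form : ∀ x → x K.^ 2 ≡ x K.* x
    square-form = KP.solve 1 (λ x → x KP.:* (x KP.:* KP.:1) KP.:= x KP.:* x) refl

    i²≡-1 : i K.* i ≡ -1K
    i²≡-1 with KP.square≡1 {i K.* i} (begin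
        (i K.* i) K.* (i K.* i)   ≡⟨ KP.solve 1 (λ x → (x KP.:* x) KP.:* (x KP.:* x) KP.:= x KP.:* (x KP.:* (x KP.:* (x KP.:* KP.:1)))) refl i ⟩
        i K.^ 4                   ≡⟨ ch-g (trans (sym (KP.^-* i 4 n)) (trans (cong (i K.^_) (ℕₚ.*-comm 4 n)) (trans (KP.^-* i n 4) (trans (cong (K._^ 4) i-root) (KP.1^ 4))))) ⟨
        ch (i K.^ 4) g            ≡⟨ pow≐ch χ4≐ 4 g ⟨
        pow χ4 4 g                ≡⟨ χ4⁴ g ⟩
        ε g                       ≡⟨ trans (ε≐ch g) (ch-trivial g≢0) ⟩
        1K                        ∎)
    ... | inj₂ h = h
    ... | inj₁ h = contradiction (λ x → trans (pow≐ch χ4≐ 2 x) (trans (cong (λ w → ch w x) (trans (square-form i) h)) (sym (ε≐ch x)))) χ4²≢ε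

    open Parameters a (a K.⁻¹) i (inverse-root a-root) a-root i²≡-1 i-root

    A2≐ : A2 ≐ ch b
    A2≐ = ch-cong (square-form a) (pow≐ch A≐ 2)

    A4≐ : A4 ≐ ch (b K.* b)
    A4≐ = ch-cong (KP.solve 1 (λ x → x KP.:* (x KP.:* (x KP.:* (x KP.:* KP.:1))) KP.:= (x KP.:* x) KP.:* (x KP.:* x)) refl a) (pow≐ch A≐ 4)

    ī : K.Carrier
    ī = -1K K.* i

    iī : i K.* ī ≡ 1K
    iī = trans (KP.solve 1 (λ x → x KP.:* ((KP.:- KP.:1) KP.:* x) KP.:= (KP.:- KP.:1) KP.:* (x KP.:* x)) refl i) (trans (cong (-1K K.*_) i²≡-1) -1*-1)

    χ4ᵇ≐ : bar χ4 ≐ ch ī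
    χ4ᵇ≐ = bar≐ch χ4≐ iī i-root

    -- The fourth roots of unity are 1, -1, i and -i, the values at g of ε, φ, χ₄ and its inverse.
    b⁴≢1 : ¬ fourth-power b ≡ 1K
    b⁴≢1 h with KP.square≡1 {b K.* b} h
    ... | inj₁ b²≡1 with KP.square≡1 {b} b²≡1
    ...   | inj₁ e = A²≢ε (λ x → trans (ch-cong e A2≐ x) (sym (ε≐ch x)))
    ...   | inj₂ e = A²≢φ (λ x → trans (ch-cong e A2≐ x) (sym (φ≐ch x)))
    b⁴≢1 h | inj₂ b²≡-1 with KP.square≡square {b} {i} (trans b²≡-1 (sym i²≡-1))
    ...   | inj₁ e = A²≢χ4 (λ x → trans (ch-cong e A2≐ x) (sym (χ4≐ x)))
    ...   | inj₂ e = A²≢χ4ᵇ (λ x → trans (ch-cong (trans e (KP.solve 1 (λ x → KP.:- x KP.:= (KP.:- KP.:1) KP.:* x) refl i)) A2≐ x) (sym (χ4ᵇ≐ x)))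

    b²b′² : (b K.* b) K.* (b′ K.* b′) ≡ 1K
    b²b′² = trans (KP.solve 2 (λ a c → (a KP.:* a) KP.:* (c KP.:* c) KP.:= (a KP.:* c) KP.:* (a KP.:* c)) refl b b′) (*-1-1 bb′ bb′)

    b²-root : Root (b K.* b)
    b²-root = root-* b-root b-root

    b′²-root : Root (b′ K.* b′)
    b′²-root = root-* b′-root b′-root

    A4b≐ : A4b ≐ E
    A4b≐ = bar≐ch A4≐ b²b′² b²-root

    N≡NG : N ≡ NG
    N≡NG = cong₂ K._*_ (gauss-cong (⊗≐ch A2≐ χ4≐)) (gauss-cong (⊗≐ch (bar≐ch A2≐ bb′ b-root) χ4≐))

    N≢0 : ¬ N ≡ 0K
    N≢0 e = NG≢0 b⁴≢1 (trans (sym N≡NG) e)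

    gaussφ≡gφ : gauss φ ≡ gφ
    gaussφ≡gφ = gauss-cong φ≐ch

    term : F.Carrier → Char → K.Carrier
    term t χ = binom (A2 ⊗ χ) χ K.* binom ((A2 ⊗ φ) ⊗ χ) ((A4 ⊗ φ) ⊗ χ)
      K.* binom ((A2 ⊗ χ4) ⊗ χ) (A4 ⊗ χ) K.* binom ((A2 ⊗ bar χ4) ⊗ χ) (φ ⊗ χ) K.* χ t

    q⁻¹ : K.Carrier
    q⁻¹ = qK K.⁻¹

    weight : F.Carrier → K.Carrier
    weight y = E ((1F F.+ y) F.* (1F F.+ y))

    module _ (k : ℕ) where
      private
        w w′ : K.Carrier
        w  = ω K.^ k
        w′ = w K.⁻¹
        w-root : Root w
        w-root = ω^k-root k
        ww′ : w K.* w′ ≡ 1K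
        ww′ = inverse-root w-root
        χ≐ = charK≐ch k
        e = ch w -1F
        j₁ = J₁ b⁴≢1 ww′ w-root
        j₂ = J₂ b⁴≢1 ww′ w-root
        j₃ = J₃ b⁴≢1 ww′ w-root
        j₄ = J₄ b⁴≢1 ww′ w-root

        -- The lower characters are χ times A⁴φ, A⁴ or φ, all of them 1 at -1. Hence the four
        -- binomials carry the same sign e = χ(-1), and e⁴ = 1.
        b²-even : ∀ x → ch ((b K.* b) K.* x) -1F ≡ ch x -1F
        b²-even x = trans (ch-⊗ (b K.* b) x -1F) (trans (cong (K._* ch x -1F) (ch-square-neg1 b-root)) (KP.*-identityˡ _))

        -1-even : ∀ x → ch (-1K K.* x) -1F ≡ ch x -1F
        -1-even x = trans (ch-⊗ -1K x -1F) (trans (cong (K._* ch x -1F) ch--1-neg1) (KP.*-identityˡ _))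

        -ww′ : (-1K K.* w) K.* (-1K K.* w′) ≡ 1K
        -ww′ = trans (KP.solve 2 (λ x y → ((KP.:- KP.:1) KP.:* x) KP.:* ((KP.:- KP.:1) KP.:* y) KP.:= x KP.:* y) refl w w′) ww′

        B₁ : binom (A2 ⊗ charK k) (charK k) ≡ e K.* (q⁻¹ K.* j₁)
        B₁ = binom-ch (⊗≐ch A2≐ χ≐) χ≐ ww′ w-root

        B₂ : binom ((A2 ⊗ φ) ⊗ charK k) ((A4 ⊗ φ) ⊗ charK k) ≡ e K.* (q⁻¹ K.* j₂)
        B₂ = trans (binom-ch {v = (b K.* b) K.* (-1K K.* w)}
            (ch-cong (KP.solve 2 (λ b w → (b KP.:* (KP.:- KP.:1)) KP.:* w KP.:= (KP.:- KP.:1) KP.:* (b KP.:* w)) refl b w) (⊗≐ch (⊗≐ch A2≐ φ≐ch) χ≐))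
            (ch-cong (KP.*-assoc _ _ _) (⊗≐ch (⊗≐ch A4≐ φ≐ch) χ≐))
            (trans (KP.solve 4 (λ b c w x → (b KP.:* ((KP.:- KP.:1) KP.:* w)) KP.:* ((KP.:- KP.:1) KP.:* (c KP.:* x)) KP.:= (b KP.:* c) KP.:* (w KP.:* x)) refl (b K.* b) (b′ K.* b′) w w′) (*-1-1 b²b′² ww′))
            (root-* b²-root (root-* root--1 w-root)))
          (cong (K._* (q⁻¹ K.* j₂)) (trans (b²-even _) (-1-even w)))

        B₃ : binom ((A2 ⊗ χ4) ⊗ charK k) (A4 ⊗ charK k) ≡ e K.* (q⁻¹ K.* j₃)
        B₃ = trans (binom-ch (⊗≐ch (⊗≐ch A2≐ χ4≐) χ≐) (⊗≐ch A4≐ χ≐)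
            (trans (KP.solve 4 (λ b c w x → (b KP.:* w) KP.:* (c KP.:* x) KP.:= (b KP.:* c) KP.:* (w KP.:* x)) refl (b K.* b) (b′ K.* b′) w w′) (*-1-1 b²b′² ww′))
            (root-* b²-root w-root))
          (cong (K._* (q⁻¹ K.* j₃)) (b²-even w))

        B₄ : binom ((A2 ⊗ bar χ4) ⊗ charK k) (φ ⊗ charK k) ≡ e K.* (q⁻¹ K.* j₄)
        B₄ = trans (binom-ch
            (ch-cong (KP.solve 3 (λ b i w → (b KP.:* ((KP.:- KP.:1) KP.:* i)) KP.:* w KP.:= (KP.:- KP.:1) KP.:* ((b KP.:* i) KP.:* w)) refl b i w) (⊗≐ch (⊗≐ch A2≐ χ4ᵇ≐) χ≐))
            (⊗≐ch φ≐ch χ≐) -ww′ (root-* root--1 w-root))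
          (cong (K._* (q⁻¹ K.* j₄)) (-1-even w))

      N*term : ∀ t → N K.* term t (charK k) ≡
        ((q⁻¹ K.* q⁻¹) K.* (φ₂ K.* gφ)) K.* ∑ (λ y → weight y K.* (ch (ω K.^ k) t K.* ch ((ω K.^ k) K.⁻¹) (s y)))
      N*term t = begin
        N K.* term t (charK k)
          ≡⟨ cong₂ K._*_ N≡NG (cong₂ K._*_ (cong₂ K._*_ (cong₂ K._*_ (cong₂ K._*_ B₁ B₂) B₃) B₄) (χ≐ t)) ⟩
        NG K.* ((e K.* (q⁻¹ K.* j₁)) K.* (e K.* (q⁻¹ K.* j₂)) K.* (e K.* (q⁻¹ K.* j₃)) K.* (e K.* (q⁻¹ K.* j₄)) K.* ch w t)
          ≡⟨ KP.solve 8 (λ N e r x y z u c → N KP.:* ((e KP.:* (r KP.:* x)) KP.:* (e KP.:* (r KP.:* y)) KP.:* (e KP.:* (r KP.:* z)) KP.:* (e KP.:* (r KP.:* u)) KP.:* c)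
               KP.:= (((e KP.:* e) KP.:* (e KP.:* e)) KP.:* ((r KP.:* r) KP.:* (r KP.:* r))) KP.:* ((N KP.:* (x KP.:* y KP.:* z KP.:* u)) KP.:* c)) refl NG e q⁻¹ j₁ j₂ j₃ j₄ (ch w t) ⟩
        (((e K.* e) K.* (e K.* e)) K.* ((q⁻¹ K.* q⁻¹) K.* (q⁻¹ K.* q⁻¹))) K.* ((NG K.* (j₁ K.* j₂ K.* j₃ K.* j₄)) K.* ch w t)
          ≡⟨ cong₂ (λ x y → (x K.* ((q⁻¹ K.* q⁻¹) K.* (q⁻¹ K.* q⁻¹))) K.* (y K.* ch w t)) (*-1-1 (ch-neg1-square w-root) (ch-neg1-square w-root)) (jacobi-product b⁴≢1 ww′ w-root) ⟩
        (1K K.* ((q⁻¹ K.* q⁻¹) K.* (q⁻¹ K.* q⁻¹))) K.* ((((φ₂ K.* gφ) K.* (qK K.* qK)) K.* S) K.* ch w t)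
          ≡⟨ KP.solve 5 (λ r f q S c → (KP.:1 KP.:* ((r KP.:* r) KP.:* (r KP.:* r))) KP.:* (((f KP.:* (q KP.:* q)) KP.:* S) KP.:* c)
               KP.:= (((r KP.:* r) KP.:* f) KP.:* (c KP.:* S)) KP.:* ((q KP.:* r) KP.:* (q KP.:* r))) refl q⁻¹ (φ₂ K.* gφ) qK S (ch w t) ⟩
        (((q⁻¹ K.* q⁻¹) K.* (φ₂ K.* gφ)) K.* (ch w t K.* S)) K.* ((qK K.* q⁻¹) K.* (qK K.* q⁻¹))
          ≡⟨ *-1ʳ _ (*-1-1 (K.inverse qK qK≢0) (K.inverse qK qK≢0)) ⟩
        ((q⁻¹ K.* q⁻¹) K.* (φ₂ K.* gφ)) K.* (ch w t K.* S)
          ≡⟨ cong (((q⁻¹ K.* q⁻¹) K.* (φ₂ K.* gφ)) K.*_) (trans (sym (∑-*ˡ (ch w t) _)) (∑-cong (λ y → KP.solve 3 (λ c x y → c KP.:* (x KP.:* y) KP.:= x KP.:* (c KP.:* y)) refl (ch w t) (weight y) (ch w′ (s y))))) ⟩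
        ((q⁻¹ K.* q⁻¹) K.* (φ₂ K.* gφ)) K.* ∑ (λ y → weight y K.* (ch w t K.* ch w′ (s y))) ∎
        where S = ∑ (λ y → weight y K.* ch w′ (s y))

    -- Interchanging the sums leaves for each y a complete character sum detecting s y = t. Its
    -- value q - 1 cancels the normalisation of Greene's series, and the four factors 1/q of the
    -- binomials cancel against powers of q.
    series-value : ∀ {t} → ¬ t ≡ 0F →
      (qK K.* N) K.* Fn t ≡ (φ₂ K.* gφ) K.* ∑ (λ y → ⟦ s y F.≟ t ⟧ K.* weight y)
    series-value {t} t≢0 = begin
      (qK K.* N) K.* ((qK K.* nK K.⁻¹) K.* K.sumL (term t) allChars)
        ≡⟨ cong (λ z → (qK K.* N) K.* ((qK K.* nK K.⁻¹) K.* z)) (KP.sumL-map (term t) charK (upTo n)) ⟩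
      (qK K.* N) K.* ((qK K.* nK K.⁻¹) K.* K.sumL (λ k → term t (charK k)) (upTo n))
        ≡⟨ KP.solve 4 (λ q N m z → (q KP.:* N) KP.:* ((q KP.:* m) KP.:* z) KP.:= ((q KP.:* q) KP.:* m) KP.:* (N KP.:* z)) refl qK N (nK K.⁻¹) _ ⟩
      ((qK K.* qK) K.* nK K.⁻¹) K.* (N K.* K.sumL (λ k → term t (charK k)) (upTo n))
        ≡⟨ cong (((qK K.* qK) K.* nK K.⁻¹) K.*_) (begin
          N K.* K.sumL (λ k → term t (charK k)) (upTo n)                  ≡⟨ KP.sumL-*ˡ N _ (upTo n) ⟨
          K.sumL (λ k → N K.* term t (charK k)) (upTo n)                  ≡⟨ KP.sumL-cong (λ k → N*term k t) (upTo n) ⟩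
          K.sumL (λ k → κ K.* ∑ (λ y → weight y K.* orth k y)) (upTo n)   ≡⟨ KP.sumL-*ˡ κ _ (upTo n) ⟩
          κ K.* K.sumL (λ k → ∑ (λ y → weight y K.* orth k y)) (upTo n)   ≡⟨ cong (κ K.*_) (KP.sumL-swap (λ k y → weight y K.* orth k y) (upTo n) F.elems) ⟩
          κ K.* ∑ (λ y → K.sumL (λ k → weight y K.* orth k y) (upTo n))   ≡⟨ cong (κ K.*_) (∑-cong (λ y → trans (KP.sumL-*ˡ (weight y) _ (upTo n)) (cong (weight y K.*_) (orthogonality (s y) t≢0)))) ⟩
          κ K.* ∑ (λ y → weight y K.* (⟦ s y F.≟ t ⟧ K.* nK))             ≡⟨ cong (κ K.*_) (∑-cong (λ y → KP.solve 3 (λ a b c → a KP.:* (b KP.:* c) KP.:= (b KP.:* a) KP.:* c) refl (weight y) ⟦ s y F.≟ t ⟧ nK)) ⟩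
          κ K.* ∑ (λ y → (⟦ s y F.≟ t ⟧ K.* weight y) K.* nK)             ≡⟨ cong (κ K.*_) (∑-*ʳ _ nK) ⟩
          κ K.* (Σ′ K.* nK)                                               ∎) ⟩
      ((qK K.* qK) K.* nK K.⁻¹) K.* (κ K.* (Σ′ K.* nK))
        ≡⟨ KP.solve 6 (λ q m r f S n → ((q KP.:* q) KP.:* m) KP.:* (((r KP.:* r) KP.:* f) KP.:* (S KP.:* n))
             KP.:= (f KP.:* S) KP.:* (((q KP.:* r) KP.:* (q KP.:* r)) KP.:* (n KP.:* m))) refl qK (nK K.⁻¹) q⁻¹ (φ₂ K.* gφ) Σ′ nK ⟩
      ((φ₂ K.* gφ) K.* Σ′) K.* (((qK K.* q⁻¹) K.* (qK K.* q⁻¹)) K.* (nK K.* nK K.⁻¹))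
        ≡⟨ *-1ʳ _ (*-1-1 (*-1-1 (K.inverse qK qK≢0) (K.inverse qK qK≢0)) (K.inverse nK nK≢0)) ⟩
      (φ₂ K.* gφ) K.* Σ′ ∎
      where
      κ = (q⁻¹ K.* q⁻¹) K.* (φ₂ K.* gφ)
      Σ′ = ∑ (λ y → ⟦ s y F.≟ t ⟧ K.* weight y)
      orth : ℕ → F.Carrier → K.Carrier
      orth k y = ch (ω K.^ k) t K.* ch ((ω K.^ k) K.⁻¹) (s y)

    -- Solutions of (v² - 1)² = 4x(1 - x) against pairs of square roots

    root-sum : F.Carrier → K.Carrier
    root-sum e = ∑ (λ y → ⟦ (y F.* y) F.≟ e ⟧ K.* E (1F F.+ y))

    -- A⁴(2)
    C₂ : K.Carrier
    C₂ = ch (b K.* b) 2F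

    E2*C₂ : E 2F K.* C₂ ≡ 1K
    E2*C₂ = trans (KP.*-comm _ _) (ch-inv b²b′² 2≢0)

    module _ (x : F.Carrier) where

      t : F.Carrier
      t = 4F F.* x F.* (1F F.- x)

      β : F.Carrier → F.Carrier → F.Carrier
      β v a = (F.- a) F.+ v

      -- Indexed by the sum v and the first member a of a pair (a, v - a), so that the product of
      -- the two root sums can be sorted by v.
      contribution : F.Carrier → F.Carrier → K.Carrier
      contribution v a = ⟦ (a F.* a) F.≟ x ⟧ K.* (⟦ (β v a F.* β v a) F.≟ (1F F.- x) ⟧ K.* E ((1F F.+ a) F.* (1F F.+ β v a)))

      root-sums-product : root-sum x K.* root-sum (1F F.- x) ≡ ∑ (λ v → ∑ (contribution v))
      root-sums-product = begin
        root-sum x K.* root-sum (1F F.- x)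
          ≡⟨ ∑-*ʳ _ _ ⟨
        ∑ (λ a → (⟦ (a F.* a) F.≟ x ⟧ K.* E (1F F.+ a)) K.* root-sum (1F F.- x))
          ≡⟨ ∑-cong (λ a → trans (cong ((⟦ (a F.* a) F.≟ x ⟧ K.* E (1F F.+ a)) K.*_) (sym (∑-translate (λ y → ⟦ (y F.* y) F.≟ (1F F.- x) ⟧ K.* E (1F F.+ y)) (F.- a)))) (sym (∑-*ˡ _ _))) ⟩
        ∑ (λ a → ∑ (λ v → (⟦ (a F.* a) F.≟ x ⟧ K.* E (1F F.+ a)) K.* (⟦ (β v a F.* β v a) F.≟ (1F F.- x) ⟧ K.* E (1F F.+ β v a))))
          ≡⟨ ∑-cong (λ a → ∑-cong (λ v → trans
               (KP.solve 4 (λ p e q f → (p KP.:* e) KP.:* (q KP.:* f) KP.:= p KP.:* (q KP.:* (e KP.:* f))) refl ⟦ (a F.* a) F.≟ x ⟧ (E (1F F.+ a)) ⟦ (β v a F.* β v a) F.≟ (1F F.- x) ⟧ (E (1F F.+ β v a)))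
               (cong (λ z → ⟦ (a F.* a) F.≟ x ⟧ K.* (⟦ (β v a F.* β v a) F.≟ (1F F.- x) ⟧ K.* z)) (sym (ch-* b′²-root (1F F.+ a) (1F F.+ β v a)))))) ⟩
        ∑ (λ a → ∑ (λ v → contribution v a))
          ≡⟨ ∑-swap _ ⟩
        ∑ (λ v → ∑ (contribution v)) ∎

      -- A pair (a , b) with a² = x and b² = 1 - x is determined by
      -- v = a + b ≠ 0, and v ranges over the solutions of (v² - 1)² = t.
      nonzero-contribution : ∀ {v} → ¬ v ≡ 0F → ⟦ s v F.≟ t ⟧ K.* weight v ≡ E 2F K.* ∑ (contribution v)
      nonzero-contribution {v} v≢0 = begin
        ⟦ s v F.≟ t ⟧ K.* weight v           ≡⟨ ⟦⟧*-cong (s v F.≟ t) (λ h → trans (cong E (double h)) (ch-* b′²-root 2F _)) ⟩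
        ⟦ s v F.≟ t ⟧ K.* (E 2F K.* X α)     ≡⟨ KP.solve 3 (λ p e X → p KP.:* (e KP.:* X) KP.:= e KP.:* (p KP.:* X)) refl ⟦ s v F.≟ t ⟧ (E 2F) (X α) ⟩
        E 2F K.* (⟦ s v F.≟ t ⟧ K.* X α)     ≡⟨ cong (E 2F K.*_) (∑-pick α (λ a → ⟦ s v F.≟ t ⟧ K.* X a)) ⟨
        E 2F K.* ∑ (λ a → ⟦ a F.≟ α ⟧ K.* (⟦ s v F.≟ t ⟧ K.* X a))
          ≡⟨ cong (E 2F K.*_) (∑-cong (λ a → ⟦⟧-pair-cong (a F.≟ α) (s v F.≟ t) ((a F.* a) F.≟ x) ((β v a F.* β v a) F.≟ (1F F.- x)) (λ { refl h → from h }) (λ h k → to h k) (X a))) ⟩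
        E 2F K.* ∑ (contribution v)          ∎
        where
        X : F.Carrier → K.Carrier
        X a = E ((1F F.+ a) F.* (1F F.+ β v a))
        -- Inserting a² = x into (v - a)² = 1 - x leaves an equation linear in a, namely 2va = v² +
        -- 2x - 1; `α` is its solution.
        d c α : F.Carrier
        d = 2F F.* v
        c = v F.* v F.+ 2F F.* x F.- 1F
        α = c F.* d F.⁻¹
        d≢0 : ¬ d ≡ 0F
        d≢0 = FP.*-nonzero 2≢0 v≢0
        dα≡c : d F.* α ≡ c
        dα≡c = trans (FP.solve 3 (λ d c i → d FP.:* (c FP.:* i) FP.:= c FP.:* (d FP.:* i)) refl d c (d F.⁻¹))
          (trans (cong (c F.*_) (F.inverse d d≢0)) (FP.*-identityʳ c))
        to : ∀ {a} → a F.* a ≡ x → β v a F.* β v a ≡ 1F F.- x → a ≡ α × s v ≡ t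
        to {a} h k = FP.*-cancelˡ d≢0 (trans da≡c (sym dα≡c)) , s≡t
          where
          B = β v a
          da≡c : d F.* a ≡ c
          da≡c = begin
            d F.* a
              ≡⟨ FP.solve 2 (λ v a → FP.:2 FP.:* v FP.:* a FP.:= v FP.:* v FP.:+ FP.:2 FP.:* (a FP.:* a) FP.:- (((FP.:- a) FP.:+ v) FP.:* ((FP.:- a) FP.:+ v) FP.:+ a FP.:* a)) refl v a ⟩
            v F.* v F.+ 2F F.* (a F.* a) F.- (B F.* B F.+ a F.* a)
              ≡⟨ cong₂ (λ y z → v F.* v F.+ 2F F.* y F.- (z F.+ y)) h k ⟩
            v F.* v F.+ 2F F.* x F.- ((1F F.- x) F.+ x)
              ≡⟨ FP.solve 2 (λ v x → v FP.:* v FP.:+ FP.:2 FP.:* x FP.:- ((FP.:1 FP.:- x) FP.:+ x) FP.:= v FP.:* v FP.:+ FP.:2 FP.:* x FP.:- FP.:1) refl v x ⟩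
            c ∎
          -- As a² + b² = 1 and v = a + b, v² - 1 is 2ab, whose square is 4x(1 - x).
          s≡t : s v ≡ t
          s≡t = begin
            s v
              ≡⟨ FP.solve 2 (λ v x → (v FP.:* v FP.:- FP.:1) FP.:* (v FP.:* v FP.:- FP.:1) FP.:= (v FP.:* v FP.:- ((FP.:1 FP.:- x) FP.:+ x)) FP.:* (v FP.:* v FP.:- ((FP.:1 FP.:- x) FP.:+ x))) refl v x ⟩
            (v F.* v F.- ((1F F.- x) F.+ x)) F.* (v F.* v F.- ((1F F.- x) F.+ x))
              ≡⟨ cong₂ (λ y z → (v F.* v F.- (z F.+ y)) F.* (v F.* v F.- (z F.+ y))) h k ⟨
            (v F.* v F.- (B F.* B F.+ a F.* a)) F.* (v F.* v F.- (B F.* B F.+ a F.* a))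
              ≡⟨ FP.solve 2 (λ v a → let B = (FP.:- a) FP.:+ v in (v FP.:* v FP.:- (B FP.:* B FP.:+ a FP.:* a)) FP.:* (v FP.:* v FP.:- (B FP.:* B FP.:+ a FP.:* a)) FP.:= FP.:4 FP.:* (a FP.:* a) FP.:* (B FP.:* B)) refl v a ⟩
            4F F.* (a F.* a) F.* (B F.* B)
              ≡⟨ cong₂ (λ y z → 4F F.* y F.* z) h k ⟩
            t ∎
        from : s v ≡ t → α F.* α ≡ x × β v α F.* β v α ≡ 1F F.- x
        from h = α²≡x , (begin
          β v α F.* β v α
            ≡⟨ FP.solve 2 (λ v a → ((FP.:- a) FP.:+ v) FP.:* ((FP.:- a) FP.:+ v) FP.:= a FP.:* a FP.:- FP.:2 FP.:* v FP.:* a FP.:+ v FP.:* v) refl v α ⟩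
          α F.* α F.- d F.* α F.+ v F.* v
            ≡⟨ cong₂ (λ y z → y F.- z F.+ v F.* v) α²≡x dα≡c ⟩
          x F.- c F.+ v F.* v
            ≡⟨ FP.solve 2 (λ v x → x FP.:- (v FP.:* v FP.:+ FP.:2 FP.:* x FP.:- FP.:1) FP.:+ v FP.:* v FP.:= FP.:1 FP.:- x) refl v x ⟩
          1F F.- x ∎)
          where
          -- c² = (v² - 1)² + 4x(v² - 1 + x); putting t = 4x(1 - x) for the first square leaves 4v²x
          -- = d²x.
          α²≡x : α F.* α ≡ x
          α²≡x = FP.*-cancelˡ (FP.*-nonzero d≢0 d≢0) (begin
            (d F.* d) F.* (α F.* α)        ≡⟨ FP.solve 2 (λ d a → (d FP.:* d) FP.:* (a FP.:* a) FP.:= (d FP.:* a) FP.:* (d FP.:* a)) refl d α ⟩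
            (d F.* α) F.* (d F.* α)        ≡⟨ cong (λ z → z F.* z) dα≡c ⟩
            c F.* c
              ≡⟨ FP.solve 2 (λ v x → (v FP.:* v FP.:+ FP.:2 FP.:* x FP.:- FP.:1) FP.:* (v FP.:* v FP.:+ FP.:2 FP.:* x FP.:- FP.:1)
                   FP.:= (v FP.:* v FP.:- FP.:1) FP.:* (v FP.:* v FP.:- FP.:1) FP.:+ FP.:4 FP.:* x FP.:* (v FP.:* v FP.:- FP.:1 FP.:+ x)) refl v x ⟩
            s v F.+ 4F F.* x F.* (v F.* v F.- 1F F.+ x)
              ≡⟨ cong (F._+ 4F F.* x F.* (v F.* v F.- 1F F.+ x)) h ⟩
            t F.+ 4F F.* x F.* (v F.* v F.- 1F F.+ x)
              ≡⟨ FP.solve 2 (λ v x → FP.:4 FP.:* x FP.:* (FP.:1 FP.:- x) FP.:+ FP.:4 FP.:* x FP.:* (v FP.:* v FP.:- FP.:1 FP.:+ x)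
                   FP.:= ((FP.:2 FP.:* v) FP.:* (FP.:2 FP.:* v)) FP.:* x) refl v x ⟩
            (d F.* d) F.* x ∎)
        double : s v ≡ t → (1F F.+ v) F.* (1F F.+ v) ≡ 2F F.* ((1F F.+ α) F.* (1F F.+ β v α))
        double h = begin
          (1F F.+ v) F.* (1F F.+ v)
            ≡⟨ FP.solve 2 (λ v a → let B = (FP.:- a) FP.:+ v in (FP.:1 FP.:+ v) FP.:* (FP.:1 FP.:+ v) FP.:= FP.:2 FP.:* ((FP.:1 FP.:+ a) FP.:* (FP.:1 FP.:+ B)) FP.:+ (B FP.:* B FP.:+ a FP.:* a FP.:- FP.:1)) refl v α ⟩
          Y F.+ (β v α F.* β v α F.+ α F.* α F.- 1F)
            ≡⟨ cong₂ (λ y z → Y F.+ (z F.+ y F.- 1F)) (proj₁ (from h)) (proj₂ (from h)) ⟩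
          Y F.+ ((1F F.- x) F.+ x F.- 1F)
            ≡⟨ FP.solve 2 (λ Y x → Y FP.:+ ((FP.:1 FP.:- x) FP.:+ x FP.:- FP.:1) FP.:= Y) refl Y x ⟩
          Y ∎
          where Y = 2F F.* ((1F F.+ α) F.* (1F F.+ β v α))

      -- For 2x = 1 the degenerate pairs contribute (1 + φ(2)) A⁴(2), while v = 0 accounts for A⁴(2)
      -- once the common factor `E 2F` is taken out. The surplus φ(2) A⁴(2) becomes the delta term.
      defect : K.Carrier
      defect = φ₂ K.* C₂ K.* ⟦ (1F F.- 2F F.* x) F.≟ 0F ⟧

      half-inverse : 1F F.- 2F F.* x ≡ 0F → 2F F.* x ≡ 1F
      half-inverse h = sym (FP.x-y≡0⇒x≡y h)

      unit-value : 2F F.* x ≡ 1F → ∀ {u v} → u K.* v ≡ 1K → Root u → ch u x ≡ ch v 2F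
      unit-value 2x≡1 {u} {v} uv eu = KP.*-cancelˡ (ch-nonzero eu 2≢0)
        (trans (sym (ch-* eu 2F x)) (trans (cong (ch u) 2x≡1) (trans (ch-1 eu) (sym (ch-inv uv 2≢0)))))

      -- The degenerate pairs (a , -a) occur only for 2x = 1, where they
      -- number 1 + φ(2), whereas v = 0 is a single solution.
      zero-contribution : ⟦ s 0F F.≟ t ⟧ K.* weight 0F ≡ E 2F K.* (∑ (contribution 0F) K.- defect)
      zero-contribution with (1F F.- 2F F.* x) F.≟ 0F
      ... | no ≢ = begin
          ⟦ s 0F F.≟ t ⟧ K.* weight 0F            ≡⟨ ⟦⟧*-no (s 0F F.≟ t) s≢t _ ⟩
          0K                                      ≡⟨ KP.solve 2 (λ e c → KP.:0 KP.:= e KP.:* (KP.:0 KP.:- c KP.:* KP.:0)) refl (E 2F) (φ₂ K.* C₂) ⟩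
          E 2F K.* (0K K.- φ₂ K.* C₂ K.* 0K)      ≡⟨ cong (λ z → E 2F K.* (z K.- φ₂ K.* C₂ K.* 0K)) (trans (∑-cong vanish) ∑-0) ⟨
          E 2F K.* (∑ (contribution 0F) K.- φ₂ K.* C₂ K.* 0K) ∎
        where
        -- Here s 0 = 1, and 1 - t = (1 - 2x)².
        s≢t : ¬ s 0F ≡ t
        s≢t h with FP.*-zero-cases {1F F.- 2F F.* x} {1F F.- 2F F.* x} (trans
          (FP.solve 1 (λ x → (FP.:1 FP.:- FP.:2 FP.:* x) FP.:* (FP.:1 FP.:- FP.:2 FP.:* x) FP.:= (FP.:0 FP.:* FP.:0 FP.:- FP.:1) FP.:* (FP.:0 FP.:* FP.:0 FP.:- FP.:1) FP.:- FP.:4 FP.:* x FP.:* (FP.:1 FP.:- x)) refl x)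
          (FP.x≡y⇒x-y≡0 h))
        ... | inj₁ e = ≢ e
        ... | inj₂ e = ≢ e
        vanish : ∀ a → contribution 0F a ≡ 0K
        vanish a = trans (⟦⟧*-cong ((a F.* a) F.≟ x) (λ h → ⟦⟧*-no ((β 0F a F.* β 0F a) F.≟ (1F F.- x)) (λ k → ≢ (begin
            1F F.- 2F F.* x                                ≡⟨ FP.solve 1 (λ x → FP.:1 FP.:- FP.:2 FP.:* x FP.:= (FP.:1 FP.:- x) FP.:- x) refl x ⟩
            (1F F.- x) F.- x                               ≡⟨ cong₂ F._-_ (sym k) (sym h) ⟩
            β 0F a F.* β 0F a F.- a F.* a                  ≡⟨ FP.solve 1 (λ a → ((FP.:- a) FP.:+ FP.:0) FP.:* ((FP.:- a) FP.:+ FP.:0) FP.:- a FP.:* a FP.:= FP.:0) refl a ⟩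
            0F                                             ∎)) _)) (KP.zeroʳ _)
      ... | yes h = begin
          ⟦ s 0F F.≟ t ⟧ K.* weight 0F            ≡⟨ ⟦⟧*-yes (s 0F F.≟ t) s≡t _ ⟩
          E ((1F F.+ 0F) F.* (1F F.+ 0F))         ≡⟨ cong E (FP.solve 0 ((FP.:1 FP.:+ FP.:0) FP.:* (FP.:1 FP.:+ FP.:0) FP.:= FP.:1) refl) ⟩
          E 1F                                    ≡⟨ ch-1 b′²-root ⟩
          1K                                      ≡⟨ E2*C₂ ⟨
          E 2F K.* C₂                             ≡⟨ KP.solve 3 (λ e f c → e KP.:* c KP.:= e KP.:* (((KP.:1 KP.:+ f) KP.:* c) KP.:- f KP.:* c KP.:* KP.:1)) refl (E 2F) φ₂ C₂ ⟩
          E 2F K.* (((1K K.+ φ₂) K.* C₂) K.- φ₂ K.* C₂ K.* 1K)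
            ≡⟨ cong (λ z → E 2F K.* (z K.- φ₂ K.* C₂ K.* 1K)) (begin
              ∑ (contribution 0F)                                          ≡⟨ ∑-cong evaluate ⟩
              ∑ (λ a → (⟦ (a F.* a) F.≟ x ⟧ K.* 1K) K.* E x)               ≡⟨ ∑-*ʳ _ (E x) ⟩
              ∑ (λ a → ⟦ (a F.* a) F.≟ x ⟧ K.* 1K) K.* E x                 ≡⟨ cong (K._* E x) (square-count x) ⟩
              (1K K.+ φ x) K.* E x                                         ≡⟨ cong₂ (λ y z → (1K K.+ y) K.* z) φx≡φ₂ Ex≡C₂ ⟩
              (1K K.+ φ₂) K.* C₂                                           ∎) ⟨
          E 2F K.* (∑ (contribution 0F) K.- φ₂ K.* C₂ K.* 1K) ∎
        where
        2x≡1 = half-inverse h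
        1-x≡x : 1F F.- x ≡ x
        1-x≡x = trans (cong (F._- x) (sym 2x≡1)) (FP.solve 1 (λ x → FP.:2 FP.:* x FP.:- x FP.:= x) refl x)
        s≡t : s 0F ≡ t
        s≡t = begin
          s 0F                     ≡⟨ FP.solve 0 ((FP.:0 FP.:* FP.:0 FP.:- FP.:1) FP.:* (FP.:0 FP.:* FP.:0 FP.:- FP.:1) FP.:= FP.:1 FP.:* FP.:1) refl ⟩
          1F F.* 1F                ≡⟨ cong₂ F._*_ 2x≡1 2x≡1 ⟨
          (2F F.* x) F.* (2F F.* x) ≡⟨ FP.solve 1 (λ x → (FP.:2 FP.:* x) FP.:* (FP.:2 FP.:* x) FP.:= FP.:4 FP.:* x FP.:* x) refl x ⟩
          4F F.* x F.* x           ≡⟨ cong (λ z → 4F F.* x F.* z) 1-x≡x ⟨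
          t                        ∎
        φx≡φ₂ : φ x ≡ φ₂
        φx≡φ₂ = trans (φ≐ch x) (unit-value 2x≡1 -1*-1 root--1)
        Ex≡C₂ : E x ≡ C₂
        Ex≡C₂ = unit-value 2x≡1 (trans (KP.*-comm _ _) b²b′²) b′²-root
        evaluate : ∀ a → contribution 0F a ≡ (⟦ (a F.* a) F.≟ x ⟧ K.* 1K) K.* E x
        evaluate a = trans (⟦⟧*-cong ((a F.* a) F.≟ x) (λ k → trans
            (⟦⟧*-yes ((β 0F a F.* β 0F a) F.≟ (1F F.- x)) (trans (FP.solve 1 (λ a → ((FP.:- a) FP.:+ FP.:0) FP.:* ((FP.:- a) FP.:+ FP.:0) FP.:= a FP.:* a) refl a) (trans k (sym 1-x≡x))) _)
            (cong E (begin
              (1F F.+ a) F.* (1F F.+ β 0F a)   ≡⟨ FP.solve 1 (λ a → (FP.:1 FP.:+ a) FP.:* (FP.:1 FP.:+ ((FP.:- a) FP.:+ FP.:0)) FP.:= FP.:1 FP.:- a FP.:* a) refl a ⟩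
              1F F.- a F.* a                   ≡⟨ cong (1F F.+_) (cong (λ z → F.- z) k) ⟩
              1F F.- x                         ≡⟨ 1-x≡x ⟩
              x                                ∎))))
          (cong (K._* E x) (sym (KP.*-identityʳ _)))

      solution-sum : ∑ (λ v → ⟦ s v F.≟ t ⟧ K.* weight v) ≡ E 2F K.* (root-sum x K.* root-sum (1F F.- x) K.- defect)
      solution-sum = begin
        ∑ (λ v → ⟦ s v F.≟ t ⟧ K.* weight v)                              ≡⟨ ∑-cong each ⟩
        ∑ (λ v → E 2F K.* (∑ (contribution v) K.- ⟦ v F.≟ 0F ⟧ K.* defect)) ≡⟨ ∑-*ˡ (E 2F) _ ⟩
        E 2F K.* ∑ (λ v → ∑ (contribution v) K.- ⟦ v F.≟ 0F ⟧ K.* defect)  ≡⟨ cong (E 2F K.*_) (trans (∑-− _ _) (cong₂ K._-_ (sym root-sums-product) (∑-pick 0F (λ _ → defect)))) ⟩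
        E 2F K.* (root-sum x K.* root-sum (1F F.- x) K.- defect)           ∎
        where
        each : ∀ v → ⟦ s v F.≟ t ⟧ K.* weight v ≡ E 2F K.* (∑ (contribution v) K.- ⟦ v F.≟ 0F ⟧ K.* defect)
        each v = decide (v F.≟ 0F)
          where
          decide : Dec (v ≡ 0F) → ⟦ s v F.≟ t ⟧ K.* weight v ≡ E 2F K.* (∑ (contribution v) K.- ⟦ v F.≟ 0F ⟧ K.* defect)
          decide (yes refl) = trans zero-contribution (cong (λ z → E 2F K.* (∑ (contribution 0F) K.- z)) (sym (⟦⟧*-yes (0F F.≟ 0F) refl defect)))
          decide (no v≢0) = trans (nonzero-contribution v≢0) (cong (E 2F K.*_)
            (trans (KP.solve 1 (λ z → z KP.:= z KP.:- KP.:0) refl (∑ (contribution v)))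
              (cong (λ z → ∑ (contribution v) K.- z) (sym (⟦⟧*-no (v F.≟ 0F) v≢0 defect)))))

    -- The closed formula and its two specialisations

    A⁻⁴φ₂-value : A⁻⁴φ₂ ≡ E 2F K.* φ₂
    A⁻⁴φ₂-value = cong₂ K._*_ (A4b≐ 2F) (φ≐ch 2F)

    qN≢0 : ¬ qK K.* N ≡ 0K
    qN≢0 = KP.*-nonzero qK≢0 N≢0

    -- From g(φ)² = q. It reconciles the constant g(φ)/(qN) that the computation produces with the
    -- 1/(g(φ)N) of the claims.
    [gN]⁻¹ : (gauss φ K.* N) K.⁻¹ ≡ gφ K.* (qK K.* N) K.⁻¹
    [gN]⁻¹ = KP.⁻¹-unique (begin
      (gauss φ K.* N) K.* (gφ K.* (qK K.* N) K.⁻¹)   ≡⟨ cong (λ z → (z K.* N) K.* (gφ K.* (qK K.* N) K.⁻¹)) gaussφ≡gφ ⟩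
      (gφ K.* N) K.* (gφ K.* (qK K.* N) K.⁻¹)        ≡⟨ KP.solve 3 (λ g N i → (g KP.:* N) KP.:* (g KP.:* i) KP.:= ((g KP.:* g) KP.:* N) KP.:* i) refl gφ N _ ⟩
      ((gφ K.* gφ) K.* N) K.* (qK K.* N) K.⁻¹        ≡⟨ cong (λ z → (z K.* N) K.* (qK K.* N) K.⁻¹) gφ² ⟩
      (qK K.* N) K.* (qK K.* N) K.⁻¹                 ≡⟨ K.inverse _ qN≢0 ⟩
      1K                                             ∎)

    -- Common source of both claims. Square roots are summed over, not chosen, and the coefficient
    -- of the indicator is written as a constant, as it takes one value on the support 2x = 1.
    product-formula : ∀ {x} → ¬ x ≡ 0F → ¬ x ≡ 1F → Fn (t x)
      ≡ A⁻⁴φ₂ K.* (gauss φ K.* N) K.⁻¹ K.* (root-sum x K.* root-sum (1F F.- x))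
        K.- ⟦ (1F F.- 2F F.* x) F.≟ 0F ⟧ K.* ((A⁻⁴φ₂ K.* gauss φ) K.* (φ₂ K.* C₂) K.* (qK K.* N) K.⁻¹)
    product-formula {x} x≢0 x≢1 = KP.*-cancelˡ qN≢0 (begin
      (qK K.* N) K.* Fn (t x)                                       ≡⟨ series-value t≢0 ⟩
      (φ₂ K.* gφ) K.* ∑ (λ v → ⟦ s v F.≟ t x ⟧ K.* weight v)        ≡⟨ cong ((φ₂ K.* gφ) K.*_) (solution-sum x) ⟩
      (φ₂ K.* gφ) K.* (E 2F K.* (P K.- φ₂ K.* C₂ K.* δ₀))           ≡⟨ *-1ʳ _ (K.inverse _ qN≢0) ⟨
      ((φ₂ K.* gφ) K.* (E 2F K.* (P K.- φ₂ K.* C₂ K.* δ₀))) K.* ((qK K.* N) K.* (qK K.* N) K.⁻¹)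
        ≡⟨ KP.solve 8 (λ f g e P C d q i → ((f KP.:* g) KP.:* (e KP.:* (P KP.:- f KP.:* C KP.:* d))) KP.:* (q KP.:* i)
             KP.:= q KP.:* ((e KP.:* f) KP.:* (g KP.:* i) KP.:* P KP.:- d KP.:* (((e KP.:* f) KP.:* g) KP.:* (f KP.:* C) KP.:* i))) refl φ₂ gφ (E 2F) P C₂ δ₀ (qK K.* N) ((qK K.* N) K.⁻¹) ⟩
      (qK K.* N) K.* ((E 2F K.* φ₂) K.* (gφ K.* (qK K.* N) K.⁻¹) K.* P K.- δ₀ K.* (((E 2F K.* φ₂) K.* gφ) K.* (φ₂ K.* C₂) K.* (qK K.* N) K.⁻¹))
        ≡⟨ cong₂ (λ y z → (qK K.* N) K.* (y K.* z K.* P K.- δ₀ K.* ((y K.* gφ) K.* (φ₂ K.* C₂) K.* (qK K.* N) K.⁻¹))) A⁻⁴φ₂-value [gN]⁻¹ ⟨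
      (qK K.* N) K.* (A⁻⁴φ₂ K.* (gauss φ K.* N) K.⁻¹ K.* P K.- δ₀ K.* ((A⁻⁴φ₂ K.* gφ) K.* (φ₂ K.* C₂) K.* (qK K.* N) K.⁻¹))
        ≡⟨ cong (λ y → (qK K.* N) K.* (A⁻⁴φ₂ K.* (gauss φ K.* N) K.⁻¹ K.* P K.- δ₀ K.* ((A⁻⁴φ₂ K.* y) K.* (φ₂ K.* C₂) K.* (qK K.* N) K.⁻¹))) gaussφ≡gφ ⟨
      (qK K.* N) K.* (A⁻⁴φ₂ K.* (gauss φ K.* N) K.⁻¹ K.* P K.- δ₀ K.* ((A⁻⁴φ₂ K.* gauss φ) K.* (φ₂ K.* C₂) K.* (qK K.* N) K.⁻¹)) ∎)
      where
      P = root-sum x K.* root-sum (1F F.- x)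
      δ₀ = ⟦ (1F F.- 2F F.* x) F.≟ 0F ⟧
      t≢0 : ¬ t x ≡ 0F
      t≢0 = FP.*-nonzero (FP.*-nonzero 4≢0 x≢0) (λ h → x≢1 (sym (FP.x-y≡0⇒x≡y h)))

    2K⁻¹ : K.Carrier
    2K⁻¹ = (2 K.×1) K.⁻¹

    2K≢0 : ¬ 2 K.×1 ≡ 0K
    2K≢0 h with K-char0 2 h
    ... | ()

    -- σ has to be a root only if e has one. So σ may be `sqrt`, with its default value at
    -- nonsquares, or the inverse of such a root; when e is no square, 1 + φ(e) = 0 and the sum over
    -- roots is empty.
    half-T : ∀ {e} σ → ¬ e ≡ 0F → (∀ s → s F.* s ≡ e → σ F.* σ ≡ e) → half e K.* T σ ≡ root-sum e
    half-T {e} σ e≢0 σ-root with square? e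
    ... | inj₁ (s , h) = begin
        ((1K K.+ φ e) K.* 2K⁻¹) K.* T σ          ≡⟨ cong (λ z → ((1K K.+ z) K.* 2K⁻¹) K.* T σ) (φ-square e≢0 h) ⟩
        ((1K K.+ 1K) K.* 2K⁻¹) K.* T σ           ≡⟨ cong (λ z → (z K.* 2K⁻¹) K.* T σ) (KP.solve 0 (KP.:1 KP.:+ KP.:1 KP.:= KP.:2) refl) ⟩
        (2 K.×1 K.* 2K⁻¹) K.* T σ                ≡⟨ trans (cong (K._* T σ) (K.inverse _ 2K≢0)) (KP.*-identityˡ _) ⟩
        T σ                                      ≡⟨ cong₂ K._+_ (A4b≐ _) (A4b≐ _) ⟩
        E (1F F.+ σ) K.+ E (1F F.- σ)            ≡⟨ ∑-over-roots (σ-root s h) e≢0 (λ y → E (1F F.+ y)) ⟨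
        root-sum e                               ∎
    ... | inj₂ ns = begin
        ((1K K.+ φ e) K.* 2K⁻¹) K.* T σ          ≡⟨ cong (λ z → ((1K K.+ z) K.* 2K⁻¹) K.* T σ) (φ-nonsquare ns) ⟩
        ((1K K.+ -1K) K.* 2K⁻¹) K.* T σ          ≡⟨ KP.solve 2 (λ i T → ((KP.:1 KP.:+ (KP.:- KP.:1)) KP.:* i) KP.:* T KP.:= KP.:0) refl 2K⁻¹ (T σ) ⟩
        0K                                       ≡⟨ ∑-over-no-roots ns (λ y → E (1F F.+ y)) ⟨
        root-sum e                               ∎

    δ≡⟦⟧ : ∀ y → δ y ≡ ⟦ y F.≟ 0F ⟧
    δ≡⟦⟧ y with y F.≟ 0F
    ... | yes _ = refl
    ... | no  _ = refl

    -- The coefficients in the claims depend on x, the one in `product-formula` does not; they have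
    -- to agree only where the delta is nonzero.
    *δ-cong : ∀ {P : Set} {u v} z (d : Dec P) → (z ≡ 0F → P) → (P → z ≡ 0F) → (P → u ≡ v) → u K.* δ z ≡ ⟦ d ⟧ K.* v
    *δ-cong {u = u} {v} z d to from e = begin
      u K.* δ z               ≡⟨ KP.*-comm u _ ⟩
      δ z K.* u               ≡⟨ cong (K._* u) (trans (δ≡⟦⟧ z) (⟦⟧-cong (z F.≟ 0F) d to from)) ⟩
      ⟦ d ⟧ K.* u             ≡⟨ ⟦⟧*-cong d e ⟩
      ⟦ d ⟧ K.* v             ∎

    ch-even-neg : ∀ {w} → Root w → ∀ y → ch (w K.* w) (F.- y) ≡ ch (w K.* w) y
    ch-even-neg {w} ew y = trans (cong (ch (w K.* w)) (FP.solve 1 (λ y → FP.:- y FP.:= (FP.:- FP.:1) FP.:* y) refl y))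
      (trans (ch-* (root-* ew ew) -1F y) (trans (cong (K._* ch (w K.* w) y) (ch-square-neg1 ew)) (KP.*-identityˡ _)))

    φ-neg : ∀ y → φ (F.- y) ≡ φ y
    φ-neg y = trans (φ≐ch (F.- y)) (trans (trans (cong (ch -1K) (FP.solve 1 (λ y → FP.:- y FP.:= (FP.:- FP.:1) FP.:* y) refl y))
      (trans (ch-* root--1 -1F y) (trans (cong (K._* ch -1K y) ch--1-neg1) (KP.*-identityˡ _)))) (sym (φ≐ch y)))

    module _ {x : F.Carrier} (x≢0 : ¬ x ≡ 0F) (x≢1 : ¬ x ≡ 1F) where

      private
        1-x≢0 : ¬ 1F F.- x ≡ 0F
        1-x≢0 h = x≢1 (sym (FP.x-y≡0⇒x≡y h))

        x-1≢0 : ¬ x F.- 1F ≡ 0F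
        x-1≢0 h = x≢1 (FP.x-y≡0⇒x≡y h)

        [1-x]²≢0 : ¬ (1F F.- x) F.^ 2 ≡ 0F
        [1-x]²≢0 = FP.^-nonzero 2 1-x≢0

      claim-i-holds : claim-i x
      claim-i-holds = trans (product-formula x≢0 x≢1) (cong₂ K._-_ main delta)
        where
        κ = A⁻⁴φ₂ K.* (gauss φ K.* N) K.⁻¹
        main : κ K.* (root-sum x K.* root-sum (1F F.- x))
          ≡ κ K.* half (1F F.- x) K.* half x K.* T (sqrt (1F F.- x)) K.* T (sqrt x)
        main = begin
          κ K.* (root-sum x K.* root-sum (1F F.- x))
            ≡⟨ cong₂ (λ y z → κ K.* (y K.* z)) (half-T (sqrt x) x≢0 (λ s → sqrt-spec)) (half-T (sqrt (1F F.- x)) 1-x≢0 (λ s → sqrt-spec)) ⟨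
          κ K.* ((half x K.* T (sqrt x)) K.* (half (1F F.- x) K.* T (sqrt (1F F.- x))))
            ≡⟨ KP.solve 5 (λ k h T h′ T′ → k KP.:* ((h KP.:* T) KP.:* (h′ KP.:* T′)) KP.:= k KP.:* h′ KP.:* h KP.:* T′ KP.:* T) refl κ (half x) (T (sqrt x)) (half (1F F.- x)) (T (sqrt (1F F.- x))) ⟩
          κ K.* half (1F F.- x) K.* half x K.* T (sqrt (1F F.- x)) K.* T (sqrt x) ∎
        -- At 2x = 1 one has x - 1 = -x, and A⁻⁶ is even as the square of A⁻³. So A²(x) A⁻⁶(x - 1)
        -- is A⁻⁴(1/2) = A⁴(2).
        coefficient : 1F F.- 2F F.* x ≡ 0F → (A2 ⊗ φ) x K.* A⁻⁴φ₂ K.* A6b (x F.- 1F) K.* gauss φ ≡ (A⁻⁴φ₂ K.* gauss φ) K.* (φ₂ K.* C₂)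
        coefficient h = begin
          A2 x K.* φ x K.* A⁻⁴φ₂ K.* A6b (x F.- 1F) K.* gauss φ
            ≡⟨ cong₂ (λ y z → y K.* φ x K.* A⁻⁴φ₂ K.* z K.* gauss φ) (A2≐ x) (trans (A6b≐ (x F.- 1F)) (trans (cong (ch (c′ K.* c′)) x-1≡-x) (ch-even-neg c′-root x))) ⟩
          ch b x K.* φ x K.* A⁻⁴φ₂ K.* ch (c′ K.* c′) x K.* gauss φ
            ≡⟨ KP.solve 5 (λ y f c z g → y KP.:* f KP.:* c KP.:* z KP.:* g KP.:= (c KP.:* g) KP.:* (f KP.:* (y KP.:* z))) refl (ch b x) (φ x) A⁻⁴φ₂ (ch (c′ K.* c′) x) (gauss φ) ⟩
          (A⁻⁴φ₂ K.* gauss φ) K.* (φ x K.* (ch b x K.* ch (c′ K.* c′) x))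
            ≡⟨ cong₂ (λ y z → (A⁻⁴φ₂ K.* gauss φ) K.* (y K.* z)) (trans (φ≐ch x) (at-half -1*-1 root--1))
                 (trans (sym (ch-⊗ b (c′ K.* c′) x)) (trans (cong (λ w → ch w x) b*c′²) (at-half (trans (KP.*-comm _ _) b²b′²) b′²-root))) ⟩
          (A⁻⁴φ₂ K.* gauss φ) K.* (φ₂ K.* C₂) ∎
          where
          2x≡1 : 2F F.* x ≡ 1F
          2x≡1 = half-inverse x h
          x-1≡-x : x F.- 1F ≡ F.- x
          x-1≡-x = trans (cong (λ z → x F.- z) (sym 2x≡1)) (FP.solve 1 (λ x → x FP.:- FP.:2 FP.:* x FP.:= FP.:- x) refl x)
          at-half : ∀ {u v} → u K.* v ≡ 1K → Root u → ch u x ≡ ch v 2F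
          at-half = unit-value x 2x≡1
          a′ c′ : K.Carrier
          a′ = a K.⁻¹
          c′ = a′ K.* (a′ K.* a′)
          a′-root : Root a′
          a′-root = root-inv (inverse-root a-root) a-root
          c′-root : Root c′
          c′-root = root-* a′-root (root-* a′-root a′-root)
          aa′ = inverse-root a-root
          a⁶-root : Root (a K.^ 6)
          a⁶-root = trans (sym (KP.^-* a 6 n)) (trans (cong (a K.^_) (ℕₚ.*-comm 6 n)) (trans (KP.^-* a n 6) (trans (cong (K._^ 6) a-root) (KP.1^ 6))))
          A6b≐ : A6b ≐ ch (c′ K.* c′)
          A6b≐ = bar≐ch (pow≐ch A≐ 6) (trans
            (KP.solve 2 (λ a d → (a KP.:* (a KP.:* (a KP.:* (a KP.:* (a KP.:* (a KP.:* KP.:1)))))) KP.:* ((d KP.:* (d KP.:* d)) KP.:* (d KP.:* (d KP.:* d)))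
              KP.:= ((a KP.:* d) KP.:* ((a KP.:* d) KP.:* (a KP.:* d))) KP.:* ((a KP.:* d) KP.:* ((a KP.:* d) KP.:* (a KP.:* d)))) refl a a′)
            (*-1-1 (*-1-1 aa′ (*-1-1 aa′ aa′)) (*-1-1 aa′ (*-1-1 aa′ aa′)))) a⁶-root
          b*c′² : b K.* (c′ K.* c′) ≡ b′ K.* b′
          b*c′² = trans (KP.solve 2 (λ a d → (a KP.:* a) KP.:* ((d KP.:* (d KP.:* d)) KP.:* (d KP.:* (d KP.:* d))) KP.:= ((d KP.:* d) KP.:* (d KP.:* d)) KP.:* ((a KP.:* d) KP.:* (a KP.:* d))) refl a a′)
            (*-1ʳ _ (*-1-1 aa′ aa′))
        z = (1F F.- 2F F.* x) F.* ((1F F.- x) F.^ 2) F.⁻¹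
        delta : ⟦ (1F F.- 2F F.* x) F.≟ 0F ⟧ K.* ((A⁻⁴φ₂ K.* gauss φ) K.* (φ₂ K.* C₂) K.* (qK K.* N) K.⁻¹)
          ≡ (((A2 ⊗ φ) x K.* A⁻⁴φ₂ K.* A6b (x F.- 1F) K.* gauss φ) K.* (qK K.* N) K.⁻¹) K.* δ z
        delta = sym (*δ-cong z ((1F F.- 2F F.* x) F.≟ 0F) to (λ h → trans (cong (F._* ((1F F.- x) F.^ 2) F.⁻¹) h) (FP.zeroˡ _)) (λ h → cong (K._* (qK K.* N) K.⁻¹) (coefficient h)))
          where
          to : z ≡ 0F → 1F F.- 2F F.* x ≡ 0F
          to h with FP.*-zero-cases h
          ... | inj₁ h′ = h′
          ... | inj₂ h′ = contradiction h′ (FP.⁻¹-nonzero [1-x]²≢0)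

      -- Part (i) at X = 1 / (1 - x), where 4X(1 - X) = -4x / (1 - x)².
      claim-ii-holds : claim-ii x
      claim-ii-holds = trans (cong Fn (sym t-X)) (trans (product-formula X≢0 X≢1) (cong₂ K._-_ main delta))
        where
        X : F.Carrier
        X = (1F F.- x) F.⁻¹
        X≢0 : ¬ X ≡ 0F
        X≢0 = FP.⁻¹-nonzero 1-x≢0
        uX : (1F F.- x) F.* X ≡ 1F
        uX = F.inverse _ 1-x≢0
        1-X≡-xX : 1F F.- X ≡ (F.- x) F.* X
        1-X≡-xX = trans (cong (F._- X) (sym uX)) (FP.solve 2 (λ x X → (FP.:1 FP.:- x) FP.:* X FP.:- X FP.:= (FP.:- x) FP.:* X) refl x X)
        1-X≢0 : ¬ 1F F.- X ≡ 0F
        1-X≢0 h = FP.*-nonzero (FP.neg-nonzero x≢0) X≢0 (trans (sym 1-X≡-xX) h)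
        X≢1 : ¬ X ≡ 1F
        X≢1 h = 1-X≢0 (trans (cong (λ z → 1F F.- z) h) (FP.-‿inverseʳ 1F))
        t-X : t X ≡ (F.- (4F F.* x)) F.* ((1F F.- x) F.^ 2) F.⁻¹
        t-X = begin
          4F F.* X F.* (1F F.- X)                       ≡⟨ cong (4F F.* X F.*_) 1-X≡-xX ⟩
          4F F.* X F.* ((F.- x) F.* X)                  ≡⟨ FP.solve 2 (λ x X → FP.:4 FP.:* X FP.:* ((FP.:- x) FP.:* X) FP.:= (FP.:- (FP.:4 FP.:* x)) FP.:* (X FP.:* X)) refl x X ⟩
          (F.- (4F F.* x)) F.* (X F.* X)                ≡⟨ cong ((F.- (4F F.* x)) F.*_) (FP.⁻¹-unique (begin
            (1F F.- x) F.^ 2 F.* (X F.* X)                ≡⟨ FP.solve 2 (λ u X → (u FP.:* (u FP.:* FP.:1)) FP.:* (X FP.:* X) FP.:= (u FP.:* X) FP.:* (u FP.:* X)) refl (1F F.- x) X ⟩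
            ((1F F.- x) F.* X) F.* ((1F F.- x) F.* X)     ≡⟨ cong₂ F._*_ uX uX ⟩
            1F F.* 1F                                     ≡⟨ FP.*-identityˡ 1F ⟩
            1F                                            ∎)) ⟨
          (F.- (4F F.* x)) F.* ((1F F.- x) F.^ 2) F.⁻¹  ∎
        Y : F.Carrier
        Y = x F.* (x F.- 1F) F.⁻¹
        1-X≡Y : 1F F.- X ≡ Y
        1-X≡Y = trans 1-X≡-xX (trans (FP.solve 2 (λ x X → (FP.:- x) FP.:* X FP.:= x FP.:* (FP.:- X)) refl x X)
          (cong (x F.*_) (sym (FP.⁻¹-unique (trans (FP.solve 2 (λ x X → (x FP.:- FP.:1) FP.:* (FP.:- X) FP.:= (FP.:1 FP.:- x) FP.:* X) refl x X) uX)))))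
        φ-⁻¹ : ∀ {y} → ¬ y ≡ 0F → φ (y F.⁻¹) ≡ φ y
        φ-⁻¹ y≢0 = trans (φ≐ch _) (trans (ch-⁻¹-inv -1*-1 root--1 y≢0) (sym (φ≐ch _)))
        φX : φ X ≡ φ (1F F.- x)
        φX = φ-⁻¹ 1-x≢0
        -- The quotient x/(x - 1) and the product x(x - 1) differ by a square.
        φY : φ (1F F.- X) ≡ φ (x F.^ 2 F.- x)
        φY = begin
          φ (1F F.- X)                              ≡⟨ cong φ 1-X≡Y ⟩
          φ Y                                       ≡⟨ φ-* x _ ⟩
          φ x K.* φ ((x F.- 1F) F.⁻¹)               ≡⟨ cong (φ x K.*_) (φ-⁻¹ x-1≢0) ⟩
          φ x K.* φ (x F.- 1F)                      ≡⟨ φ-* x _ ⟨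
          φ (x F.* (x F.- 1F))                      ≡⟨ cong φ (FP.solve 1 (λ x → x FP.:* (x FP.:- FP.:1) FP.:= x FP.:* (x FP.:* FP.:1) FP.:- x) refl x) ⟩
          φ (x F.^ 2 F.- x)                         ∎
          where
          φ-* : ∀ y z → φ (y F.* z) ≡ φ y K.* φ z
          φ-* y z = trans (φ≐ch _) (trans (ch-* root--1 y z) (sym (cong₂ K._*_ (φ≐ch y) (φ≐ch z))))
        σ : F.Carrier
        σ = (sqrt (1F F.- x)) F.⁻¹
        σ-root : ∀ s → s F.* s ≡ X → σ F.* σ ≡ X
        σ-root s h = sym (FP.⁻¹-unique (begin
          (1F F.- x) F.* (σ F.* σ)            ≡⟨ cong (F._* (σ F.* σ)) ρ² ⟨
          (ρ F.* ρ) F.* (σ F.* σ)             ≡⟨ FP.solve 2 (λ r s → (r FP.:* r) FP.:* (s FP.:* s) FP.:= (r FP.:* s) FP.:* (r FP.:* s)) refl ρ σ ⟩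
          (ρ F.* σ) F.* (ρ F.* σ)             ≡⟨ cong (λ z → z F.* z) (F.inverse ρ (root-of-nonzero 1-x≢0 ρ²)) ⟩
          1F F.* 1F                           ≡⟨ FP.*-identityˡ 1F ⟩
          1F                                  ∎))
          where
          ρ = sqrt (1F F.- x)
          ρ² : ρ F.* ρ ≡ 1F F.- x
          -- A root s of 1/(1 - x) gives the root (1 - x) s of 1 - x, so `sqrt` does not fall back
          -- on its default.
          ρ² = sqrt-spec {s = (1F F.- x) F.* s} (begin
            (1F F.- x) F.* s F.* ((1F F.- x) F.* s)   ≡⟨ FP.solve 2 (λ u s → u FP.:* s FP.:* (u FP.:* s) FP.:= u FP.:* (u FP.:* (s FP.:* s))) refl (1F F.- x) s ⟩
            (1F F.- x) F.* ((1F F.- x) F.* (s F.* s)) ≡⟨ cong (λ z → (1F F.- x) F.* ((1F F.- x) F.* z)) h ⟩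
            (1F F.- x) F.* ((1F F.- x) F.* X)         ≡⟨ trans (cong ((1F F.- x) F.*_) uX) (FP.*-identityʳ _) ⟩
            1F F.- x                                  ∎)
        τ-root : ∀ s → s F.* s ≡ 1F F.- X → sqrt Y F.* sqrt Y ≡ 1F F.- X
        τ-root s h = trans (sqrt-spec (trans h 1-X≡Y)) (sym 1-X≡Y)
        κ = A⁻⁴φ₂ K.* (gauss φ K.* N) K.⁻¹
        4K⁻¹≡ : (4 K.×1) K.⁻¹ ≡ 2K⁻¹ K.* 2K⁻¹
        4K⁻¹≡ = KP.⁻¹-unique (trans (KP.solve 1 (λ i → KP.:4 KP.:* (i KP.:* i) KP.:= (KP.:2 KP.:* i) KP.:* (KP.:2 KP.:* i)) refl 2K⁻¹)
          (*-1-1 (K.inverse _ 2K≢0) (K.inverse _ 2K≢0)))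
        main : κ K.* (root-sum X K.* root-sum (1F F.- X))
          ≡ κ K.* ((1K K.+ φ (1F F.- x)) K.* (1K K.+ φ (x F.^ 2 F.- x)) K.* (4 K.×1) K.⁻¹) K.* T σ K.* T (sqrt Y)
        main = begin
          κ K.* (root-sum X K.* root-sum (1F F.- X))
            ≡⟨ cong₂ (λ y z → κ K.* (y K.* z)) (half-T σ X≢0 σ-root) (half-T (sqrt Y) 1-X≢0 τ-root) ⟨
          κ K.* ((half X K.* T σ) K.* (half (1F F.- X) K.* T (sqrt Y)))
            ≡⟨ cong₂ (λ y z → κ K.* ((((1K K.+ y) K.* 2K⁻¹) K.* T σ) K.* (((1K K.+ z) K.* 2K⁻¹) K.* T (sqrt Y)))) φX φY ⟩
          κ K.* ((((1K K.+ φ (1F F.- x)) K.* 2K⁻¹) K.* T σ) K.* (((1K K.+ φ (x F.^ 2 F.- x)) K.* 2K⁻¹) K.* T (sqrt Y)))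
            ≡⟨ KP.solve 6 (λ k f h i T T′ → k KP.:* (((f KP.:* i) KP.:* T) KP.:* ((h KP.:* i) KP.:* T′)) KP.:= k KP.:* (f KP.:* h KP.:* (i KP.:* i)) KP.:* T KP.:* T′) refl κ (1K K.+ φ (1F F.- x)) (1K K.+ φ (x F.^ 2 F.- x)) 2K⁻¹ (T σ) (T (sqrt Y)) ⟩
          κ K.* ((1K K.+ φ (1F F.- x)) K.* (1K K.+ φ (x F.^ 2 F.- x)) K.* (2K⁻¹ K.* 2K⁻¹)) K.* T σ K.* T (sqrt Y)
            ≡⟨ cong (λ z → κ K.* ((1K K.+ φ (1F F.- x)) K.* (1K K.+ φ (x F.^ 2 F.- x)) K.* z) K.* T σ K.* T (sqrt Y)) 4K⁻¹≡ ⟨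
          κ K.* ((1K K.+ φ (1F F.- x)) K.* (1K K.+ φ (x F.^ 2 F.- x)) K.* (4 K.×1) K.⁻¹) K.* T σ K.* T (sqrt Y) ∎
        z = 1F F.- x F.^ 2
        -- Of the two roots of x² = 1 the hypothesis x ≠ 1 leaves -1, where X = 1/2; the delta of
        -- this part thus matches 2X = 1.
        z≡0⇒x≡-1 : z ≡ 0F → x ≡ -1F
        z≡0⇒x≡-1 h with FP.square≡1 {x} (trans (FP.solve 1 (λ x → x FP.:* x FP.:= x FP.:* (x FP.:* FP.:1)) refl x) (sym (FP.x-y≡0⇒x≡y h)))
        ... | inj₁ e = contradiction e x≢1
        ... | inj₂ e = e
        1-2X≡-[1+x]X : 1F F.- 2F F.* X ≡ (F.- (1F F.+ x)) F.* X
        1-2X≡-[1+x]X = trans (cong (F._- 2F F.* X) (sym uX)) (FP.solve 2 (λ x X → (FP.:1 FP.:- x) FP.:* X FP.:- FP.:2 FP.:* X FP.:= (FP.:- (FP.:1 FP.:+ x)) FP.:* X) refl x X)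
        to : z ≡ 0F → 1F F.- 2F F.* X ≡ 0F
        to h = trans 1-2X≡-[1+x]X (trans (cong (λ y → (F.- (1F F.+ y)) F.* X) (z≡0⇒x≡-1 h))
          (FP.solve 1 (λ X → (FP.:- (FP.:1 FP.:+ (FP.:- FP.:1))) FP.:* X FP.:= FP.:0) refl X))
        x≡-1 : 1F F.- 2F F.* X ≡ 0F → x ≡ -1F
        x≡-1 h with FP.*-zero-cases (trans (sym 1-2X≡-[1+x]X) h)
        ... | inj₂ e = contradiction e X≢0
        ... | inj₁ e = trans (FP.solve 1 (λ x → x FP.:= (FP.:- FP.:1) FP.:- (FP.:- (FP.:1 FP.:+ x))) refl x)
          (trans (cong (λ y → -1F F.- y) e) (FP.solve 0 ((FP.:- FP.:1) FP.:- FP.:0 FP.:= FP.:- FP.:1) refl))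
        from : 1F F.- 2F F.* X ≡ 0F → z ≡ 0F
        from h = trans (cong (λ y → 1F F.- y F.^ 2) (x≡-1 h)) (FP.solve 0 (FP.:1 FP.:- (FP.:- FP.:1) FP.:* ((FP.:- FP.:1) FP.:* FP.:1) FP.:= FP.:0) refl)
        -- At x = -1 the factor (A²φ)(-1) is 1, and x - 1 = -2 contributes A⁴(2) φ(2), both
        -- characters being even.
        coefficient : 1F F.- 2F F.* X ≡ 0F → (A2 ⊗ φ) x K.* A⁻⁴φ₂ K.* (A4 ⊗ φ) (x F.- 1F) K.* gauss φ ≡ (A⁻⁴φ₂ K.* gauss φ) K.* (φ₂ K.* C₂)
        coefficient h = begin
          (A2 ⊗ φ) x K.* A⁻⁴φ₂ K.* (A4 ⊗ φ) (x F.- 1F) K.* gauss φ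
            ≡⟨ cong (λ y → (A2 ⊗ φ) y K.* A⁻⁴φ₂ K.* (A4 ⊗ φ) (y F.- 1F) K.* gauss φ) (x≡-1 h) ⟩
          (A2 -1F K.* φ -1F) K.* A⁻⁴φ₂ K.* (A4 (-1F F.- 1F) K.* φ (-1F F.- 1F)) K.* gauss φ
            ≡⟨ cong₂ (λ y z → y K.* A⁻⁴φ₂ K.* z K.* gauss φ)
                 (*-1-1 (trans (A2≐ -1F) (ch-square-neg1 a-root)) (trans (φ≐ch -1F) ch--1-neg1))
                 (cong₂ K._*_ (trans (A4≐ _) (trans (cong (ch (b K.* b)) -2≡) (ch-even-neg b-root 2F))) (trans (cong φ -2≡) (trans (φ-neg 2F) (φ≐ch 2F)))) ⟩
          1K K.* A⁻⁴φ₂ K.* (C₂ K.* φ₂) K.* gauss φ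
            ≡⟨ KP.solve 4 (λ c C f g → KP.:1 KP.:* c KP.:* (C KP.:* f) KP.:* g KP.:= (c KP.:* g) KP.:* (f KP.:* C)) refl A⁻⁴φ₂ C₂ φ₂ (gauss φ) ⟩
          (A⁻⁴φ₂ K.* gauss φ) K.* (φ₂ K.* C₂) ∎
          where
          -2≡ : -1F F.- 1F ≡ F.- 2F
          -2≡ = FP.solve 0 ((FP.:- FP.:1) FP.:- FP.:1 FP.:= FP.:- FP.:2) refl
        delta : ⟦ (1F F.- 2F F.* X) F.≟ 0F ⟧ K.* ((A⁻⁴φ₂ K.* gauss φ) K.* (φ₂ K.* C₂) K.* (qK K.* N) K.⁻¹)
          ≡ (((A2 ⊗ φ) x K.* A⁻⁴φ₂ K.* (A4 ⊗ φ) (x F.- 1F) K.* gauss φ) K.* (qK K.* N) K.⁻¹) K.* δ z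
        delta = sym (*δ-cong z ((1F F.- 2F F.* X) F.≟ 0F) to from (λ h → cong (K._* (qK K.* N) K.⁻¹) (coefficient h)))

open import Data.Nat using (_^_)

theorem1p7 : (p r : ℕ) → Prime p → ¬ (p ≡ 2) → (p ^ r) % 4 ≡ 1 →
    (Fq : FiniteField p r) (K : Fld) → Fld.CharZero K →
    (ζ ω : Fld.Carrier K) (g : FiniteField.Carrier Fq) →
    let open Setup Fq K ζ ω g in
    PrimitivePthRoot → PrimitiveRoot-q-1 → Generator →
    (χ4 : Char) → IsChar χ4 → pow χ4 4 ≐ ε → ¬ (pow χ4 2 ≐ ε) →
    (A : Char) → IsChar A →
    ¬ (pow A 2 ≐ ε) → ¬ (pow A 2 ≐ φ) → ¬ (pow A 2 ≐ χ4) → ¬ (pow A 2 ≐ bar χ4) →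
    (x : FiniteField.Carrier Fq) → ¬ (x ≡ FiniteField.0# Fq) → ¬ (x ≡ FiniteField.1# Fq) →
    Thm.claim-i A χ4 x × Thm.claim-ii A χ4 x
theorem1p7 p r p-prime p≢2 q%4≡1 Fq K K-char0 ζ ω g ζ-root ω-root gen
  χ4 χ4-char χ4⁴ χ4²≢ε A A-char A²≢ε A²≢φ A²≢χ4 A²≢χ4ᵇ x x≢0 x≢1 =
  claim-i-holds x≢0 x≢1 , claim-ii-holds x≢0 x≢1
  where
  open CharacterSums Fq p-prime p≢2 q%4≡1 g gen K K-char0 ζ ω ζ-root ω-root
  open WithCharacters A χ4 A-char χ4-char χ4⁴ χ4²≢ε A²≢ε A²≢φ A²≢χ4 A²≢χ4ᵇ
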